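{- Let $S(q)=\dfrac{1}{(q;q^8)_\infty(q^4;q^8)_\infty(q^7;q^8)_\infty}$ and $T(q)=\dfrac{1}{(q^3;q^8)_\infty(q^4;q^8)_\infty(q^5;q^8)_\infty}$. For a positive integer $k$ define power series (sums over $n\ge0$) \[ \sum\rho_{1,k}(n)q^n=\frac{S^k(q)}{T^k(q)},\quad \sum\rho_{2,k}(n)q^n=\frac{T(q)S(q^k)}{S(q)T(q^k)},\quad \sum\rho_{3,k}(n)q^n=\frac{S(q)S(q^k)}{T(q)T(q^k)}, \] \[ \sum\rho_{4}(n)q^n=\frac{T(q^2)S(q^4)}{S(q^2)T(q^4)},\quad \sum\rho_{5,k}(n)q^n=\frac{S^k(-q)T^k(q)S^k(q^4)}{S^k(q)T^k(-q)T^k(q^4)},\quad \sum\rho_{6}(n)q^n=\frac{S(-q)T(q^2)S(q^3)}{T(-q)S(q^2)T(q^3)}, \] \[ \sum\rho_{7}(n)q^n=\frac{T(-q)T(q^2)S(q^3)}{S(-q)S(q^2)T(q^3)},\quad \sum\rho_{8}(n)q^n=\frac{S(q)S(-q^3)S(q^6)}{T(q)T(-q^3)T(q^6)},\quad \sum\rho_{9}(n)q^n=\frac{S(q)T(-q^3)S(q^6)}{T(q)S(-q^3)T(q^6)}, \] and denote by a prime (e.g. $\rho'_{1,k}(n)$) the coefficient of $q^n$ in the reciprocal of the corresponding series. Then for all $n\ge0$: (i) $\rho_{1,1}(2n+1)=\rho'_{1,1}(2n)$; (ii) $\rho_{1,1}(4n+2)=-\rho'_{1,1}(4n+1)$; (iii)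 $\rho_{1,2}(2n+3)=-\rho'_{1,2}(2n+1)$; (iv) $\rho_{1,2}(8n+4)=\rho'_{1,2}(8n+2)$; (v) $\rho_{1,2}(8n+6)=\rho'_{1,2}(8n+4)$; (vi) $\rho_{1,4}(4n+6)=\rho'_{1,2}(4n+2)$; (vii) $\rho_{2,3}(4n+5)=-\rho'_{2,3}(4n+3)$; (viii) $\rho_{2,5}(4n+6)=-\rho'_{2,5}(4n+2)$; (ix) $\rho_{2,7}(4n+7)=-\rho'_{2,7}(4n+1)$; (x) $\rho_{2,9}(4n+10)=-\rho'_{2,9}(4n+2)$; (xi) $\rho_{3,3}(4n+6)=-\rho'_{3,3}(4n+2)$; (xii) $\rho_{3,5}(4n+7)=-\rho'_{3,5}(4n+1)$; (xiii) $\rho_{3,9}(4n+11)=-\rho'_{3,9}(4n+1)$; (xiv) $\rho_4(4n+2)=-\rho'_4(4n)$; (xv) $\rho_{5,1}(4n+6)=-\rho'_{5,1}(4n+2)$; (xvi) $\rho_{5,1}(4n+7)=\rho'_{5,1}(4n+3)$; (xvii) $\rho_{5,1}(8n+4)=-\rho'_{5,1}(8n)$; (xviii) $\rho_{5,1}(8n+5)=\rho'_{5,1}(8n+1)$; (xix) $\rho_{5,2}(8n+12)=-\rho'_{5,2}(8n+4)$; (xx) $\rho_6(4n+5)=-\rho'_6(4n+3)$; (xxi) $\rho_7(8n)=-\rho'_7(8n)$; (xxii) $\rho_8(8n+13)=-\rho'_8(8n+3)$; (xxiii) $\rho_9(4n+6)=-\rho'_9(4n+2)$.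
   Context: $(a;q)_\infty=\prod_{j\ge0}(1-aq^j)$, $q$ a formal variable (or complex with $|q|<1$). $S(q),T(q)$ are the Ramanujan–Göllnitz–Gordon functions in product form; all series above have constant term $1$.
   Formalization: Item (vi) as printed is false at n=0 (−6 versus 1) and is proved as ρ_{1,4}(4n+6) = −ρ'_{1,4}(4n+2); item (xxi) is false at n=0 (1 = −1) and is proved for n≥1 only. -}

module Defs where

open import Data.Nat as ℕ using (ℕ; zero; suc; _∸_; NonZero; _≤ᵇ_; _≡ᵇ_)
open import Data.Nat.DivMod using (_/_; _%_)
open import Data.Integer using (ℤ; 0ℤ; 1ℤ; _+_; _*_; -_)
open import Data.Bool using (if_then_else_)
open import Data.List using (List; []; _∷_)

-- Formal power series over ℤ in q: the coefficient sequence.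
PS : Set
PS = ℕ → ℤ

sumTo : ℕ → (ℕ → ℤ) → ℤ
sumTo zero h = h 0
sumTo (suc n) h = sumTo n h + h (suc n)

_⊛_ : PS → PS → PS
(f ⊛ g) n = sumTo n (λ i → f i * g (n ∸ i))
infixl 7 _⊛_

onePS : PS
onePS zero = 1ℤ
onePS (suc _) = 0ℤ

powPS : ℕ → PS → PS
powPS zero f = onePS
powPS (suc k) f = f ⊛ powPS k f

-- Multiplicative inverse of a series with constant term 1:
-- g 0 = 1, g n = - Σ_{i=1}^{n} f i * g (n - i).
-- invRev f n = [g n, g (n-1), ..., g 0]
private
  dotFrom : PS → ℕ → List ℤ → ℤ
  dotFrom f k [] = 0ℤ
  dotFrom f k (x ∷ xs) = f k * x + dotFrom f (suc k) xs

  invRev : PS → ℕ → List ℤ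
  invRev f zero = 1ℤ ∷ []
  invRev f (suc n) = let gs = invRev f n in (- dotFrom f 1 gs) ∷ gs

  headℤ : List ℤ → ℤ
  headℤ [] = 0ℤ
  headℤ (x ∷ _) = x

inv : PS → PS
inv f n = headℤ (invRev f n)

-- f / g  (g with constant term 1)
_⊘_ : PS → PS → PS
f ⊘ g = f ⊛ inv g
infixl 7 _⊘_

times1-q^ : ℕ → PS → PS
times1-q^ m f n = if m ≤ᵇ n then f n + - f (n ∸ m) else f n

finPoch : ℕ → ℕ → ℕ → PS
finPoch a d zero = onePS
finPoch a d (suc N) = times1-q^ (a ℕ.+ d ℕ.* N) (finPoch a d N)

-- (q^a ; q^d)_∞ as a formal power series (a ≥ 1, d ≥ 1): the coefficient of q^n
-- only involves the factors with a + d j ≤ n, all of which have j < n + 1.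
poch : ℕ → ℕ → PS
poch a d n = finPoch a d (suc n) n

dil : (k : ℕ) → .{{NonZero k}} → PS → PS
dil k f n = if (n % k) ≡ᵇ 0 then f (n / k) else 0ℤ

sgn : ℕ → ℤ
sgn zero = 1ℤ
sgn (suc n) = - sgn n

neg : PS → PS
neg f n = sgn n * f n

S : PS
S = inv (poch 1 8 ⊛ poch 4 8 ⊛ poch 7 8)

T : PS
T = inv (poch 3 8 ⊛ poch 4 8 ⊛ poch 5 8)

ρ₁ : ℕ → PS
ρ₁ k = powPS k S ⊘ powPS k T

ρ₂ : (k : ℕ) → .{{NonZero k}} → PS
ρ₂ k = (T ⊛ dil k S) ⊘ (S ⊛ dil k T)

ρ₃ : (k : ℕ) → .{{NonZero k}} → PS
ρ₃ k = (S ⊛ dil k S) ⊘ (T ⊛ dil k T)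

ρ₄ : PS
ρ₄ = (dil 2 T ⊛ dil 4 S) ⊘ (dil 2 S ⊛ dil 4 T)

ρ₅ : ℕ → PS
ρ₅ k = (powPS k (neg S) ⊛ powPS k T ⊛ powPS k (dil 4 S))
     ⊘ (powPS k S ⊛ powPS k (neg T) ⊛ powPS k (dil 4 T))

ρ₆ : PS
ρ₆ = (neg S ⊛ dil 2 T ⊛ dil 3 S) ⊘ (neg T ⊛ dil 2 S ⊛ dil 3 T)

ρ₇ : PS
ρ₇ = (neg T ⊛ dil 2 T ⊛ dil 3 S) ⊘ (neg S ⊛ dil 2 S ⊛ dil 3 T)

-- S(-q^3) = (neg S)(q^3)
ρ₈ : PS
ρ₈ = (S ⊛ dil 3 (neg S) ⊛ dil 6 S) ⊘ (T ⊛ dil 3 (neg T) ⊛ dil 6 T)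

ρ₉ : PS
ρ₉ = (S ⊛ dil 3 (neg T) ⊛ dil 6 S) ⊘ (T ⊛ dil 3 (neg S) ⊛ dil 6 T)

ρ₁′ : ℕ → PS
ρ₁′ k = inv (ρ₁ k)
ρ₂′ : (k : ℕ) → .{{NonZero k}} → PS
ρ₂′ k = inv (ρ₂ k)
ρ₃′ : (k : ℕ) → .{{NonZero k}} → PS
ρ₃′ k = inv (ρ₃ k)
ρ₄′ ρ₆′ ρ₇′ ρ₈′ ρ₉′ : PS
ρ₄′ = inv ρ₄
ρ₆′ = inv ρ₆
ρ₇′ = inv ρ₇
ρ₈′ = inv ρ₈
ρ₉′ = inv ρ₉
ρ₅′ : ℕ → PS
ρ₅′ k = inv (ρ₅ k)

{-# OPTIONS --safe #-}

-- With S and T as products, G = S/T is a quotient of two theta series of exponents 4x² + x and 4x² + 3x, by Jacobi's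
-- triple product.  For φ(q) = Σ q^{x²} and ψ(q) = Σ_{x ∈ ℤ} q^{2x² + x} = Σ_{n ≥ 0} q^{n(n+1)/2} this gives Ramanujan's
-- relations G − q/G = φ(q²)/ψ(q⁴) and G + q/G = φ(q)/ψ(q⁴).  Each of the series is a product A of dilations of
-- G and 1/G (note G(q)G(−q) = G(q²)), and each claim says that A ± q^d/A vanishes on an arithmetic progression.
-- Ramanujan's relations turn A ± q^d/A into a polynomial in φ(q^k) divided by a product of ψ(q^{4k}), and 2-dissections
-- of φ(q), φ(q)², ψ(q)², ψ(q)ψ(q³) and φ(q)φ(q⁷) show which residue classes of exponents survive.  The dissections are
-- changes of variables in binary quadratic forms.
module Submission where

-- If A + B, A - B, C + D, C - D are all known from Ramanujan's relations, then (A + B)(C + D) plus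
-- or minus (A - B)(C - D) isolates AC + BD or AD + BC. This linearises products of several G's, at
-- the cost of a factor 2, 4 or 8 and a power of q, which can be cancelled in the domain ℤ⟦q⟧.
-- Counting residues is often not enough: the class that should vanish contains a term. The
-- dissections then show that its numerator is a monomial times the very product of ψ's in the
-- denominator, so that the whole class collapses to one monomial c q^l. This is why many
-- progressions begin above their modulus: they start just after that monomial. The denominators are
-- series in q⁴, so claims modulo 8 need more. For G² the identity φ(q⁴)/ψ(q⁴)² = 1/ψ(q⁸) suffices.
-- For ρ₇ and ρ₈ the denominator ψ(q)ψ(q³), taken at q⁴, is rationalised by ψ(-q)ψ(-q³), and one
-- parity class of the resulting quotient turns out to be a single monomial.

open import Algebra.Bundles using (CommutativeRing)
import Algebra.Properties.Group as GroupProperties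
import Algebra.Solver.Ring
import Algebra.Solver.Ring.AlmostCommutativeRing as ACR
open import Data.Bool using (true; false; if_then_else_)
import Data.Bool as Bool
open import Data.Empty using (⊥; ⊥-elim)
open import Data.Integer using (ℤ; +_; -[1+_]; 0ℤ; 1ℤ; -_)
import Data.Integer as ℤ
import Data.Integer.DivMod as ℤD
import Data.Integer.Properties as ℤP
open import Data.Integer.Solver using (module +-*-Solver)
import Data.Integer.Tactic.RingSolver as ℤRing
open import Data.List using (List; []; _∷_; _++_; map; cartesianProductWith; cartesianProduct; applyUpTo; upTo; length; filter)
import Data.List.Membership.DecPropositional as DecMembership
open import Data.List.Membership.Propositional using (_∈_; _∉_)
import Data.List.Membership.Propositional.Properties as ∈P
open import Data.List.Membership.Propositional.Properties.WithK using (unique∧set⇒bag)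
open import Data.List.Relation.Binary.BagAndSetEquality using (∼bag⇒↭)
open import Data.List.Relation.Binary.Permutation.Propositional.Properties using (↭-length)
import Data.List.Relation.Unary.All as All
open import Data.List.Relation.Unary.AllPairs using ([]; _∷_)
open import Data.List.Relation.Unary.Any using (here; there)
open import Data.List.Relation.Unary.Unique.Propositional using (Unique)
import Data.List.Relation.Unary.Unique.Propositional.Properties as UniqueP
open import Data.Maybe using (Maybe; just; nothing)
open import Data.Nat using (ℕ; zero; suc; _+_; _*_; _∸_; _≤_; _<_; z≤n; s≤s; _≤ᵇ_; _≡ᵇ_; NonZero)
import Data.Nat as ℕ
open import Data.Nat.DivMod using (_/_; _%_)
import Data.Nat.DivMod as ℕD
import Data.Nat.Properties as ℕP
open import Data.Product using (Σ; _×_; _,_; proj₁; proj₂)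
open import Data.Sum using (_⊎_; inj₁; inj₂; [_,_]′)
import Data.Sum as Sum
open import Data.Unit using (⊤; tt)
open import Function using (_∘_; id)
open import Function.Bundles using (mk⇔)
open import Relation.Binary.Bundles using (Setoid)
open import Relation.Binary.PropositionalEquality using (_≡_; _≢_; refl; sym; trans; cong; cong₂; subst; module ≡-Reasoning)
import Relation.Binary.Reasoning.Setoid as SetoidReasoning
open import Relation.Nullary using (Dec; yes; no)
open import Relation.Nullary.Decidable using (False; toWitnessFalse; True; toWitness)
open import Tactic.Cong using (cong!)
open import Defs

-- partialDot is the private recursion behind inv. Two of its intermediate sums become visible when inv f (2 + n) and
-- inv f (3 + n) unfold; they are the values at 1 and 2 of one function, and cong! reconstructs that function.
private
  matchTails : ∀ f n {a b : ℤ}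
    → inv f (2 + n) ≡ - (f 1 ℤ.* inv f (1 + n) ℤ.+ a)
    → inv f (3 + n) ≡ - (f 1 ℤ.* inv f (2 + n) ℤ.+ (f 2 ℤ.* inv f (1 + n) ℤ.+ b))
    → a ≡ b → Σ ℤ λ a → Σ ℤ λ b → a ≡ b
  matchTails f n {a} {b} _ _ p = a , b , p

  tails : (f : PS) (n : ℕ) → 1 ≡ 2 → Σ ℤ λ a → Σ ℤ λ b → a ≡ b
  tails f n e = matchTails f n refl refl (cong! e)

  data IsCong (F : ℕ → ℤ) {x y : ℕ} (e : x ≡ y) : {a b : ℤ} → a ≡ b → Set where
    isCong : IsCong F e {F x} {F y} (cong F e)

  tailFunction : (f : PS) (n : ℕ) → Σ (ℕ → ℤ) λ F → (e : 1 ≡ 2) → IsCong F e (proj₂ (proj₂ (tails f n e)))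
  tailFunction f n = _ , λ e → isCong

partialDot : PS → ℕ → ℕ → ℤ
partialDot f n = proj₁ (tailFunction f n)

-- Finite sums of integers

sumTo-cong : ∀ n {f g : ℕ → ℤ} → (∀ i → i ≤ n → f i ≡ g i) → sumTo n f ≡ sumTo n g
sumTo-cong zero h = h 0 z≤n
sumTo-cong (suc n) h =
  cong₂ ℤ._+_ (sumTo-cong n (λ i i≤n → h i (ℕP.m≤n⇒m≤1+n i≤n))) (h (suc n) ℕP.≤-refl)

sumTo-zero : ∀ n {f : ℕ → ℤ} → (∀ i → i ≤ n → f i ≡ 0ℤ) → sumTo n f ≡ 0ℤ
sumTo-zero zero h = h 0 z≤n
sumTo-zero (suc n) h =
  cong₂ ℤ._+_ (sumTo-zero n (λ i i≤n → h i (ℕP.m≤n⇒m≤1+n i≤n))) (h (suc n) ℕP.≤-refl)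

sumTo-+ : ∀ n (f g : ℕ → ℤ) → sumTo n (λ i → f i ℤ.+ g i) ≡ sumTo n f ℤ.+ sumTo n g
sumTo-+ zero f g = refl
sumTo-+ (suc n) f g rewrite sumTo-+ n f g = interchange (sumTo n f) (sumTo n g) (f (suc n)) (g (suc n))
  where
  interchange : ∀ a b c d → a ℤ.+ b ℤ.+ (c ℤ.+ d) ≡ a ℤ.+ c ℤ.+ (b ℤ.+ d)
  interchange = ℤRing.solve-∀

sumTo-*ˡ : ∀ n c (f : ℕ → ℤ) → sumTo n (λ i → c ℤ.* f i) ≡ c ℤ.* sumTo n f
sumTo-*ˡ zero c f = refl
sumTo-*ˡ (suc n) c f rewrite sumTo-*ˡ n c f = sym (ℤP.*-distribˡ-+ c (sumTo n f) (f (suc n)))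

sumTo-*ʳ : ∀ n c (f : ℕ → ℤ) → sumTo n (λ i → f i ℤ.* c) ≡ sumTo n f ℤ.* c
sumTo-*ʳ zero c f = refl
sumTo-*ʳ (suc n) c f rewrite sumTo-*ʳ n c f = sym (ℤP.*-distribʳ-+ c (sumTo n f) (f (suc n)))

sumTo-first : ∀ n (f : ℕ → ℤ) → sumTo (suc n) f ≡ f 0 ℤ.+ sumTo n (f ∘ suc)
sumTo-first zero f = refl
sumTo-first (suc n) f rewrite sumTo-first n f = ℤP.+-assoc (f 0) _ _

sumTo-reverse : ∀ n (f : ℕ → ℤ) → sumTo n f ≡ sumTo n (λ i → f (n ∸ i))
sumTo-reverse zero f = refl
sumTo-reverse (suc n) f = begin
  sumTo n f ℤ.+ f (suc n) ≡⟨ cong (λ s → s ℤ.+ f (suc n)) (sumTo-reverse n f) ⟩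
  sumTo n (λ i → f (n ∸ i)) ℤ.+ f (suc n) ≡⟨ ℤP.+-comm _ (f (suc n)) ⟩
  f (suc n) ℤ.+ sumTo n (λ i → f (n ∸ i)) ≡⟨ sumTo-first n (λ i → f (suc n ∸ i)) ⟨
  sumTo (suc n) (λ i → f (suc n ∸ i)) ∎
  where open ≡-Reasoning

-- Interchange of summation over the triangle j ≤ i ≤ n; associativity of the convolution rests on
-- it.
sumTo-triangle : ∀ n (A : ℕ → ℕ → ℤ) →
  sumTo n (λ i → sumTo i (λ j → A j (i ∸ j))) ≡ sumTo n (λ j → sumTo (n ∸ j) (A j))
sumTo-triangle zero A = refl
sumTo-triangle (suc n) A = begin
  sumTo n (λ i → sumTo i (λ j → A j (i ∸ j))) ℤ.+ (sumTo n (λ j → A j (suc n ∸ j)) ℤ.+ A (suc n) (n ∸ n))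
    ≡⟨ ℤP.+-assoc (sumTo n (λ i → sumTo i (λ j → A j (i ∸ j)))) (sumTo n (λ j → A j (suc n ∸ j))) (A (suc n) (n ∸ n)) ⟨
  sumTo n (λ i → sumTo i (λ j → A j (i ∸ j))) ℤ.+ sumTo n (λ j → A j (suc n ∸ j)) ℤ.+ A (suc n) (n ∸ n)
    ≡⟨ cong (λ s → s ℤ.+ sumTo n (λ j → A j (suc n ∸ j)) ℤ.+ A (suc n) (n ∸ n)) (sumTo-triangle n A) ⟩
  sumTo n (λ j → sumTo (n ∸ j) (A j)) ℤ.+ sumTo n (λ j → A j (suc n ∸ j)) ℤ.+ A (suc n) (n ∸ n)
    ≡⟨ cong₂ ℤ._+_ (sym (sumTo-+ n _ _)) (cong (A (suc n)) (ℕP.n∸n≡0 n)) ⟩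
  sumTo n (λ j → sumTo (n ∸ j) (A j) ℤ.+ A j (suc n ∸ j)) ℤ.+ A (suc n) 0
    ≡⟨ cong₂ ℤ._+_ (sumTo-cong n column) (cong (λ k → sumTo k (A (suc n))) (sym (ℕP.n∸n≡0 n))) ⟩
  sumTo n (λ j → sumTo (suc n ∸ j) (A j)) ℤ.+ sumTo (n ∸ n) (A (suc n)) ∎
  where
  open ≡-Reasoning
  column : ∀ j → j ≤ n → sumTo (n ∸ j) (A j) ℤ.+ A j (suc n ∸ j) ≡ sumTo (suc n ∸ j) (A j)
  column j j≤n rewrite ℕP.+-∸-assoc 1 j≤n = refl

-- The commutative ring of formal power series

infix 4 _≈_
record _≈_ (f g : PS) : Set where
  constructor coeffwise
  field at : ∀ n → f n ≡ g n
open _≈_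

infixl 7 _·_
infixl 6 _⊕_
infix 8 ⊟_

-- Opaque, so that unification of series (which are functions) stops at the ring operations.
opaque
  _·_ : PS → PS → PS
  _·_ = _⊛_

  _⊕_ : PS → PS → PS
  (f ⊕ g) n = f n ℤ.+ g n

  ⊟_ : PS → PS
  (⊟ f) n = - f n

ι : ℤ → PS
ι c zero = c
ι c (suc _) = 0ℤ

zeroPS : PS
zeroPS _ = 0ℤ

⊛-at-cong : ∀ {f f′ g g′ : PS} n → (∀ i → i ≤ n → f i ≡ f′ i) → (∀ i → i ≤ n → g i ≡ g′ i) → (f ⊛ g) n ≡ (f′ ⊛ g′) n
⊛-at-cong n hf hg = sumTo-cong n (λ i i≤n → cong₂ ℤ._*_ (hf i i≤n) (hg (n ∸ i) (ℕP.m∸n≤m n i)))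

≈-refl : ∀ {f} → f ≈ f
≈-refl .at n = refl

≈-sym : ∀ {f g} → f ≈ g → g ≈ f
≈-sym p .at n = sym (p .at n)

≈-trans : ∀ {f g h} → f ≈ g → g ≈ h → f ≈ h
≈-trans p q .at n = trans (p .at n) (q .at n)

constant-⊛ : ∀ c f n → (ι c ⊛ f) n ≡ c ℤ.* f n
constant-⊛ c f zero = refl
constant-⊛ c f (suc n) = trans (sumTo-first n _)
  (trans (cong (λ s → c ℤ.* f (suc n) ℤ.+ s) (sumTo-zero n (λ i _ → ℤP.*-zeroˡ (f (n ∸ i))))) (ℤP.+-identityʳ _))

onePS≈constant : onePS ≈ ι 1ℤ
onePS≈constant .at zero = refl
onePS≈constant .at (suc n) = refl

opaque
  unfolding _·_ _⊕_ ⊟_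

  ·≈⊛ : ∀ f g → f · g ≈ f ⊛ g
  ·≈⊛ f g = ≈-refl

  ·-cong : ∀ {f f′ g g′} → f ≈ f′ → g ≈ g′ → f · g ≈ f′ · g′
  ·-cong p q .at n = ⊛-at-cong n (λ i _ → p .at i) (λ i _ → q .at i)

  ⊕-cong : ∀ {f f′ g g′} → f ≈ f′ → g ≈ g′ → f ⊕ g ≈ f′ ⊕ g′
  ⊕-cong p q .at n = cong₂ ℤ._+_ (p .at n) (q .at n)

  ⊟-cong : ∀ {f f′} → f ≈ f′ → ⊟ f ≈ ⊟ f′
  ⊟-cong p .at n = cong -_ (p .at n)

  ⊕-assoc : ∀ f g h → (f ⊕ g) ⊕ h ≈ f ⊕ (g ⊕ h)
  ⊕-assoc f g h .at n = ℤP.+-assoc (f n) (g n) (h n)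

  ⊕-comm : ∀ f g → f ⊕ g ≈ g ⊕ f
  ⊕-comm f g .at n = ℤP.+-comm (f n) (g n)

  ⊕-identityˡ : ∀ f → zeroPS ⊕ f ≈ f
  ⊕-identityˡ f .at n = ℤP.+-identityˡ (f n)

  ⊕-inverseˡ : ∀ f → ⊟ f ⊕ f ≈ zeroPS
  ⊕-inverseˡ f .at n = ℤP.+-inverseˡ (f n)

  ·-comm : ∀ f g → f · g ≈ g · f
  ·-comm f g .at n = trans (sumTo-reverse n _) (sumTo-cong n (λ i i≤n →
    trans (cong (λ k → f (n ∸ i) ℤ.* g k) (ℕP.m∸[m∸n]≡n i≤n)) (ℤP.*-comm (f (n ∸ i)) (g i))))

  ·-assoc : ∀ f g h → (f · g) · h ≈ f · (g · h)
  ·-assoc f g h .at n = begin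
    sumTo n (λ i → sumTo i (λ j → f j ℤ.* g (i ∸ j)) ℤ.* h (n ∸ i))
      ≡⟨ sumTo-cong n (λ i i≤n → trans (sym (sumTo-*ʳ i (h (n ∸ i)) _))
           (sumTo-cong i (λ j j≤i → cong (λ k → f j ℤ.* g (i ∸ j) ℤ.* h (n ∸ k)) (sym (ℕP.m+[n∸m]≡n j≤i))))) ⟩
    sumTo n (λ i → sumTo i (λ j → A j (i ∸ j)))
      ≡⟨ sumTo-triangle n A ⟩
    sumTo n (λ j → sumTo (n ∸ j) (A j))
      ≡⟨ sumTo-cong n (λ j j≤n → trans (sumTo-cong (n ∸ j) (λ k k≤ →
           trans (ℤP.*-assoc (f j) (g k) _) (cong (λ m → f j ℤ.* (g k ℤ.* h m)) (sym (ℕP.∸-+-assoc n j k)))))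
           (sumTo-*ˡ (n ∸ j) (f j) _)) ⟩
    sumTo n (λ j → f j ℤ.* sumTo (n ∸ j) (λ k → g k ℤ.* h (n ∸ j ∸ k))) ∎
    where
    open ≡-Reasoning
    A : ℕ → ℕ → ℤ
    A j k = f j ℤ.* g k ℤ.* h (n ∸ (j + k))

  ·-identityˡ : ∀ f → onePS · f ≈ f
  ·-identityˡ f .at n = trans (⊛-at-cong {g = f} n (λ i _ → onePS≈constant .at i) (λ _ _ → refl))
    (trans (constant-⊛ 1ℤ f n) (ℤP.*-identityˡ (f n)))

  ·-distribˡ : ∀ f g h → f · (g ⊕ h) ≈ f · g ⊕ f · h
  ·-distribˡ f g h .at n =
    trans (sumTo-cong n (λ i _ → ℤP.*-distribˡ-+ (f i) (g (n ∸ i)) (h (n ∸ i)))) (sumTo-+ n _ _)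

  ·-constantTerm : ∀ f g → f 0 ≡ 1ℤ → g 0 ≡ 1ℤ → (f · g) 0 ≡ 1ℤ
  ·-constantTerm f g f0 g0 = cong₂ ℤ._*_ f0 g0

  constant-· : ∀ c f n → (ι c · f) n ≡ c ℤ.* f n
  constant-· = constant-⊛

  constant-⊕ : ∀ c d → ι (c ℤ.+ d) ≈ ι c ⊕ ι d
  constant-⊕ c d .at zero = refl
  constant-⊕ c d .at (suc n) = refl

  constant-⊟ : ∀ c → ι (- c) ≈ ⊟ ι c
  constant-⊟ c .at zero = refl
  constant-⊟ c .at (suc n) = refl

  constant-* : ∀ c d → ι (c ℤ.* d) ≈ ι c · ι d
  constant-* c d .at zero = refl
  constant-* c d .at (suc n) = sym (trans (constant-⊛ c (ι d) (suc n)) (ℤP.*-zeroʳ c))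

  ⊕-at : ∀ f g n → (f ⊕ g) n ≡ f n ℤ.+ g n
  ⊕-at f g n = refl

  ⊟-at : ∀ f n → (⊟ f) n ≡ - f n
  ⊟-at f n = refl

·-congˡ : ∀ {f g g′} → g ≈ g′ → f · g ≈ f · g′
·-congˡ = ·-cong ≈-refl

·-congʳ : ∀ {f f′ g} → f ≈ f′ → f · g ≈ f′ · g
·-congʳ p = ·-cong p ≈-refl

⊕-congʳ : ∀ {f f′ g} → f ≈ f′ → f ⊕ g ≈ f′ ⊕ g
⊕-congʳ p = ⊕-cong p ≈-refl

⊕-congˡ : ∀ {f g g′} → g ≈ g′ → f ⊕ g ≈ f ⊕ g′
⊕-congˡ = ⊕-cong ≈-refl

≈-setoid : Setoid _ _
≈-setoid = record { Carrier = PS ; _≈_ = _≈_ ; isEquivalence = record { refl = ≈-refl ; sym = ≈-sym ; trans = ≈-trans } }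

open import Algebra.Consequences.Setoid ≈-setoid using (comm∧idˡ⇒id; comm∧invˡ⇒inv; comm∧distrˡ⇒distr)

psRing : CommutativeRing _ _
psRing = record
  { Carrier = PS ; _≈_ = _≈_ ; _+_ = _⊕_ ; _*_ = _·_ ; -_ = ⊟_ ; 0# = zeroPS ; 1# = onePS
  ; isCommutativeRing = record
    { isRing = record
      { +-isAbelianGroup = record
        { isGroup = record
          { isMonoid = record
            { isSemigroup = record
              { isMagma = record
                { isEquivalence = Setoid.isEquivalence ≈-setoid ; ∙-cong = ⊕-cong }
              ; assoc = ⊕-assoc }
            ; identity = comm∧idˡ⇒id ⊕-comm ⊕-identityˡ }
          ; inverse = comm∧invˡ⇒inv ⊕-comm ⊕-inverseˡ
          ; ⁻¹-cong = ⊟-cong }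
        ; comm = ⊕-comm }
      ; *-cong = ·-cong
      ; *-assoc = ·-assoc
      ; *-identity = comm∧idˡ⇒id ·-comm ·-identityˡ
      ; distrib = comm∧distrˡ⇒distr ⊕-cong ·-comm ·-distribˡ }
    ; *-comm = ·-comm } }

-- Integers act as constant series, so that the ring solver can compute with numerical coefficients.
constant-homomorphism : ACR._-Raw-AlmostCommutative⟶_ ℤ.+-*-rawRing (ACR.fromCommutativeRing psRing)
constant-homomorphism = record
  { ⟦_⟧ = ι
  ; +-homo = constant-⊕
  ; *-homo = constant-*
  ; -‿homo = constant-⊟
  ; 0-homo = coeffwise λ { zero → refl ; (suc n) → refl }
  ; 1-homo = ≈-sym onePS≈constant }

constant≟ : ∀ c d → Maybe (ι c ≈ ι d)
constant≟ c d with c ℤ.≟ d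
... | yes refl = just ≈-refl
... | no _ = nothing

open Algebra.Solver.Ring ℤ.+-*-rawRing (ACR.fromCommutativeRing psRing) constant-homomorphism constant≟
  using (solve; _:=_; _:+_; _:*_; _:-_; :-_; _:^_; con)

infixl 6 _⊖_
_⊖_ : PS → PS → PS
f ⊖ g = f ⊕ ⊟ g

-- The recursion behind `inv` meets the stored coefficients from the newest to the oldest, so its
-- partial sums are tails of a convolution. At j = 0 the tail is the whole coefficient of
-- `f · inv f` at n + 1 except for the term with `f 0`.
inv-recurrence : ∀ f n j → partialDot f n j ≡ sumTo n (λ i → f (suc j + i) ℤ.* inv f (n ∸ i))
inv-recurrence f zero j rewrite ℕP.+-identityʳ j = ℤP.+-identityʳ _
inv-recurrence f (suc n) j = begin
  f (suc j) ℤ.* inv f (suc n) ℤ.+ partialDot f n (suc j)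
    ≡⟨ cong₂ ℤ._+_ (cong (λ k → f (suc k) ℤ.* inv f (suc n)) (sym (ℕP.+-identityʳ j))) (inv-recurrence f n (suc j)) ⟩
  f (suc j + 0) ℤ.* inv f (suc n) ℤ.+ sumTo n (λ i → f (suc (suc j) + i) ℤ.* inv f (n ∸ i))
    ≡⟨ cong (λ s → f (suc j + 0) ℤ.* inv f (suc n) ℤ.+ s)
         (sumTo-cong n (λ i _ → cong (λ k → f (suc k) ℤ.* inv f (n ∸ i)) (sym (ℕP.+-suc j i)))) ⟩
  f (suc j + 0) ℤ.* inv f (suc n) ℤ.+ sumTo n (λ i → f (suc j + suc i) ℤ.* inv f (n ∸ i))
    ≡⟨ sumTo-first n (λ i → f (suc j + i) ℤ.* inv f (suc n ∸ i)) ⟨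
  sumTo (suc n) (λ i → f (suc j + i) ℤ.* inv f (suc n ∸ i)) ∎
  where open ≡-Reasoning

opaque
  unfolding _·_

  inv-inverse : ∀ {f} → f 0 ≡ 1ℤ → f · inv f ≈ onePS
  inv-inverse f0 .at zero = cong (ℤ._* 1ℤ) f0
  inv-inverse {f} f0 .at (suc n) = begin
    (f ⊛ inv f) (suc n)
      ≡⟨ sumTo-first n _ ⟩
    f 0 ℤ.* (- partialDot f n 0) ℤ.+ sumTo n (λ i → f (suc i) ℤ.* inv f (n ∸ i))
      ≡⟨ cong₂ (λ a b → a ℤ.* (- partialDot f n 0) ℤ.+ b) f0 (sym (inv-recurrence f n 0)) ⟩
    1ℤ ℤ.* (- partialDot f n 0) ℤ.+ partialDot f n 0
      ≡⟨ cong (λ s → s ℤ.+ partialDot f n 0) (ℤP.*-identityˡ (- partialDot f n 0)) ⟩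
    - partialDot f n 0 ℤ.+ partialDot f n 0
      ≡⟨ ℤP.+-inverseˡ (partialDot f n 0) ⟩
    0ℤ ∎
    where open ≡-Reasoning

-- Power series

module ≈-Reasoning = SetoidReasoning ≈-setoid

open DecMembership ℕ._≟_ using (_∈?_)

q^ : ℕ → PS
q^ zero = onePS
q^ (suc k) zero = 0ℤ
q^ (suc k) (suc n) = q^ k n

opaque
  unfolding _·_ _⊕_ ⊟_

  q^-suc-· : ∀ k f n → (q^ (suc k) · f) (suc n) ≡ (q^ k · f) n
  q^-suc-· k f n = trans (sumTo-first n _) (trans (cong (ℤ._+ (q^ k · f) n) (ℤP.*-zeroˡ (f (suc n)))) (ℤP.+-identityˡ _))

  q^-· : ∀ k f n → (q^ k · f) (k + n) ≡ f n
  q^-· zero f n = ·-identityˡ f .at n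
  q^-· (suc k) f n = trans (q^-suc-· k f (k + n)) (q^-· k f n)

  q^-+ : ∀ j k → q^ j · q^ k ≈ q^ (j + k)
  q^-+ zero k = ·-identityˡ (q^ k)
  q^-+ (suc j) k .at zero = ℤP.*-zeroˡ (q^ k 0)
  q^-+ (suc j) k .at (suc n) = trans (q^-suc-· j (q^ k) n) (q^-+ j k .at n)

q^-diagonal : ∀ k → q^ k k ≡ 1ℤ
q^-diagonal zero = refl
q^-diagonal (suc k) = q^-diagonal k

q^-off : ∀ {k n} → n ≢ k → q^ k n ≡ 0ℤ
q^-off {zero} {zero} n≢k = ⊥-elim (n≢k refl)
q^-off {zero} {suc n} n≢k = refl
q^-off {suc k} {zero} n≢k = refl
q^-off {suc k} {suc n} n≢k = q^-off (n≢k ∘ cong suc)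

q^-cancel : ∀ k {f g} → q^ k · f ≈ q^ k · g → f ≈ g
q^-cancel k {f} {g} p .at n = trans (sym (q^-· k f n)) (trans (p .at (k + n)) (q^-· k g n))

opaque
  unfolding _·_ _⊕_ ⊟_

  -- The coefficient of q^m in f · w is f 0 · w m plus terms in lower coefficients of w, which
  -- vanish by induction. The bound n on m makes this course-of-values induction structural.
  regular-constantTerm : ∀ {f w} → f 0 ≢ 0ℤ → f · w ≈ zeroPS → w ≈ zeroPS
  regular-constantTerm {f} {w} f0 fw .at n = vanish n n ℕP.≤-refl
    where
    zero-divisor : ∀ x → f 0 ℤ.* x ≡ 0ℤ → x ≡ 0ℤ
    zero-divisor x p with ℤP.i*j≡0⇒i≡0∨j≡0 (f 0) p
    ... | inj₁ z = ⊥-elim (f0 z)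
    ... | inj₂ z = z
    vanish : ∀ n m → m ≤ n → w m ≡ 0ℤ
    vanish n zero _ = zero-divisor (w 0) (fw .at 0)
    vanish (suc n) (suc m) (s≤s m≤n) = zero-divisor (w (suc m)) (begin
      f 0 ℤ.* w (suc m) ≡⟨ ℤP.+-identityʳ _ ⟨
      f 0 ℤ.* w (suc m) ℤ.+ 0ℤ ≡⟨ cong (λ s → f 0 ℤ.* w (suc m) ℤ.+ s) (sumTo-zero m lower) ⟨
      f 0 ℤ.* w (suc m) ℤ.+ sumTo m (λ i → f (suc i) ℤ.* w (m ∸ i)) ≡⟨ sumTo-first m (λ i → f i ℤ.* w (suc m ∸ i)) ⟨
      (f · w) (suc m) ≡⟨ fw .at (suc m) ⟩
      0ℤ ∎)
      where
      open ≡-Reasoning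
      lower : ∀ i → i ≤ m → f (suc i) ℤ.* w (m ∸ i) ≡ 0ℤ
      lower i _ = trans (cong (λ x → f (suc i) ℤ.* x) (vanish n (m ∸ i) (ℕP.≤-trans (ℕP.m∸n≤m m i) m≤n)))
                        (ℤP.*-zeroʳ (f (suc i)))

  ⊖≈zero⇒≈ : ∀ {f g} → f ⊖ g ≈ zeroPS → f ≈ g
  ⊖≈zero⇒≈ {f} {g} p .at n = ℤP.i-j≡0⇒i≡j (f n) (g n) (p .at n)

·-cancel : ∀ {f g h} → f 0 ≢ 0ℤ → f · g ≈ f · h → g ≈ h
·-cancel {f} {g} {h} f0 p = ⊖≈zero⇒≈ (regular-constantTerm f0 (begin
  f · (g ⊖ h) ≈⟨ solve 3 (λ f g h → f :* (g :- h) := f :* g :- f :* h) ≈-refl f g h ⟩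
  f · g ⊖ f · h ≈⟨ ⊕-congʳ p ⟩
  f · h ⊖ f · h ≈⟨ CommutativeRing.-‿inverseʳ psRing (f · h) ⟩
  zeroPS ∎))
  where open ≈-Reasoning

-- In the domain ℤ⟦q⟧ squares determine the series up to sign, and u + v is regular since its constant term is 2.
square-injective : ∀ {u v} → u 0 ≡ 1ℤ → v 0 ≡ 1ℤ → u · u ≈ v · v → u ≈ v
square-injective {u} {v} u0 v0 p = ⊖≈zero⇒≈ (regular-constantTerm {u ⊕ v} two (begin
  (u ⊕ v) · (u ⊖ v) ≈⟨ solve 2 (λ u v → (u :+ v) :* (u :- v) := u :* u :- v :* v) ≈-refl u v ⟩
  u · u ⊖ v · v ≈⟨ ⊕-congʳ p ⟩
  v · v ⊖ v · v ≈⟨ CommutativeRing.-‿inverseʳ psRing (v · v) ⟩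
  zeroPS ∎))
  where
  open ≈-Reasoning
  two : (u ⊕ v) 0 ≢ 0ℤ
  two eq with trans (sym (trans (⊕-at u v 0) (cong₂ ℤ._+_ u0 v0))) eq
  ... | ()

inv-unique : ∀ {f g} → f 0 ≡ 1ℤ → f · g ≈ onePS → g ≈ inv f
inv-unique {f} {g} f0 p = ·-cancel f≢0 (≈-trans p (≈-sym (inv-inverse f0)))
  where
  f≢0 : f 0 ≢ 0ℤ
  f≢0 eq with trans (sym f0) eq
  ... | ()

⊘-unique : ∀ {f g h} → g 0 ≡ 1ℤ → h · g ≈ f → f ⊘ g ≈ h
⊘-unique {f} {g} {h} g0 p = begin
  f ⊘ g ≈⟨ ·≈⊛ f (inv g) ⟨
  f · inv g ≈⟨ ·-congʳ (≈-sym p) ⟩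
  (h · g) · inv g ≈⟨ ·-assoc h g (inv g) ⟩
  h · (g · inv g) ≈⟨ ·-congˡ (inv-inverse g0) ⟩
  h · onePS ≈⟨ CommutativeRing.*-identityʳ psRing h ⟩
  h ∎
  where open ≈-Reasoning

-- The dilation q ↦ q^k

module _ (k : ℕ) .{{_ : NonZero k}} where

  data Position : ℕ → Set where
    multiple : ∀ m → Position (m * k)
    nonmultiple : ∀ {n} → n % k ≢ 0 → Position n

  position : ∀ n → Position n
  position n with n % k ℕ.≟ 0
  ... | no r≢0 = nonmultiple r≢0
  ... | yes r≡0 = subst Position (sym (trans (ℕD.m≡m%n+[m/n]*n n k) (cong (_+ n / k * k) r≡0))) (multiple (n / k))

  dil-multiple : ∀ f m → dil k f (m * k) ≡ f m
  dil-multiple f m = trans (cong (λ r → if r ≡ᵇ 0 then f (m * k / k) else 0ℤ) (ℕD.m*n%n≡0 m k)) (cong f (ℕD.m*n/n≡m m k))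

  dil-nonmultiple : ∀ f {n} → n % k ≢ 0 → dil k f n ≡ 0ℤ
  dil-nonmultiple f {n} r≢0 with n % k
  ... | zero = ⊥-elim (r≢0 refl)
  ... | suc _ = refl

  -- Compatibility of `dil` with monomials, constants, products and further dilations is reduced to
  -- this criterion, which avoids the Boolean test in its definition.
  dil-unique : ∀ {f g} → (∀ m → g (m * k) ≡ f m) → (∀ n → n % k ≢ 0 → g n ≡ 0ℤ) → g ≈ dil k f
  dil-unique {f} {g} on off .at n with position n
  ... | multiple m = trans (on m) (sym (dil-multiple f m))
  ... | nonmultiple r≢0 = trans (off n r≢0) (sym (dil-nonmultiple f r≢0))

  dil-cong : ∀ {f g} → f ≈ g → dil k f ≈ dil k g
  dil-cong p .at n with (n % k) ≡ᵇ 0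
  ... | true = p .at (n / k)
  ... | false = refl

  opaque
    unfolding _·_ _⊕_ ⊟_

    dil-⊕ : ∀ f g → dil k (f ⊕ g) ≈ dil k f ⊕ dil k g
    dil-⊕ f g .at n with (n % k) ≡ᵇ 0
    ... | true = refl
    ... | false = refl

    dil-⊟ : ∀ f → dil k (⊟ f) ≈ ⊟ dil k f
    dil-⊟ f .at n with (n % k) ≡ᵇ 0
    ... | true = refl
    ... | false = refl

  dil-q^ : ∀ j → dil k (q^ j) ≈ q^ (j * k)
  dil-q^ j = ≈-sym (dil-unique on (λ n r≢0 → q^-off (λ n≡jk → r≢0 (trans (cong (_% k) n≡jk) (ℕD.m*n%n≡0 j k)))))
    where
    on : ∀ m → q^ (j * k) (m * k) ≡ q^ j m
    on m with m ℕ.≟ j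
    ... | yes refl = trans (q^-diagonal (j * k)) (sym (q^-diagonal j))
    ... | no m≢j = trans (q^-off (m≢j ∘ ℕP.*-cancelʳ-≡ m j k)) (sym (q^-off m≢j))

  dil-constant : ∀ c → dil k (ι c) ≈ ι c
  dil-constant c = ≈-sym (dil-unique on off)
    where
    on : ∀ m → ι c (m * k) ≡ ι c m
    on zero = refl
    on (suc m) with suc m * k in eq
    ... | zero = ⊥-elim (ℕ.≢-nonZero⁻¹ (suc m * k) {{ℕP.m*n≢0 (suc m) k}} eq)
    ... | suc _ = refl
    off : ∀ n → n % k ≢ 0 → ι c n ≡ 0ℤ
    off zero r≢0 = ⊥-elim (r≢0 (ℕD.m<n⇒m%n≡m (ℕ.>-nonZero⁻¹ k)))
    off (suc n) _ = refl

  -- Between consecutive multiples of k only zeros are added: `gap` runs through such a stretch and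
  -- `last` adds the next multiple.
  sumTo-multiples : ∀ (h : ℕ → ℤ) → (∀ n → n % k ≢ 0 → h n ≡ 0ℤ) → ∀ m → sumTo (m * k) h ≡ sumTo m (λ j → h (j * k))
  sumTo-multiples h off zero = refl
  sumTo-multiples h off (suc m) = trans (last k refl) (cong (ℤ._+ h (k + m * k)) (sumTo-multiples h off m))
    where
    gap : ∀ j → j < k → sumTo (j + m * k) h ≡ sumTo (m * k) h
    gap zero _ = refl
    gap (suc j) j<k = trans (cong₂ ℤ._+_ (gap j (ℕP.<-trans ℕP.≤-refl j<k)) (off (suc j + m * k) nonzero)) (ℤP.+-identityʳ _)
      where
      nonzero : (suc j + m * k) % k ≢ 0
      nonzero eq with trans (sym (trans (ℕD.[m+kn]%n≡m%n (suc j) m k) (ℕD.m<n⇒m%n≡m j<k))) eq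
      ... | ()
    -- A separate variable l stands for k, so that matching on it exposes the successor at which
    -- `sumTo` unfolds.
    last : ∀ l → l ≡ k → sumTo (l + m * k) h ≡ sumTo (m * k) h ℤ.+ h (l + m * k)
    last zero l≡k = ⊥-elim (ℕ.≢-nonZero⁻¹ k (sym l≡k))
    last (suc l) refl = cong (ℤ._+ h (suc l + m * k)) (gap l ℕP.≤-refl)

  opaque
    unfolding _·_ _⊕_ ⊟_

    dil-· : ∀ f g → dil k (f · g) ≈ dil k f · dil k g
    dil-· f g = ≈-sym (dil-unique on off)
      where
      on : ∀ m → (dil k f · dil k g) (m * k) ≡ (f · g) m
      on m = trans (sumTo-multiples _ (λ n r≢0 → trans (cong (ℤ._* dil k g (m * k ∸ n)) (dil-nonmultiple f r≢0)) (ℤP.*-zeroˡ (dil k g (m * k ∸ n)))) m)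
        (sumTo-cong m (λ j j≤m → cong₂ ℤ._*_ (dil-multiple f j)
          (trans (cong (dil k g) (sym (ℕP.*-distribʳ-∸ k m j))) (dil-multiple g (m ∸ j)))))
      off : ∀ n → n % k ≢ 0 → (dil k f · dil k g) n ≡ 0ℤ
      off n r≢0 = sumTo-zero n term
        where
        term : ∀ i → i ≤ n → dil k f i ℤ.* dil k g (n ∸ i) ≡ 0ℤ
        term i i≤n with position i
        ... | nonmultiple i≢0 = trans (cong (ℤ._* dil k g (n ∸ i)) (dil-nonmultiple f i≢0)) (ℤP.*-zeroˡ (dil k g (n ∸ i)))
        ... | multiple m = trans (cong (dil k f (m * k) ℤ.*_) (dil-nonmultiple g rest)) (ℤP.*-zeroʳ (dil k f (m * k)))
          where
          rest : (n ∸ m * k) % k ≢ 0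
          rest eq = r≢0 (trans (cong (_% k) (sym (ℕP.m∸n+n≡m i≤n))) (trans (ℕD.[m+kn]%n≡m%n (n ∸ m * k) m k) eq))

  dil-constantTerm : ∀ f → dil k f 0 ≡ f 0
  dil-constantTerm f = dil-multiple f 0

  dil-inverse : ∀ {f g} → f · g ≈ onePS → dil k f · dil k g ≈ onePS
  dil-inverse {f} {g} p = ≈-trans (≈-sym (dil-· f g)) (≈-trans (dil-cong p) (dil-q^ 0))

dil-dil : ∀ a b .{{_ : NonZero a}} .{{_ : NonZero b}} f → dil a (dil b f) ≈ dil (b * a) {{ℕP.m*n≢0 b a}} f
dil-dil a b f = dil-unique (b * a) {{ab≢0}} on off
  where
  ab≢0 : NonZero (b * a)
  ab≢0 = ℕP.m*n≢0 b a
  on : ∀ m → dil a (dil b f) (m * (b * a)) ≡ f m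
  on m = trans (cong (dil a (dil b f)) (sym (ℕP.*-assoc m b a)))
    (trans (dil-multiple a (dil b f) (m * b)) (dil-multiple b f m))
  off : ∀ n → _%_ n (b * a) {{ab≢0}} ≢ 0 → dil a (dil b f) n ≡ 0ℤ
  off n r≢0 with position a n
  ... | nonmultiple n≢0 = dil-nonmultiple a (dil b f) n≢0
  ... | multiple m with position b m
  ... | nonmultiple m≢0 = trans (dil-multiple a (dil b f) m) (dil-nonmultiple b f m≢0)
  ... | multiple l = ⊥-elim (r≢0 (trans (cong (λ x → _%_ x (b * a) {{ab≢0}}) (ℕP.*-assoc l b a)) (ℕD.m*n%n≡0 l (b * a) {{ab≢0}})))

-- The substitution q ↦ -q

sgn-+ : ∀ m n → sgn (m + n) ≡ sgn m ℤ.* sgn n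
sgn-+ zero n = sym (ℤP.*-identityˡ (sgn n))
sgn-+ (suc m) n = trans (cong -_ (sgn-+ m n)) (ℤP.neg-distribˡ-* (sgn m) (sgn n))

sgn-square : ∀ n → sgn n ℤ.* sgn n ≡ 1ℤ
sgn-square zero = refl
sgn-square (suc n) = trans (neg-neg (sgn n)) (sgn-square n)
  where
  neg-neg : ∀ x → - x ℤ.* - x ≡ x ℤ.* x
  neg-neg = ℤRing.solve-∀

sgn-even : ∀ m → sgn (m * 2) ≡ 1ℤ
sgn-even zero = refl
sgn-even (suc m) = trans (ℤP.neg-involutive (sgn (m * 2))) (sgn-even m)

neg-cong : ∀ {f g} → f ≈ g → neg f ≈ neg g
neg-cong p .at n = cong (sgn n ℤ.*_) (p .at n)

opaque
  unfolding _·_ _⊕_ ⊟_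

  neg-⊕ : ∀ f g → neg (f ⊕ g) ≈ neg f ⊕ neg g
  neg-⊕ f g .at n = ℤP.*-distribˡ-+ (sgn n) (f n) (g n)

  neg-⊟ : ∀ f → neg (⊟ f) ≈ ⊟ neg f
  neg-⊟ f .at n = sym (ℤP.neg-distribʳ-* (sgn n) (f n))

  neg-· : ∀ f g → neg (f · g) ≈ neg f · neg g
  neg-· f g .at n = trans (sym (sumTo-*ˡ n (sgn n) _)) (sumTo-cong n term)
    where
    swap : ∀ a b x y → (a ℤ.* b) ℤ.* (x ℤ.* y) ≡ (a ℤ.* x) ℤ.* (b ℤ.* y)
    swap = ℤRing.solve-∀
    term : ∀ i → i ≤ n → sgn n ℤ.* (f i ℤ.* g (n ∸ i)) ≡ (sgn i ℤ.* f i) ℤ.* (sgn (n ∸ i) ℤ.* g (n ∸ i))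
    term i i≤n = trans (cong (ℤ._* (f i ℤ.* g (n ∸ i))) (trans (cong sgn (sym (ℕP.m+[n∸m]≡n i≤n))) (sgn-+ i (n ∸ i))))
      (swap (sgn i) (sgn (n ∸ i)) (f i) (g (n ∸ i)))

neg-neg : ∀ f → neg (neg f) ≈ f
neg-neg f .at n = trans (sym (ℤP.*-assoc (sgn n) (sgn n) (f n))) (trans (cong (ℤ._* f n) (sgn-square n)) (ℤP.*-identityˡ (f n)))

neg-constant : ∀ c → neg (ι c) ≈ ι c
neg-constant c .at zero = ℤP.*-identityˡ c
neg-constant c .at (suc n) = ℤP.*-zeroʳ (sgn (suc n))

neg-onePS : neg onePS ≈ onePS
neg-onePS .at zero = refl
neg-onePS .at (suc n) = ℤP.*-zeroʳ (sgn (suc n))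

neg-q^ : ∀ k → neg (q^ k) ≈ ι (sgn k) · q^ k
neg-q^ k .at n = trans lemma (sym (constant-· (sgn k) (q^ k) n))
  where
  lemma : sgn n ℤ.* q^ k n ≡ sgn k ℤ.* q^ k n
  lemma with n ℕ.≟ k
  ... | yes refl = refl
  ... | no n≢k rewrite q^-off n≢k = trans (ℤP.*-zeroʳ (sgn n)) (sym (ℤP.*-zeroʳ (sgn k)))

neg-dil-even : ∀ k .{{_ : NonZero k}} {k-even : True (k % 2 ℕ.≟ 0)} f → neg (dil k f) ≈ dil k f
neg-dil-even k {k-even} f .at n with position k n
... | multiple m = trans (cong (ℤ._* dil k f (m * k)) even) (ℤP.*-identityˡ _)
  where
  even : sgn (m * k) ≡ 1ℤ
  even = trans (cong sgn (trans (cong (m *_) (trans (ℕD.m≡m%n+[m/n]*n k 2) (cong (_+ k / 2 * 2) (toWitness k-even))))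
    (sym (ℕP.*-assoc m (k / 2) 2)))) (sgn-even (m * (k / 2)))
... | nonmultiple r≢0 rewrite dil-nonmultiple k f r≢0 = ℤP.*-zeroʳ (sgn n)

neg-inverse : ∀ {f g} → f · g ≈ onePS → neg f · neg g ≈ onePS
neg-inverse {f} {g} p = ≈-trans (≈-sym (neg-· f g)) (≈-trans (neg-cong p) neg-onePS)

-- The list is an upper bound for the residues of the support and may contain repetitions. It is
-- assembled by the rules below and evaluated by the type checker, so that vanishing on a
-- progression becomes a decidable non-membership.
Within : (m : ℕ) .{{_ : NonZero m}} → List ℕ → PS → Set
Within m R f = ∀ n → f n ≡ 0ℤ ⊎ n % m ∈ R

module _ {m : ℕ} .{{_ : NonZero m}} where

  sumset : List ℕ → List ℕ → List ℕ
  sumset = cartesianProductWith (λ a b → (a + b) % m)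

  within-cong : ∀ {R f g} → f ≈ g → Within m R f → Within m R g
  within-cong p w n with w n
  ... | inj₁ z = inj₁ (trans (sym (p .at n)) z)
  ... | inj₂ r = inj₂ r

  opaque
    unfolding _·_ _⊕_ ⊟_

    within-· : ∀ {R R′ f g} → Within m R f → Within m R′ g → Within m (sumset R R′) (f · g)
    within-· {R} {R′} {f} {g} wf wg n with (n % m) ∈? sumset R R′
    ... | yes r = inj₂ r
    ... | no ¬r = inj₁ (sumTo-zero n term)
      where
      term : ∀ i → i ≤ n → f i ℤ.* g (n ∸ i) ≡ 0ℤ
      term i i≤n with wf i | wg (n ∸ i)
      ... | inj₁ z | _ = trans (cong (ℤ._* g (n ∸ i)) z) (ℤP.*-zeroˡ (g (n ∸ i)))
      ... | inj₂ _ | inj₁ z = trans (cong (f i ℤ.*_) z) (ℤP.*-zeroʳ (f i))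
      ... | inj₂ r | inj₂ s = ⊥-elim (¬r (subst (_∈ sumset R R′) residue (∈P.∈-cartesianProductWith⁺ (λ a b → (a + b) % m) r s)))
        where
        residue : (i % m + (n ∸ i) % m) % m ≡ n % m
        residue = trans (sym (ℕD.%-distribˡ-+ i (n ∸ i) m)) (cong (_% m) (ℕP.m+[n∸m]≡n i≤n))

    within-⊕ : ∀ {R R′ f g} → Within m R f → Within m R′ g → Within m (R ++ R′) (f ⊕ g)
    within-⊕ {R} wf wg n with wf n | wg n
    ... | inj₁ z | inj₁ z′ = inj₁ (cong₂ ℤ._+_ z z′)
    ... | inj₂ r | _ = inj₂ (∈P.∈-++⁺ˡ r)
    ... | inj₁ _ | inj₂ r = inj₂ (∈P.∈-++⁺ʳ R r)

    within-⊟ : ∀ {R f} → Within m R f → Within m R (⊟ f)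
    within-⊟ w n with w n
    ... | inj₁ z = inj₁ (cong -_ z)
    ... | inj₂ r = inj₂ r

  within-q^ : ∀ k → Within m (k % m ∷ []) (q^ k)
  within-q^ k n with n ℕ.≟ k
  ... | yes refl = inj₂ (here refl)
  ... | no n≢k = inj₁ (q^-off n≢k)

  within-constant : ∀ c → Within m (0 % m ∷ []) (ι c)
  within-constant c zero = inj₂ (here refl)
  within-constant c (suc n) = inj₁ refl

  within-dil : ∀ k .{{_ : NonZero k}} {m∣k : True (k % m ℕ.≟ 0)} f → Within m (0 ∷ []) (dil k f)
  within-dil k {m∣k} f n with position k n
  ... | nonmultiple r≢0 = inj₁ (dil-nonmultiple k f r≢0)
  ... | multiple j = inj₂ (here (trans (cong (λ x → (j * x) % m) (trans (ℕD.m≡m%n+[m/n]*n k m) (cong (_+ k / m * m) (toWitness m∣k))))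
    (trans (cong (_% m) (sym (ℕP.*-assoc j (k / m) m))) (ℕD.m*n%n≡0 (j * (k / m)) m))))

  within-vanish : ∀ {R f} → Within m R f → ∀ n → n % m ∉ R → f n ≡ 0ℤ
  within-vanish w n r with w n
  ... | inj₁ z = z
  ... | inj₂ s = ⊥-elim (r s)

-- Generating series of exponent functions

infix 9 z^_
-- Exponents are integers because they are values of polynomials on ℤ. Zero at negative exponents is
-- a mere default, for which the exponent law `z^-+` fails; therefore `Gen` demands nonnegative
-- exponents.
z^_ : ℤ → PS
z^ (+ n) = q^ n
z^ -[1+ _ ] = zeroPS

z^-at : ∀ {e n} → e ≡ + n → (z^ e) n ≡ 1ℤ
z^-at {n = n} refl = q^-diagonal n

z^-off : ∀ e {n} → e ≢ + n → (z^ e) n ≡ 0ℤ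
z^-off (+ k) e≢n = q^-off (λ n≡k → e≢n (cong +_ (sym n≡k)))
z^-off -[1+ _ ] _ = refl

z^-+ : ∀ {d e} → 0ℤ ℤ.≤ d → 0ℤ ℤ.≤ e → z^ d · z^ e ≈ z^ (d ℤ.+ e)
z^-+ {+ m} {+ n} _ _ = q^-+ m n

module _ {I : Set} where

  Σ⟨_⟩ : List I → (I → PS) → PS
  Σ⟨ [] ⟩ F = zeroPS
  Σ⟨ i ∷ L ⟩ F = F i ⊕ Σ⟨ L ⟩ F

  Σ-at-cong : ∀ L {F F′ : I → PS} n → (∀ i → F i n ≡ F′ i n) → Σ⟨ L ⟩ F n ≡ Σ⟨ L ⟩ F′ n
  Σ-at-cong [] n h = refl
  Σ-at-cong (i ∷ L) {F} {F′} n h =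
    trans (⊕-at (F i) _ n) (trans (cong₂ ℤ._+_ (h i) (Σ-at-cong L n h)) (sym (⊕-at (F′ i) _ n)))

  Σ-++ : ∀ L L′ F → Σ⟨ L ++ L′ ⟩ F ≈ Σ⟨ L ⟩ F ⊕ Σ⟨ L′ ⟩ F
  Σ-++ [] L′ F = ≈-sym (⊕-identityˡ _)
  Σ-++ (i ∷ L) L′ F = ≈-trans (⊕-congˡ (Σ-++ L L′ F)) (≈-sym (⊕-assoc _ _ _))

  Σ-·ˡ : ∀ L f F → f · Σ⟨ L ⟩ F ≈ Σ⟨ L ⟩ (λ i → f · F i)
  Σ-·ˡ [] f F = CommutativeRing.zeroʳ psRing f
  Σ-·ˡ (i ∷ L) f F = ≈-trans (·-distribˡ f _ _) (⊕-congˡ (Σ-·ˡ L f F))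

  Σ-dil : ∀ k .{{_ : NonZero k}} L F → dil k (Σ⟨ L ⟩ F) ≈ Σ⟨ L ⟩ (λ i → dil k (F i))
  Σ-dil k [] F .at n with (n % k) ≡ᵇ 0
  ... | true = refl
  ... | false = refl
  Σ-dil k (i ∷ L) F = ≈-trans (dil-⊕ k (F i) (Σ⟨ L ⟩ F)) (⊕-congˡ (Σ-dil k L F))

Σ-map : ∀ {I J : Set} (σ : I → J) L F → Σ⟨ map σ L ⟩ F ≈ Σ⟨ L ⟩ (F ∘ σ)
Σ-map σ [] F = ≈-refl
Σ-map σ (i ∷ L) F = ⊕-congˡ (Σ-map σ L F)

Σ-× : ∀ {I J : Set} (L : List I) (L′ : List J) F F′ →
  Σ⟨ L ⟩ F · Σ⟨ L′ ⟩ F′ ≈ Σ⟨ cartesianProduct L L′ ⟩ (λ (i , j) → F i · F′ j)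
Σ-× [] L′ F F′ = CommutativeRing.zeroˡ psRing _
Σ-× (i ∷ L) L′ F F′ = begin
  (F i ⊕ Σ⟨ L ⟩ F) · Σ⟨ L′ ⟩ F′ ≈⟨ CommutativeRing.distribʳ psRing _ _ _ ⟩
  F i · Σ⟨ L′ ⟩ F′ ⊕ Σ⟨ L ⟩ F · Σ⟨ L′ ⟩ F′ ≈⟨ ⊕-cong (Σ-·ˡ L′ (F i) F′) (Σ-× L L′ F F′) ⟩
  Σ⟨ L′ ⟩ (λ j → F i · F′ j) ⊕ Σ⟨ cartesianProduct L L′ ⟩ _
                                                       ≈⟨ ⊕-congʳ (Σ-map (i ,_) L′ _) ⟨
  Σ⟨ map (i ,_) L′ ⟩ _ ⊕ Σ⟨ cartesianProduct L L′ ⟩ _ ≈⟨ Σ-++ (map (i ,_) L′) _ _ ⟨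
  Σ⟨ cartesianProduct (i ∷ L) L′ ⟩ _ ∎
  where open ≈-Reasoning

module _ {I : Set} (e : I → ℤ) (n : ℕ) where

  private
    hit? : ∀ i → Dec (e i ≡ + n)
    hit? i = e i ℤ.≟ + n

  Σ-counts : ∀ L → Σ⟨ L ⟩ (λ i → z^ e i) n ≡ + length (filter hit? L)
  Σ-counts [] = refl
  Σ-counts (i ∷ L) with e i ℤ.≟ + n
  ... | yes p = trans (⊕-at (z^ e i) _ n) (cong₂ ℤ._+_ (z^-at p) (Σ-counts L))
  ... | no ¬p = trans (⊕-at (z^ e i) _ n) (trans (cong₂ ℤ._+_ (z^-off (e i) ¬p) (Σ-counts L)) (ℤP.+-identityˡ _))

  -- Both coefficients count the solutions of e i = n: two lists without repetitions that contain
  -- every solution are permutations of each other once filtered by this equation.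
  Σ-unique : ∀ {L L′} → Unique L → Unique L′ → (∀ i → e i ≡ + n → i ∈ L) → (∀ i → e i ≡ + n → i ∈ L′) →
    Σ⟨ L ⟩ (λ i → z^ e i) n ≡ Σ⟨ L′ ⟩ (λ i → z^ e i) n
  Σ-unique {L} {L′} u u′ c c′ = trans (Σ-counts L) (trans (cong +_ (↭-length (∼bag⇒↭ (unique∧set⇒bag
    (UniqueP.filter⁺ hit? u) (UniqueP.filter⁺ hit? u′) (mk⇔ (move L c′) (move L′ c)))))) (sym (Σ-counts L′)))
    where
    move : ∀ K {K′} → (∀ i → e i ≡ + n → i ∈ K′) → ∀ {i} → i ∈ filter hit? K → i ∈ filter hit? K′
    move K c {i} i∈ with ∈P.∈-filter⁻ hit? {xs = K} i∈
    ... | _ , p = ∈P.∈-filter⁺ hit? (c i p) p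

-- g = Σ_{i ∈ I} q^{e i}, for an exponent function with finite fibres.
record Gen {I : Set} (e : I → ℤ) (g : PS) : Set where
  field
    nonneg : ∀ i → 0ℤ ℤ.≤ e i
    support : ℕ → List I
    unique : ∀ N → Unique (support N)
    covers : ∀ N i → e i ℤ.≤ + N → i ∈ support N
    sums : ∀ N n → n ≤ N → g n ≡ Σ⟨ support N ⟩ (λ i → z^ e i) n
open Gen

-- The exponent function determines the series. Together with `gen-reindex` this reduces an identity
-- between theta series to a bijection of index sets that preserves exponents.
gen-unique : ∀ {I : Set} {e : I → ℤ} {g g′} → Gen e g → Gen e g′ → g ≈ g′
gen-unique {e = e} G G′ .at n = trans (sums G n n ℕP.≤-refl) (trans
  (Σ-unique e n (unique G n) (unique G′ n) (λ i p → covers G n i (ℤP.≤-reflexive p)) (λ i p → covers G′ n i (ℤP.≤-reflexive p)))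
  (sym (sums G′ n n ℕP.≤-refl)))

gen-reindex : ∀ {I J : Set} {e : I → ℤ} {e′ : J → ℤ} {g} (σ : I → J) (τ : J → I) →
  (∀ j → σ (τ j) ≡ j) → (∀ i → τ (σ i) ≡ i) → (∀ i → e′ (σ i) ≡ e i) → Gen e g → Gen e′ g
gen-reindex {e = e} {e′} σ τ στ τσ eq G = record
  { nonneg = λ j → subst (0ℤ ℤ.≤_) (sym (back j)) (nonneg G (τ j))
  ; support = λ N → map σ (support G N)
  ; unique = λ N → UniqueP.map⁺ (λ {x} {y} p → trans (sym (τσ x)) (trans (cong τ p) (τσ y))) (unique G N)
  ; covers = λ N j le → subst (_∈ map σ (support G N)) (στ j)
      (∈P.∈-map⁺ σ (covers G N (τ j) (subst (ℤ._≤ + N) (back j) le)))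
  ; sums = λ N n n≤N → trans (sums G N n n≤N) (sym (trans (Σ-map σ (support G N) (λ j → z^ e′ j) .at n)
      (Σ-at-cong (support G N) n (λ i → cong (λ k → (z^ k) n) (eq i))))) }
  where
  back : ∀ j → e′ j ≡ e (τ j)
  back j = trans (cong e′ (sym (στ j))) (eq (τ j))

gen-⊎ : ∀ {I J : Set} {e : I → ℤ} {e′ : J → ℤ} {g g′} → Gen e g → Gen e′ g′ → Gen [ e , e′ ]′ (g ⊕ g′)
gen-⊎ {e = e} {e′} {g} {g′} G G′ = record
  { nonneg = λ { (inj₁ i) → nonneg G i ; (inj₂ j) → nonneg G′ j }
  ; support = λ N → map inj₁ (support G N) ++ map inj₂ (support G′ N)
  ; unique = λ N → UniqueP.++⁺ (UniqueP.map⁺ (λ { refl → refl }) (unique G N)) (UniqueP.map⁺ (λ { refl → refl }) (unique G′ N))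
      (λ (p , p′) → disjoint (proj₂ (proj₂ (∈P.∈-map⁻ inj₁ p))) (proj₂ (proj₂ (∈P.∈-map⁻ inj₂ p′))))
  ; covers = λ { N (inj₁ i) le → ∈P.∈-++⁺ˡ (∈P.∈-map⁺ inj₁ (covers G N i le))
               ; N (inj₂ j) le → ∈P.∈-++⁺ʳ (map inj₁ (support G N)) (∈P.∈-map⁺ inj₂ (covers G′ N j le)) }
  ; sums = λ N n n≤N → trans (⊕-at g g′ n) (trans (cong₂ ℤ._+_ (sums G N n n≤N) (sums G′ N n n≤N)) (sym
      (trans (Σ-++ (map inj₁ (support G N)) _ _ .at n) (trans (⊕-at _ _ n)
        (cong₂ ℤ._+_ (Σ-map inj₁ (support G N) _ .at n) (Σ-map inj₂ (support G′ N) _ .at n)))))) }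
  where
  disjoint : ∀ {A B : Set} {k : A ⊎ B} {i j} → k ≡ inj₁ i → k ≡ inj₂ j → ⊥
  disjoint refl ()

private
  ≤-from-+ˡ : ∀ {d e n} → 0ℤ ℤ.≤ e → d ℤ.+ e ℤ.≤ n → d ℤ.≤ n
  ≤-from-+ˡ {d} 0≤e le = ℤP.≤-trans (ℤP.≤-trans (ℤP.≤-reflexive (sym (ℤP.+-identityʳ d))) (ℤP.+-monoʳ-≤ d 0≤e)) le

opaque
  unfolding _·_

  gen-× : ∀ {I J : Set} {e : I → ℤ} {e′ : J → ℤ} {g g′} → Gen e g → Gen e′ g′ → Gen {I × J} (λ (i , j) → e i ℤ.+ e′ j) (g · g′)
  gen-× {e = e} {e′} {g} {g′} G G′ = record
    { nonneg = λ (i , j) → ℤP.+-mono-≤ (nonneg G i) (nonneg G′ j)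
    ; support = λ N → cartesianProduct (support G N) (support G′ N)
    ; unique = λ N → UniqueP.cartesianProduct⁺ (unique G N) (unique G′ N)
    ; covers = λ N (i , j) le → ∈P.∈-cartesianProduct⁺ (covers G N i (≤-from-+ˡ (nonneg G′ j) le))
        (covers G′ N j (≤-from-+ˡ (nonneg G i) (subst (ℤ._≤ + N) (ℤP.+-comm (e i) (e′ j)) le)))
    ; sums = λ N n n≤N → trans
        (⊛-at-cong n (λ m m≤n → sums G N m (ℕP.≤-trans m≤n n≤N)) (λ m m≤n → sums G′ N m (ℕP.≤-trans m≤n n≤N)))
        (trans (Σ-× (support G N) (support G′ N) (λ i → z^ e i) (λ j → z^ e′ j) .at n)
          (Σ-at-cong (cartesianProduct (support G N) (support G′ N)) n (λ (i , j) → z^-+ (nonneg G i) (nonneg G′ j) .at n))) }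

gen-q^ : ∀ k → Gen {⊤} (λ _ → + k) (q^ k)
gen-q^ k = record
  { nonneg = λ _ → ℤ.+≤+ z≤n
  ; support = λ _ → tt ∷ []
  ; unique = λ _ → All.[] ∷ []
  ; covers = λ _ _ _ → here refl
  ; sums = λ N n _ → sym (trans (⊕-at (q^ k) zeroPS n) (ℤP.+-identityʳ _)) }

gen-shift : ∀ {I : Set} {e : I → ℤ} {g} k → Gen e g → Gen (λ i → + k ℤ.+ e i) (q^ k · g)
gen-shift k G = gen-reindex proj₂ (tt ,_) (λ _ → refl) (λ _ → refl) (λ _ → refl) (gen-× (gen-q^ k) G)

z^-dil : ∀ k .{{_ : NonZero k}} {e} → 0ℤ ℤ.≤ e → dil k (z^ e) ≈ z^ (e ℤ.* + k)
z^-dil k {+ m} _ = ≈-trans (dil-q^ k m) (coeffwise λ n → cong (λ x → (z^ x) n) (ℤP.pos-* m k))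

-- Multiplying nonnegative exponents by k ≥ 1 can only raise them, so the old support lists still
-- cover everything.
gen-dil : ∀ {I : Set} {e : I → ℤ} {g} k .{{_ : NonZero k}} → Gen e g → Gen (λ i → e i ℤ.* + k) (dil k g)
gen-dil {e = e} {g} k G = record
  { nonneg = λ i → ℤP.*-monoʳ-≤-nonNeg (+ k) (nonneg G i)
  ; support = support G
  ; unique = unique G
  ; covers = λ N i le → covers G N i (ℤP.≤-trans (grow (nonneg G i)) le)
  ; sums = λ N n n≤N → trans (truncate N n n≤N) (trans (Σ-dil k (support G N) (λ i → z^ e i) .at n)
      (Σ-at-cong (support G N) n (λ i → z^-dil k (nonneg G i) .at n))) }
  where
  grow : ∀ {d} → 0ℤ ℤ.≤ d → d ℤ.≤ d ℤ.* + k
  grow {+ m} _ = subst (+ m ℤ.≤_) (ℤP.pos-* m k) (ℤ.+≤+ (ℕP.m≤m*n m k))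
  truncate : ∀ N n → n ≤ N → dil k g n ≡ dil k (Σ⟨ support G N ⟩ (λ i → z^ e i)) n
  truncate N n n≤N with position k n
  ... | nonmultiple r≢0 = trans (dil-nonmultiple k g r≢0) (sym (dil-nonmultiple k (Σ⟨ support G N ⟩ (λ i → z^ e i)) r≢0))
  ... | multiple m = trans (dil-multiple k g m) (trans (sums G N m (ℕP.≤-trans (ℕP.m≤m*n m k) n≤N))
      (sym (dil-multiple k (Σ⟨ support G N ⟩ (λ i → z^ e i)) m)))

-- Theta series as generating series

interval : ℕ → List ℤ
interval N = map (λ k → + k ℤ.- + N) (upTo (suc (N + N)))

interval-unique : ∀ N → Unique (interval N)
interval-unique N = UniqueP.map⁺ (λ {x} {y} p → ℤP.+-injective (GroupProperties.∙-cancelʳ (CommutativeRing.+-group ℤP.+-*-commutativeRing) (- + N) (+ x) (+ y) p)) (UniqueP.upTo⁺ (suc (N + N)))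

∈-interval : ∀ N x → + ℤ.∣ x ∣ ℤ.≤ + N → x ∈ interval N
∈-interval N (+ n) (ℤ.+≤+ n≤N) = subst (_∈ interval N) (cancel (+ n) (+ N))
  (∈P.∈-map⁺ (λ k → + k ℤ.- + N) {x = n + N} (∈P.∈-upTo⁺ (s≤s (ℕP.+-monoˡ-≤ N n≤N))))
  where
  cancel : ∀ x y → x ℤ.+ y ℤ.- y ≡ x
  cancel = ℤRing.solve-∀
∈-interval N -[1+ n ] (ℤ.+≤+ n<N) = subst (_∈ interval N) (begin
    + (N ∸ suc n) ℤ.- + N ≡⟨ cong (λ k → + (N ∸ suc n) ℤ.- + k) (ℕP.m∸n+n≡m n<N) ⟨
    + (N ∸ suc n) ℤ.- (+ (N ∸ suc n) ℤ.+ + suc n) ≡⟨ cancel (+ (N ∸ suc n)) (+ suc n) ⟩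
    -[1+ n ] ∎)
  (∈P.∈-map⁺ (λ k → + k ℤ.- + N) {x = N ∸ suc n} (∈P.∈-upTo⁺ (s≤s (ℕP.≤-trans (ℕP.m∸n≤m N (suc n)) (ℕP.m≤m+n N N)))))
  where
  open ≡-Reasoning
  cancel : ∀ x y → x ℤ.- (x ℤ.+ y) ≡ - y
  cancel = ℤRing.solve-∀

quadratic : ℕ → ℕ → ℤ → ℤ
quadratic a b x = + a ℤ.* (x ℤ.* x) ℤ.+ + b ℤ.* x

-- Σ_{x ∈ ℤ} q^{a x² + b x} for b < a; then only |x| ≤ n contribute to the coefficient of qⁿ.
theta : ℕ → ℕ → PS
theta a b n = Σ⟨ interval n ⟩ (λ x → z^ quadratic a b x) n

-- The form a = 1 + b + k encodes b < a. Then a x² + b x = (1 + k) x² + b (x² + x), where x² + x ≥ 0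
-- and x² ≥ |x| for integers.
quadratic-bound : ∀ b k x → + ℤ.∣ x ∣ ℤ.≤ quadratic (suc (b + k)) b x
quadratic-bound b k (+ n) = subst (+ n ℤ.≤_) casts (ℤ.+≤+ bound)
  where
  a : ℕ
  a = suc (b + k)
  square : ∀ n → n ≤ n * n
  square zero = z≤n
  square (suc n) = ℕP.m≤m*n (suc n) (suc n)
  bound : n ≤ a * (n * n) + b * n
  bound = ℕP.≤-trans (square n) (ℕP.≤-trans (ℕP.m≤n*m (n * n) a) (ℕP.m≤m+n (a * (n * n)) (b * n)))
  casts : + (a * (n * n)) ℤ.+ + (b * n) ≡ + a ℤ.* (+ n ℤ.* + n) ℤ.+ + b ℤ.* + n
  casts = cong₂ ℤ._+_ (trans (ℤP.pos-* a (n * n)) (cong (+ a ℤ.*_) (ℤP.pos-* n n))) (ℤP.pos-* b n)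
quadratic-bound b k -[1+ n ] = subst (+ suc n ℤ.≤_) (trans (cong (λ s → + suc n ℤ.+ s) casts) (expand (+ b) (+ k) (+ n)))
  (ℤ.+≤+ (ℕP.m≤m+n (suc n) (n * suc n + k * (suc n * suc n) + b * (n * suc n))))
  where
  casts : + (n * suc n + k * (suc n * suc n) + b * (n * suc n)) ≡
    + n ℤ.* (1ℤ ℤ.+ + n) ℤ.+ + k ℤ.* ((1ℤ ℤ.+ + n) ℤ.* (1ℤ ℤ.+ + n)) ℤ.+ + b ℤ.* (+ n ℤ.* (1ℤ ℤ.+ + n))
  casts = cong₂ ℤ._+_ (cong₂ ℤ._+_ (ℤP.pos-* n (suc n)) (trans (ℤP.pos-* k _) (cong (+ k ℤ.*_) (ℤP.pos-* (suc n) (suc n)))))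
    (trans (ℤP.pos-* b _) (cong (+ b ℤ.*_) (ℤP.pos-* n (suc n))))
  expand : ∀ b k n → (1ℤ ℤ.+ n) ℤ.+ (n ℤ.* (1ℤ ℤ.+ n) ℤ.+ k ℤ.* ((1ℤ ℤ.+ n) ℤ.* (1ℤ ℤ.+ n)) ℤ.+ b ℤ.* (n ℤ.* (1ℤ ℤ.+ n)))
    ≡ (1ℤ ℤ.+ (b ℤ.+ k)) ℤ.* (- (1ℤ ℤ.+ n) ℤ.* - (1ℤ ℤ.+ n)) ℤ.+ b ℤ.* - (1ℤ ℤ.+ n)
  expand = ℤRing.solve-∀

gen-theta : ∀ b k → Gen (quadratic (suc (b + k)) b) (theta (suc (b + k)) b)
gen-theta b k = record
  { nonneg = λ x → ℤP.≤-trans (ℤ.+≤+ z≤n) (quadratic-bound b k x)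
  ; support = interval
  ; unique = interval-unique
  ; covers = cov
  ; sums = λ N n n≤N → Σ-unique e n (interval-unique n) (interval-unique N) (λ x p → cov n x (ℤP.≤-reflexive p))
      (λ x p → cov N x (ℤP.≤-trans (ℤP.≤-reflexive p) (ℤ.+≤+ n≤N))) }
  where
  e : ℤ → ℤ
  e = quadratic (suc (b + k)) b
  cov : ∀ N x → e x ℤ.≤ + N → x ∈ interval N
  cov N x le = ∈-interval N x (ℤP.≤-trans (quadratic-bound b k x) le)

theta-constantTerm : ∀ a b → theta a b 0 ≡ 1ℤ
theta-constantTerm a b = trans (⊕-at (z^ quadratic a b 0ℤ) zeroPS 0)
  (cong (ℤ._+ 0ℤ) (z^-at (cong₂ ℤ._+_ (ℤP.*-zeroʳ (+ a)) (ℤP.*-zeroʳ (+ b)))))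

-- Theta series and their dissections

open +-*-Solver using () renaming (solve to solveℤ; _:=_ to _⩵_; _:+_ to _⊞_; _:*_ to _⊠_; _:-_ to _∖_; :-_ to ⊟ᵖ_; con to κ; Polynomial to Polynomialℤ)

interleave : ℤ ⊎ ℤ → ℤ
interleave (inj₁ t) = + 2 ℤ.* t
interleave (inj₂ t) = + 2 ℤ.* t ℤ.+ 1ℤ

parity : ℤ → ℤ ⊎ ℤ
parity x with x ℤD.%ℕ 2
... | zero = inj₁ (x ℤD./ℕ 2)
... | suc _ = inj₂ (x ℤD./ℕ 2)

interleave-parity : ∀ x → interleave (parity x) ≡ x
interleave-parity x with x ℤD.%ℕ 2 | ℤD.n%ℕd<d x 2 | ℤD.a≡a%ℕn+[a/ℕn]*n x 2
... | zero | _ | eq = trans (ℤP.*-comm (+ 2) (x ℤD./ℕ 2)) (trans (sym (ℤP.+-identityˡ _)) (sym eq))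
... | suc zero | _ | eq = trans (ℤP.+-comm (+ 2 ℤ.* (x ℤD./ℕ 2)) 1ℤ) (trans (cong (λ s → 1ℤ ℤ.+ s) (ℤP.*-comm (+ 2) (x ℤD./ℕ 2))) (sym eq))
... | suc (suc _) | s≤s (s≤s ()) | _

even≢odd : ∀ s t → + 2 ℤ.* s ≢ + 2 ℤ.* t ℤ.+ 1ℤ
even≢odd s t eq = 2*n≢1 ℤ.∣ s ℤ.- t ∣ (trans (sym (ℤP.abs-* (+ 2) (s ℤ.- t))) (cong ℤ.∣_∣ (trans (distribute s t)
  (trans (cong (λ z → z ℤ.- + 2 ℤ.* t) eq) (cancel (+ 2 ℤ.* t))))))
  where
  distribute : ∀ s t → + 2 ℤ.* (s ℤ.- t) ≡ + 2 ℤ.* s ℤ.- + 2 ℤ.* t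
  distribute = ℤRing.solve-∀
  cancel : ∀ x → x ℤ.+ 1ℤ ℤ.- x ≡ 1ℤ
  cancel = ℤRing.solve-∀
  2*n≢1 : ∀ n → 2 * n ≢ 1
  2*n≢1 (suc n) p with trans (sym (ℕP.+-suc n (n + 0))) (ℕP.suc-injective p)
  ... | ()

interleave-injective : ∀ {a b} → interleave a ≡ interleave b → a ≡ b
interleave-injective {inj₁ s} {inj₁ t} p = cong inj₁ (ℤP.*-cancelˡ-≡ (+ 2) s t p)
interleave-injective {inj₁ s} {inj₂ t} p = ⊥-elim (even≢odd s t p)
interleave-injective {inj₂ s} {inj₁ t} p = ⊥-elim (even≢odd t s (sym p))
interleave-injective {inj₂ s} {inj₂ t} p = cong inj₂ (ℤP.*-cancelˡ-≡ (+ 2) s t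
  (GroupProperties.∙-cancelʳ (CommutativeRing.+-group ℤP.+-*-commutativeRing) 1ℤ (+ 2 ℤ.* s) (+ 2 ℤ.* t) p))

parity-interleave : ∀ a → parity (interleave a) ≡ a
parity-interleave a = interleave-injective {parity (interleave a)} {a} (interleave-parity (interleave a))

gen-cong : ∀ {I : Set} {e e′ : I → ℤ} {g} → (∀ i → e′ i ≡ e i) → Gen e g → Gen e′ g
gen-cong = gen-reindex id id (λ _ → refl) (λ _ → refl)

-- A dissection read on indices: ℤ is two copies of itself, the even and the odd integers, and the
-- exponent function is computed on each.
gen-halves : ∀ {e₀ e₁ e : ℤ → ℤ} {g₀ g₁} → (∀ t → e (+ 2 ℤ.* t) ≡ e₀ t) → (∀ t → e (+ 2 ℤ.* t ℤ.+ 1ℤ) ≡ e₁ t) →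
  Gen e₀ g₀ → Gen e₁ g₁ → Gen e (g₀ ⊕ g₁)
gen-halves eq₀ eq₁ G₀ G₁ = gen-reindex interleave parity interleave-parity parity-interleave
  (λ { (inj₁ t) → eq₀ t ; (inj₂ t) → eq₁ t }) (gen-⊎ G₀ G₁)

gen-halves₂ : ∀ {e₀ e₁ e : ℤ × ℤ → ℤ} {g₀ g₁} → (∀ t y → e (+ 2 ℤ.* t , y) ≡ e₀ (t , y)) →
  (∀ t y → e (+ 2 ℤ.* t ℤ.+ 1ℤ , y) ≡ e₁ (t , y)) → Gen e₀ g₀ → Gen e₁ g₁ → Gen e (g₀ ⊕ g₁)
gen-halves₂ {e = e} eq₀ eq₁ G₀ G₁ = gen-reindex from to from∘to to∘from (λ { (inj₁ (t , y)) → eq₀ t y ; (inj₂ (t , y)) → eq₁ t y }) (gen-⊎ G₀ G₁)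
  where
  from : (ℤ × ℤ) ⊎ (ℤ × ℤ) → ℤ × ℤ
  from (inj₁ (t , y)) = interleave (inj₁ t) , y
  from (inj₂ (t , y)) = interleave (inj₂ t) , y
  to : ℤ × ℤ → (ℤ × ℤ) ⊎ (ℤ × ℤ)
  to (x , y) = Sum.map (_, y) (_, y) (parity x)
  from-map : ∀ a y → from (Sum.map (_, y) (_, y) a) ≡ (interleave a , y)
  from-map (inj₁ t) y = refl
  from-map (inj₂ t) y = refl
  from∘to : ∀ p → from (to p) ≡ p
  from∘to (x , y) = trans (from-map (parity x) y) (cong (_, y) (interleave-parity x))
  to∘from : ∀ p → to (from p) ≡ p
  to∘from (inj₁ (t , y)) = cong (Sum.map (_, y) (_, y)) (parity-interleave (inj₁ t))
  to∘from (inj₂ (t , y)) = cong (Sum.map (_, y) (_, y)) (parity-interleave (inj₂ t))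

-- Affine unimodular changes of variables

reflect-involutive : ∀ x → ℤ.-1ℤ ℤ.- (ℤ.-1ℤ ℤ.- x) ≡ x
reflect-involutive = solveℤ 1 (λ x → κ ℤ.-1ℤ ∖ (κ ℤ.-1ℤ ∖ x) ⩵ x) refl

-- Since a(-1 - x)² + b(-1 - x) = a x² + (2a - b) x + a - b, this reflection brings a linear
-- coefficient between a and 2a back below a, as the definition of `theta` expects. Such
-- coefficients arise from the odd indices.
gen-reflect : ∀ {e : ℤ → ℤ} {g} → Gen e g → Gen (λ x → e (ℤ.-1ℤ ℤ.- x)) g
gen-reflect {e} = gen-reindex (λ x → ℤ.-1ℤ ℤ.- x) (λ x → ℤ.-1ℤ ℤ.- x) reflect-involutive reflect-involutive
  (λ x → cong e (reflect-involutive x))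

module _ {e : ℤ × ℤ → ℤ} {g : PS} where

  gen-swap : Gen e g → Gen {ℤ × ℤ} (λ (x , y) → e (y , x)) g
  gen-swap = gen-reindex (λ (x , y) → y , x) (λ (x , y) → y , x) (λ _ → refl) (λ _ → refl) (λ _ → refl)

  gen-reflect₁ : Gen e g → Gen {ℤ × ℤ} (λ (x , y) → e (ℤ.-1ℤ ℤ.- x , y)) g
  gen-reflect₁ = gen-reindex (λ (x , y) → ℤ.-1ℤ ℤ.- x , y) (λ (x , y) → ℤ.-1ℤ ℤ.- x , y)
    (λ (x , y) → cong (_, y) (reflect-involutive x)) (λ (x , y) → cong (_, y) (reflect-involutive x))
    (λ (x , y) → cong (λ z → e (z , y)) (reflect-involutive x))

  gen-negate₁ : Gen e g → Gen {ℤ × ℤ} (λ (x , y) → e (- x , y)) g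
  gen-negate₁ = gen-reindex (λ (x , y) → - x , y) (λ (x , y) → - x , y)
    (λ (x , y) → cong (_, y) (ℤP.neg-involutive x)) (λ (x , y) → cong (_, y) (ℤP.neg-involutive x))
    (λ (x , y) → cong (λ z → e (z , y)) (ℤP.neg-involutive x))

  gen-add₁ : Gen e g → Gen {ℤ × ℤ} (λ (x , y) → e (x ℤ.+ y , y)) g
  gen-add₁ = gen-reindex (λ (x , y) → x ℤ.- y , y) (λ (x , y) → x ℤ.+ y , y)
    (λ (x , y) → cong (_, y) (add-subtract x y)) (λ (x , y) → cong (_, y) (subtract-add x y))
    (λ (x , y) → cong (λ z → e (z , y)) (subtract-add x y))
    where
    add-subtract : ∀ x y → x ℤ.+ y ℤ.- y ≡ x
    add-subtract = ℤRing.solve-∀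
    subtract-add : ∀ x y → x ℤ.- y ℤ.+ y ≡ x
    subtract-add = ℤRing.solve-∀

gen-subtract₁ : ∀ {e : ℤ × ℤ → ℤ} {g} → Gen e g → Gen {ℤ × ℤ} (λ (x , y) → e (y ℤ.- x , y)) g
gen-subtract₁ {e} G = gen-cong (λ (x , y) → cong (λ z → e (z , y)) (ℤP.+-comm y (- x))) (gen-negate₁ (gen-add₁ G))

gen-subtract₁′ : ∀ {e : ℤ × ℤ → ℤ} {g} → Gen e g → Gen {ℤ × ℤ} (λ (x , y) → e (x ℤ.- y , y)) g
gen-subtract₁′ {e} G = gen-cong (λ (x , y) → cong (λ z → e (z , y)) (double-negation x y)) (gen-subtract₁ (gen-negate₁ G))
  where
  double-negation : ∀ x y → x ℤ.- y ≡ - (y ℤ.- x)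
  double-negation = ℤRing.solve-∀

-- In Ramanujan's notation X₀ = f(q³, q⁵) and Y₀ = f(q, q⁷). These are the versions without signs;
-- `X` and `Y` restore the signs that the products for S and T require.
φ ψ X₀ Y₀ : PS
φ = theta 1 0
ψ = theta 2 1
X₀ = theta 4 1
Y₀ = theta 4 3

gen-φ : Gen (quadratic 1 0) φ
gen-φ = gen-theta 0 0

gen-ψ : Gen (quadratic 2 1) ψ
gen-ψ = gen-theta 1 0

gen-X₀ : Gen (quadratic 4 1) X₀
gen-X₀ = gen-theta 1 2

gen-Y₀ : Gen (quadratic 4 3) Y₀
gen-Y₀ = gen-theta 3 0

-- Σ_{x ∈ ℤ} q^{x(x+1)}
pronic : PS
pronic = dil 2 ψ ⊕ dil 2 ψ

2x 2x+1 reflectᵖ : ∀ {n} → Polynomialℤ n → Polynomialℤ n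
2x t = κ (+ 2) ⊠ t
2x+1 t = 2x t ⊞ κ 1ℤ
reflectᵖ t = κ ℤ.-1ℤ ∖ t

quadraticᵖ : ∀ {n} → ℕ → ℕ → Polynomialℤ n → Polynomialℤ n
quadraticᵖ a b x = κ (+ a) ⊠ (x ⊠ x) ⊞ κ (+ b) ⊠ x

gen-pronic : Gen (quadratic 1 1) pronic
gen-pronic = gen-halves
  (solveℤ 1 (λ t → quadraticᵖ 1 1 (2x t) ⩵ quadraticᵖ 2 1 t ⊠ κ (+ 2)) refl)
  (solveℤ 1 (λ t → quadraticᵖ 1 1 (2x+1 t) ⩵ quadraticᵖ 2 1 (reflectᵖ t) ⊠ κ (+ 2)) refl)
  (gen-dil 2 gen-ψ) (gen-reflect (gen-dil 2 gen-ψ))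

φ-halves : φ ≈ dil 4 φ ⊕ q^ 1 · dil 4 pronic
φ-halves = gen-unique gen-φ (gen-halves
  (solveℤ 1 (λ t → quadraticᵖ 1 0 (2x t) ⩵ quadraticᵖ 1 0 t ⊠ κ (+ 4)) refl)
  (solveℤ 1 (λ t → quadraticᵖ 1 0 (2x+1 t) ⩵ κ (+ 1) ⊞ quadraticᵖ 1 1 t ⊠ κ (+ 4)) refl)
  (gen-dil 4 gen-φ) (gen-shift 1 (gen-dil 4 gen-pronic)))

ψ-halves : ψ ≈ dil 2 X₀ ⊕ q^ 1 · dil 2 Y₀
ψ-halves = gen-unique gen-ψ (gen-halves
  (solveℤ 1 (λ t → quadraticᵖ 2 1 (2x t) ⩵ quadraticᵖ 4 1 t ⊠ κ (+ 2)) refl)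
  (solveℤ 1 (λ t → quadraticᵖ 2 1 (2x+1 t) ⩵ κ (+ 1) ⊞ quadraticᵖ 4 3 (reflectᵖ t) ⊠ κ (+ 2)) refl)
  (gen-dil 2 gen-X₀) (gen-reflect (gen-shift 1 (gen-dil 2 gen-Y₀))))

-- For u ≡ v modulo 2, u² + v² = 2((u + v)/2)² + 2((u - v)/2)²; the other class gives pronic
-- numbers. The shear makes u - v the first coordinate, whose parity `gen-halves₂` splits. The
-- dissections of products below follow the same pattern.
φ-square : φ · φ ≈ dil 2 φ · dil 2 φ ⊕ q^ 1 · (dil 2 pronic · dil 2 pronic)
φ-square = gen-unique (gen-add₁ (gen-× gen-φ gen-φ)) (gen-halves₂
  (solveℤ 2 (λ t y → quadraticᵖ 1 0 (2x t ⊞ y) ⊞ quadraticᵖ 1 0 y ⩵ quadraticᵖ 1 0 (y ⊞ t) ⊠ κ (+ 2) ⊞ quadraticᵖ 1 0 t ⊠ κ (+ 2)) refl)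
  (solveℤ 2 (λ t y → quadraticᵖ 1 0 (2x+1 t ⊞ y) ⊞ quadraticᵖ 1 0 y ⩵ κ (+ 1) ⊞ (quadraticᵖ 1 1 (y ⊞ t) ⊠ κ (+ 2) ⊞ quadraticᵖ 1 1 t ⊠ κ (+ 2))) refl)
  (gen-swap (gen-add₁ (gen-× (gen-dil 2 gen-φ) (gen-dil 2 gen-φ))))
  (gen-swap (gen-add₁ (gen-shift 1 (gen-× (gen-dil 2 gen-pronic) (gen-dil 2 gen-pronic))))))

-- Both classes share the factor ψ(q²), and their cofactors are the two halves of φ from `φ-halves`;
-- hence the product formula `ψ²≈φ·ψ₂`.
ψ-square-halves : ψ · ψ ≈ dil 2 ψ · dil 4 φ ⊕ q^ 1 · (dil 2 ψ · dil 4 pronic)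
ψ-square-halves = gen-unique (gen-add₁ (gen-× gen-ψ gen-ψ)) (gen-halves₂
  (solveℤ 2 (λ t y → quadraticᵖ 2 1 (2x t ⊞ y) ⊞ quadraticᵖ 2 1 y ⩵ quadraticᵖ 2 1 (y ⊞ t) ⊠ κ (+ 2) ⊞ quadraticᵖ 1 0 t ⊠ κ (+ 4)) refl)
  (solveℤ 2 (λ t y → quadraticᵖ 2 1 (2x+1 t ⊞ y) ⊞ quadraticᵖ 2 1 y ⩵ κ (+ 1) ⊞ (quadraticᵖ 2 1 (reflectᵖ (y ⊞ t)) ⊠ κ (+ 2) ⊞ quadraticᵖ 1 1 t ⊠ κ (+ 4))) refl)
  (gen-swap (gen-add₁ (gen-× (gen-dil 2 gen-ψ) (gen-dil 4 gen-φ))))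
  (gen-swap (gen-add₁ (gen-reflect₁ (gen-shift 1 (gen-× (gen-dil 2 gen-ψ) (gen-dil 4 gen-pronic)))))))

-- Again a common factor, now ψ(q⁴), with the two halves of ψ as cofactors. It yields the common
-- denominator XY of G and q/G.
X₀·Y₀-halves : X₀ · Y₀ ≈ dil 2 X₀ · dil 4 ψ ⊕ q^ 1 · (dil 2 Y₀ · dil 4 ψ)
X₀·Y₀-halves = gen-unique (gen-add₁ (gen-× gen-X₀ gen-Y₀)) (gen-halves₂
  (solveℤ 2 (λ t y → quadraticᵖ 4 1 (2x t ⊞ y) ⊞ quadraticᵖ 4 3 y ⩵ quadraticᵖ 4 1 (⊟ᵖ t) ⊠ κ (+ 2) ⊞ quadraticᵖ 2 1 (y ∖ ⊟ᵖ t) ⊠ κ (+ 4)) refl)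
  (solveℤ 2 (λ t y → quadraticᵖ 4 1 (2x+1 t ⊞ y) ⊞ quadraticᵖ 4 3 y ⩵ κ (+ 1) ⊞ (quadraticᵖ 4 3 t ⊠ κ (+ 2) ⊞ quadraticᵖ 2 1 (reflectᵖ (y ⊞ t)) ⊠ κ (+ 4))) refl)
  (gen-negate₁ (gen-swap (gen-subtract₁′ (gen-swap (gen-× (gen-dil 2 gen-X₀) (gen-dil 4 gen-ψ))))))
  (gen-swap (gen-add₁ (gen-reflect₁ (gen-swap (gen-shift 1 (gen-× (gen-dil 2 gen-Y₀) (gen-dil 4 gen-ψ))))))))

-- Meant to be read from right to left: under q ↦ -q the right side becomes X² - q Y², the numerator
-- of G - q/G.
ψ·φ-halves : ψ · dil 2 φ ≈ X₀ · X₀ ⊕ q^ 1 · (Y₀ · Y₀)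
ψ·φ-halves = gen-unique (gen-add₁ (gen-× gen-ψ (gen-dil 2 gen-φ))) (gen-halves₂
  (solveℤ 2 (λ t y → quadraticᵖ 2 1 (2x t ⊞ y) ⊞ quadraticᵖ 1 0 y ⊠ κ (+ 2) ⩵ quadraticᵖ 4 1 (y ⊞ t) ⊞ quadraticᵖ 4 1 t) refl)
  (solveℤ 2 (λ t y → quadraticᵖ 2 1 (2x+1 t ⊞ y) ⊞ quadraticᵖ 1 0 y ⊠ κ (+ 2) ⩵ κ (+ 1) ⊞ (quadraticᵖ 4 3 (reflectᵖ t) ⊞ quadraticᵖ 4 3 (reflectᵖ t ∖ y))) refl)
  (gen-swap (gen-add₁ (gen-× gen-X₀ gen-X₀)))
  (gen-reflect₁ (gen-swap (gen-subtract₁ (gen-swap (gen-shift 1 (gen-× gen-Y₀ gen-Y₀)))))))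

-- A form of discriminant −7.
form₇ : ℤ × ℤ → ℤ
form₇ (y , u) = u ℤ.* u ℤ.- u ℤ.* y ℤ.+ + 2 ℤ.* (y ℤ.* y)

form₇ᵖ : ∀ {n} → Polynomialℤ n → Polynomialℤ n → Polynomialℤ n
form₇ᵖ y u = (u ⊠ u ∖ u ⊠ y) ⊞ 2x (y ⊠ y)

-- The theta series of `form₇`, written by the parity of y: for y = 2t the form is (u - t)² + 7t²,
-- and odd y gives the pronic analogue shifted by 2.
Θ₇ : PS
Θ₇ = φ · dil 7 φ ⊕ q^ 2 · (pronic · dil 7 pronic)

gen-Θ₇ : Gen form₇ Θ₇
gen-Θ₇ = gen-halves₂
  (solveℤ 2 (λ t y → form₇ᵖ (2x t) y ⩵ quadraticᵖ 1 0 (t ∖ y) ⊞ quadraticᵖ 1 0 t ⊠ κ (+ 7)) refl)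
  (solveℤ 2 (λ t y → form₇ᵖ (2x+1 t) y ⩵ κ (+ 2) ⊞ (quadraticᵖ 1 1 (t ∖ y) ⊞ quadraticᵖ 1 1 t ⊠ κ (+ 7))) refl)
  (gen-swap (gen-subtract₁ (gen-× gen-φ (gen-dil 7 gen-φ))))
  (gen-swap (gen-subtract₁ (gen-shift 2 (gen-× gen-pronic (gen-dil 7 gen-pronic)))))

-- In the maximal order of ℚ(√−7) the prime 2 splits: u even gives the multiples of one prime above 2, and u odd
-- gives the numbers (a + b √−7)/2 divided by the other prime, with a ≡ b ≡ ±1 modulo 4.
Θ₇-halves : Θ₇ ≈ dil 2 Θ₇ ⊕ (q^ 1 · (ψ · dil 7 ψ) ⊕ q^ 1 · (ψ · dil 7 ψ))
Θ₇-halves = gen-unique (gen-swap gen-Θ₇) (gen-halves₂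
  (solveℤ 2 (λ t y → form₇ᵖ y (2x t) ⩵ form₇ᵖ t y ⊠ κ (+ 2)) refl) (λ _ _ → refl)
  (gen-dil 2 gen-Θ₇) (gen-halves₂
    (solveℤ 2 (λ t y → form₇ᵖ y (2x+1 (2x t)) ⩵ κ (+ 1) ⊞ (quadraticᵖ 2 1 (t ∖ y) ⊞ quadraticᵖ 2 1 t ⊠ κ (+ 7))) refl)
    (solveℤ 2 (λ t y → form₇ᵖ y (2x+1 (2x+1 t)) ⩵ κ (+ 1) ⊞ (quadraticᵖ 2 1 (y ⊞ reflectᵖ t) ⊞ quadraticᵖ 2 1 (reflectᵖ t) ⊠ κ (+ 7))) refl)
    (gen-swap (gen-subtract₁ (gen-shift 1 (gen-× gen-ψ (gen-dil 7 gen-ψ)))))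
    (gen-reflect₁ (gen-swap (gen-add₁ (gen-shift 1 (gen-× gen-ψ (gen-dil 7 gen-ψ))))))))

-- The form 2u² + u + 3(2v² + v) becomes diagonal on each class of v - u modulo 4. The even classes
-- share ψ(q⁴) and the odd ones ψ(q¹²); their cofactors are the halves of φ(q⁶) and φ(q²), which
-- `ψ·ψ₃-dissection` puts together again.
ψ·ψ₃-quarters : ψ · dil 3 ψ ≈ (dil 24 φ · dil 4 ψ ⊕ q^ 6 · (dil 24 pronic · dil 4 ψ))
  ⊕ (q^ 1 · (dil 8 φ · dil 12 ψ) ⊕ q^ 3 · (dil 8 pronic · dil 12 ψ))
ψ·ψ₃-quarters = gen-unique (gen-subtract₁ (gen-× gen-ψ (gen-dil 3 gen-ψ))) (gen-halves₂ (λ _ _ → refl) (λ _ _ → refl)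
  (gen-halves₂
    (solveℤ 2 (λ t y → quadraticᵖ 2 1 (y ∖ 2x (2x t)) ⊞ quadraticᵖ 2 1 y ⊠ κ (+ 3) ⩵ quadraticᵖ 1 0 t ⊠ κ (+ 24) ⊞ quadraticᵖ 2 1 (y ∖ t) ⊠ κ (+ 4)) refl)
    (solveℤ 2 (λ t y → quadraticᵖ 2 1 (y ∖ 2x (2x+1 t)) ⊞ quadraticᵖ 2 1 y ⊠ κ (+ 3) ⩵ κ (+ 6) ⊞ (quadraticᵖ 1 1 t ⊠ κ (+ 24) ⊞ quadraticᵖ 2 1 (t ∖ y) ⊠ κ (+ 4))) refl)
    (gen-swap (gen-subtract₁′ (gen-swap (gen-× (gen-dil 24 gen-φ) (gen-dil 4 gen-ψ)))))
    (gen-swap (gen-subtract₁ (gen-swap (gen-shift 6 (gen-× (gen-dil 24 gen-pronic) (gen-dil 4 gen-ψ)))))))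
  (gen-halves₂
    (solveℤ 2 (λ t y → quadraticᵖ 2 1 (y ∖ 2x+1 (2x t)) ⊞ quadraticᵖ 2 1 y ⊠ κ (+ 3) ⩵ κ (+ 1) ⊞ (quadraticᵖ 1 0 (t ∖ y) ⊠ κ (+ 8) ⊞ quadraticᵖ 2 1 t ⊠ κ (+ 12))) refl)
    (solveℤ 2 (λ t y → quadraticᵖ 2 1 (y ∖ 2x+1 (2x+1 t)) ⊞ quadraticᵖ 2 1 y ⊠ κ (+ 3) ⩵ κ (+ 3) ⊞ (quadraticᵖ 1 1 (y ⊞ reflectᵖ t) ⊠ κ (+ 8) ⊞ quadraticᵖ 2 1 (reflectᵖ t) ⊠ κ (+ 12))) refl)
    (gen-swap (gen-subtract₁ (gen-shift 1 (gen-× (gen-dil 8 gen-φ) (gen-dil 12 gen-ψ)))))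
    (gen-reflect₁ (gen-swap (gen-add₁ (gen-shift 3 (gen-× (gen-dil 8 gen-pronic) (gen-dil 12 gen-ψ))))))))

-- Jacobi's triple product

opaque
  unfolding _·_

  ·-at-cong : ∀ {f f′ g g′ : PS} n → (∀ i → i ≤ n → f i ≡ f′ i) → (∀ i → i ≤ n → g i ≡ g′ i) → (f · g) n ≡ (f′ · g′) n
  ·-at-cong = ⊛-at-cong

q^-below : ∀ k f {n} → n < k → (q^ k · f) n ≡ 0ℤ
q^-below (suc k) f {n} n<k = trans (·≈⊛ (q^ (suc k)) f .at n) (sumTo-zero n term)
  where
  term : ∀ i → i ≤ n → q^ (suc k) i ℤ.* f (n ∸ i) ≡ 0ℤ
  term i i≤n = trans (cong (ℤ._* f (n ∸ i)) (q^-off {suc k} (ℕP.<⇒≢ (ℕP.≤-<-trans i≤n n<k)))) (ℤP.*-zeroˡ (f (n ∸ i)))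

⊕-q^-at : ∀ f k g {n} → n < k → (f ⊕ q^ k · g) n ≡ f n
⊕-q^-at f k g {n} n<k = trans (⊕-at f (q^ k · g) n) (trans (cong (λ s → f n ℤ.+ s) (q^-below k g n<k)) (ℤP.+-identityʳ (f n)))

-- The Gaussian binomial coefficient of i + j over i in base q⁸.
gauss : ℕ → ℕ → PS
gauss zero j = onePS
gauss (suc i) zero = onePS
gauss (suc i) (suc j) = gauss i (suc j) ⊕ q^ (suc i * 8) · gauss (suc i) j

q⁸ : ∀ i → q^ (suc i * 8) ≈ q^ 8 · q^ (i * 8)
q⁸ i = ≈-sym (q^-+ 8 (i * 8))

-- The mirror image of the defining Pascal rule. Both are needed: a further factor in one of the two
-- finite products calls for this rule, a factor in the other for the defining one.
gauss-pascal : ∀ i j → gauss (suc i) (suc j) ≈ gauss (suc i) j ⊕ q^ (suc j * 8) · gauss i (suc j)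
gauss-pascal zero zero = ≈-refl
gauss-pascal zero (suc j) = begin
  onePS ⊕ Q · gauss 1 (suc j) ≈⟨ ⊕-congˡ (·-congˡ (gauss-pascal zero j)) ⟩
  onePS ⊕ Q · (gauss 1 j ⊕ q^ (suc j * 8) · onePS) ≈⟨ solve 4 (λ o Q g p → o :+ Q :* (g :+ p :* o) := (o :+ Q :* g) :+ (Q :* p) :* o)
                                                                       ≈-refl onePS Q (gauss 1 j) (q^ (suc j * 8)) ⟩
  (onePS ⊕ Q · gauss 1 j) ⊕ (q^ 8 · q^ (suc j * 8)) · onePS ≈⟨ ⊕-congˡ (·-congʳ (q⁸ (suc j))) ⟨
  gauss 1 (suc j) ⊕ q^ (suc (suc j) * 8) · onePS ∎
  where
  open ≈-Reasoning
  Q : PS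
  Q = q^ 8
gauss-pascal (suc i) zero = begin
  gauss (suc i) 1 ⊕ q^ (suc (suc i) * 8) · onePS ≈⟨ ⊕-cong (gauss-pascal i zero) (·-congʳ (q⁸ (suc i))) ⟩
  (onePS ⊕ Q · gauss i 1) ⊕ (Q · q^ (suc i * 8)) · onePS ≈⟨ solve 4 (λ o Q g p → (o :+ Q :* g) :+ (Q :* p) :* o := o :+ Q :* (g :+ p :* o))
                                                                       ≈-refl onePS Q (gauss i 1) (q^ (suc i * 8)) ⟩
  onePS ⊕ Q · (gauss i 1 ⊕ q^ (suc i * 8) · onePS) ∎
  where
  open ≈-Reasoning
  Q : PS
  Q = q^ 8
gauss-pascal (suc i) (suc j) = begin
  gauss (suc i) (suc (suc j)) ⊕ q^ (suc (suc i) * 8) · gauss (suc (suc i)) (suc j)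
    ≈⟨ ⊕-cong (gauss-pascal i (suc j)) (·-cong (q⁸ (suc i)) (gauss-pascal (suc i) j)) ⟩
  (g ⊕ q^ (suc (suc j) * 8) · gauss i (suc (suc j))) ⊕ (Q · a) · (gauss (suc (suc i)) j ⊕ b · g)
    ≈⟨ ⊕-congʳ (⊕-congˡ (·-congʳ (q⁸ (suc j)))) ⟩
  (g ⊕ (Q · b) · gauss i (suc (suc j))) ⊕ (Q · a) · (gauss (suc (suc i)) j ⊕ b · g)
    ≈⟨ solve 6 (λ g h k Q a b → (g :+ (Q :* b) :* h) :+ (Q :* a) :* (k :+ b :* g) := (g :+ (Q :* a) :* k) :+ (Q :* b) :* (h :+ a :* g))
         ≈-refl g (gauss i (suc (suc j))) (gauss (suc (suc i)) j) Q a b ⟩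
  (g ⊕ (Q · a) · gauss (suc (suc i)) j) ⊕ (Q · b) · gauss (suc i) (suc (suc j))
    ≈⟨ ⊕-cong (⊕-congˡ (·-congʳ (q⁸ (suc i)))) (·-congʳ (q⁸ (suc j))) ⟨
  gauss (suc (suc i)) (suc j) ⊕ q^ (suc (suc j) * 8) · gauss (suc i) (suc (suc j)) ∎
  where
  open ≈-Reasoning
  g Q a b : PS
  g = gauss (suc i) (suc j)
  Q = q^ 8
  a = q^ (suc i * 8)
  b = q^ (suc j * 8)

-- The limit of the Gaussian binomials, namely 1/(q⁸;q⁸)_∞. It occurs in both triple products and
-- cancels in S/T.
gauss∞ : PS
gauss∞ n = gauss n n n

-- By the two Pascal rules, raising i or j by one changes only coefficients from 8(i + 1) or 8(j +
-- 1) onwards, beyond n.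
gauss-stable : ∀ {i j n} → n ≤ i → n ≤ j → gauss i j n ≡ gauss∞ n
gauss-stable {i} {j} {n} n≤i n≤j =
  trans (cong₂ (λ i j → gauss i j n) (sym (ℕP.m∸n+n≡m n≤i)) (sym (ℕP.m∸n+n≡m n≤j))) (trans (rows (i ∸ n)) (columns (j ∸ n)))
  where
  small : ∀ {m p} → p ≤ m → p < suc m * 8
  small {m} {p} p≤m = ℕP.≤-trans (s≤s p≤m) (ℕP.m≤m*n (suc m) 8)
  row : ∀ i j → n ≤ i → gauss (suc i) j n ≡ gauss i j n
  row zero zero _ = refl
  row (suc i) zero _ = refl
  row i (suc j) n≤i = ⊕-q^-at (gauss i (suc j)) (suc i * 8) (gauss (suc i) j) (small n≤i)
  column : ∀ i j → n ≤ j → gauss i (suc j) n ≡ gauss i j n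
  column zero j _ = refl
  column (suc i) j n≤j = trans (gauss-pascal i j .at n) (⊕-q^-at (gauss (suc i) j) (suc j * 8) (gauss i (suc j)) (small n≤j))
  rows : ∀ p → gauss (p + n) (j ∸ n + n) n ≡ gauss n (j ∸ n + n) n
  rows zero = refl
  rows (suc p) = trans (row (p + n) (j ∸ n + n) (ℕP.m≤n+m n p)) (rows p)
  columns : ∀ r → gauss n (r + n) n ≡ gauss∞ n
  columns zero = refl
  columns (suc r) = trans (column n (r + n) (ℕP.m≤n+m n r)) (columns r)

antidiagonal : ℕ → (ℕ → ℕ → PS) → PS
antidiagonal zero F = F 0 0
antidiagonal (suc n) F = F 0 (suc n) ⊕ antidiagonal n (λ i → F (suc i))

antidiagonal-cong : ∀ n {F F′ : ℕ → ℕ → PS} → (∀ i j → i + j ≡ n → F i j ≈ F′ i j) → antidiagonal n F ≈ antidiagonal n F′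
antidiagonal-cong zero h = h 0 0 refl
antidiagonal-cong (suc n) h = ⊕-cong (h 0 (suc n) refl) (antidiagonal-cong n (λ i j eq → h (suc i) j (cong suc eq)))

antidiagonal-at-cong : ∀ n m {F F′ : ℕ → ℕ → PS} → (∀ i j → i + j ≡ n → F i j m ≡ F′ i j m) → antidiagonal n F m ≡ antidiagonal n F′ m
antidiagonal-at-cong zero m h = h 0 0 refl
antidiagonal-at-cong (suc n) m {F} {F′} h = trans (⊕-at (F 0 (suc n)) _ m) (trans
  (cong₂ ℤ._+_ (h 0 (suc n) refl) (antidiagonal-at-cong n m (λ i j eq → h (suc i) j (cong suc eq)))) (sym (⊕-at (F′ 0 (suc n)) _ m)))

antidiagonal-⊕ : ∀ n F F′ → antidiagonal n (λ i j → F i j ⊕ F′ i j) ≈ antidiagonal n F ⊕ antidiagonal n F′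
antidiagonal-⊕ zero F F′ = ≈-refl
antidiagonal-⊕ (suc n) F F′ = ≈-trans (⊕-congˡ (antidiagonal-⊕ n (λ i → F (suc i)) (λ i → F′ (suc i))))
  (solve 4 (λ a b c d → (a :+ b) :+ (c :+ d) := (a :+ c) :+ (b :+ d)) ≈-refl _ _ _ _)

antidiagonal-· : ∀ n f F → antidiagonal n (λ i j → f · F i j) ≈ f · antidiagonal n F
antidiagonal-· zero f F = ≈-refl
antidiagonal-· (suc n) f F = ≈-trans (⊕-congˡ (antidiagonal-· n f (λ i → F (suc i)))) (≈-sym (·-distribˡ f _ _))

antidiagonal-last : ∀ n F → antidiagonal (suc n) F ≈ antidiagonal n (λ i j → F i (suc j)) ⊕ F (suc n) 0
antidiagonal-last zero F = ≈-refl
antidiagonal-last (suc n) F = ≈-trans (⊕-congˡ (antidiagonal-last n (λ i → F (suc i)))) (≈-sym (⊕-assoc _ _ _))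

-- The shape of Pascal's triangle: an inner entry of the new row is a sum of two entries, and each
-- end is inherited from one.
antidiagonal-pascal : ∀ n {u v w : ℕ → ℕ → PS} → u 0 (suc n) ≈ v 0 n → u (suc n) 0 ≈ w n 0 →
  (∀ i j → i + suc j ≡ n → u (suc i) (suc j) ≈ v (suc i) j ⊕ w i (suc j)) →
  antidiagonal (suc n) u ≈ antidiagonal n v ⊕ antidiagonal n w
antidiagonal-pascal zero first last step = ⊕-cong first last
antidiagonal-pascal (suc n) {u} {v} {w} first last step = begin
  u 0 (suc (suc n)) ⊕ antidiagonal (suc n) (λ i → u (suc i))
    ≈⟨ ⊕-cong first (antidiagonal-last n (λ i → u (suc i))) ⟩
  v 0 (suc n) ⊕ (antidiagonal n (λ i j → u (suc i) (suc j)) ⊕ u (suc (suc n)) 0)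
    ≈⟨ ⊕-congˡ (⊕-cong (antidiagonal-cong n (λ i j eq → step i j (trans (ℕP.+-suc i j) (cong suc eq)))) last) ⟩
  v 0 (suc n) ⊕ (antidiagonal n (λ i j → v (suc i) j ⊕ w i (suc j)) ⊕ w (suc n) 0)
    ≈⟨ ⊕-congˡ (⊕-congʳ (antidiagonal-⊕ n (λ i → v (suc i)) (λ i j → w i (suc j)))) ⟩
  v 0 (suc n) ⊕ ((antidiagonal n (λ i → v (suc i)) ⊕ antidiagonal n (λ i j → w i (suc j))) ⊕ w (suc n) 0)
    ≈⟨ solve 4 (λ a b c d → a :+ ((b :+ c) :+ d) := (a :+ b) :+ (c :+ d)) ≈-refl _ _ _ _ ⟩
  (v 0 (suc n) ⊕ antidiagonal n (λ i → v (suc i))) ⊕ (antidiagonal n (λ i j → w i (suc j)) ⊕ w (suc n) 0)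
    ≈⟨ ⊕-congˡ (antidiagonal-last n w) ⟨
  antidiagonal (suc n) v ⊕ antidiagonal (suc n) w ∎
  where open ≈-Reasoning

antidiagonal-upTo : ∀ n (f : ℕ → ℕ) F → Σ⟨ applyUpTo f (suc n) ⟩ F ≈ antidiagonal n (λ i _ → F (f i))
antidiagonal-upTo zero f F = ≈-trans (⊕-comm _ zeroPS) (⊕-identityˡ _)
antidiagonal-upTo (suc n) f F = ⊕-congˡ (antidiagonal-upTo n (f ∘ suc) F)

opaque
  unfolding _·_ _⊕_ ⊟_

  times1-q^≈ : ∀ m f → times1-q^ m f ≈ f ⊖ q^ m · f
  times1-q^≈ m f .at n with m ≤ᵇ n in eq
  ... | true = cong (λ x → f n ℤ.+ - x) (sym (trans (cong (q^ m · f) (sym (ℕP.m+[n∸m]≡n m≤n))) (q^-· m f (n ∸ m))))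
    where
    m≤n : m ≤ n
    m≤n = ℕP.≤ᵇ⇒≤ m n (subst Bool.T (sym eq) tt)
  ... | false = sym (trans (cong (λ x → f n ℤ.+ - x) (q^-below m f (ℕP.≰⇒> (λ m≤n → subst Bool.T eq (ℕP.≤⇒≤ᵇ m≤n))))) (ℤP.+-identityʳ (f n)))

-- A factor 1 - q^(a + dN) leaves the coefficients below a + dN unchanged, and n < a + dN as soon as
-- n < N.
finPoch-stable : ∀ a d .{{_ : NonZero a}} .{{_ : NonZero d}} {n} N → n < N → finPoch a d N n ≡ poch a d n
finPoch-stable a d {n} (suc N) (s≤s n≤N) with ℕP.m≤n⇒m<n∨m≡n n≤N
... | inj₂ refl = refl
... | inj₁ n<N = trans (times1-q^≈ (a + d * N) (finPoch a d N) .at n) (trans (⊕-at (finPoch a d N) _ n)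
  (trans (cong (λ x → finPoch a d N n ℤ.+ x) (trans (⊟-at (q^ (a + d * N) · finPoch a d N) n) (cong -_ (q^-below _ (finPoch a d N) below))))
  (trans (ℤP.+-identityʳ (finPoch a d N n)) (finPoch-stable a d N n<N))))
  where
  below : n < a + d * N
  below = ℕP.<-≤-trans n<N (ℕP.≤-trans (ℕP.m≤n*m N d) (ℕP.m≤n+m (d * N) a))

-- For odd a the exponent a + 8N is odd, so the factor 1 - q^(a + 8N) turns into 1 + q^(a + 8N).
neg-finPoch : ∀ a h N → a ≡ suc (h * 2) → neg (finPoch a 8 (suc N)) ≈ neg (finPoch a 8 N) ⊕ q^ (a + 8 * N) · neg (finPoch a 8 N)
neg-finPoch a h N odd = begin
  neg (times1-q^ m f) ≈⟨ neg-cong (times1-q^≈ m f) ⟩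
  neg (f ⊖ q^ m · f) ≈⟨ neg-⊕ f (⊟ (q^ m · f)) ⟩
  neg f ⊕ neg (⊟ (q^ m · f)) ≈⟨ ⊕-congˡ (neg-⊟ (q^ m · f)) ⟩
  neg f ⊕ ⊟ neg (q^ m · f) ≈⟨ ⊕-congˡ (⊟-cong (≈-trans (neg-· (q^ m) f) (·-congʳ negq))) ⟩
  neg f ⊕ ⊟ ((ι ℤ.-1ℤ · q^ m) · neg f) ≈⟨ solve 2 (λ f q → f :- (con ℤ.-1ℤ :* q) :* f := f :+ q :* f) ≈-refl (neg f) (q^ m) ⟩
  neg f ⊕ q^ m · neg f ∎
  where
  open ≈-Reasoning
  m : ℕ
  m = a + 8 * N
  f : PS
  f = finPoch a 8 N
  sgn-m : sgn m ≡ ℤ.-1ℤ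
  sgn-m = trans (cong sgn (trans (cong₂ _+_ odd (trans (ℕP.*-comm 8 N) (sym (ℕP.*-assoc N 4 2)))) (cong suc (sym (ℕP.*-distribʳ-+ 2 h (N * 4))))))
    (cong -_ (sgn-even (h + N * 4)))
  negq : neg (q^ m) ≈ ι ℤ.-1ℤ · q^ m
  negq = ≈-trans (neg-q^ m) (·-congʳ (coeffwise λ n → cong (λ s → ι s n) sgn-m))

z^-cong : ∀ {d e} → d ≡ e → z^ d ≈ z^ e
z^-cong refl = ≈-refl

q^·z^ : ∀ {k l d e} → 0ℤ ℤ.≤ d → 0ℤ ℤ.≤ e → + k ℤ.+ d ≡ + l ℤ.+ e → q^ k · z^ d ≈ q^ l · z^ e
q^·z^ 0≤d 0≤e eq = ≈-trans (z^-+ (ℤ.+≤+ z≤n) 0≤d) (≈-trans (z^-cong eq) (≈-sym (z^-+ (ℤ.+≤+ z≤n) 0≤e)))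

-- Jacobi's triple product with base q⁸ at z = q^{4 + c}, after q ↦ -q, which removes all signs for odd c.
module TripleProduct (c k a b h₁ h₂ : ℕ) (c+k : suc (c + k) ≡ 4) (a≡ : + a ≡ + 4 ℤ.+ + c) (b≡ : + b ≡ + 4 ℤ.- + c)
  (a-odd : a ≡ suc (h₁ * 2)) (b-odd : b ≡ suc (h₂ * 2)) where

  private
    e : ℤ → ℤ
    e = quadratic 4 c

    bound : ∀ x → + ℤ.∣ x ∣ ℤ.≤ e x
    bound x = subst (λ m → + ℤ.∣ x ∣ ℤ.≤ quadratic m c x) c+k (quadratic-bound c k x)

    e≥0 : ∀ x → 0ℤ ℤ.≤ e x
    e≥0 x = ℤP.≤-trans (ℤ.+≤+ z≤n) (bound x)

    term : ℕ → ℕ → ℕ → PS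
    term N i j = z^ e (+ i ℤ.- + N) · gauss i j

    quadraticℤ : ℤ → ℤ → ℤ
    quadraticℤ c x = + 4 ℤ.* (x ℤ.* x) ℤ.+ c ℤ.* x

    quadratic₄ : ∀ {n} → Polynomialℤ n → Polynomialℤ n → Polynomialℤ n
    quadratic₄ c x = κ (+ 4) ⊠ (x ⊠ x) ⊞ c ⊠ x

    -- With e(x + 1) - e(x) = 8x + 4 + c at x = i - N, and i + j = M + N, the factor q^(8j) of
    -- Pascal's rule turns the step from i + 1 to i into exactly the exponent a + 8M of the new
    -- factor.
    raise-upper : ∀ M N i j → i + j ≡ M + N → q^ (j * 8) · z^ e (+ suc i ℤ.- + N) ≈ q^ (a + 8 * M) · z^ e (+ i ℤ.- + N)
    raise-upper M N i j eq = q^·z^ (e≥0 (+ suc i ℤ.- + N)) (e≥0 (+ i ℤ.- + N)) (begin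
      + (j * 8) ℤ.+ e (+ suc i ℤ.- + N)
        ≡⟨ cong (ℤ._+ e (+ suc i ℤ.- + N)) (ℤP.pos-* j 8) ⟩
      + j ℤ.* + 8 ℤ.+ e (+ suc i ℤ.- + N)
        ≡⟨ identity (+ i) (+ j) (+ N) (+ c) ⟩
      ((+ 4 ℤ.+ + c) ℤ.+ + 8 ℤ.* ((+ i ℤ.+ + j) ℤ.- + N)) ℤ.+ e (+ i ℤ.- + N)
        ≡⟨ cong (λ m → ((+ 4 ℤ.+ + c) ℤ.+ + 8 ℤ.* m) ℤ.+ e (+ i ℤ.- + N)) (trans (cong (λ m → + m ℤ.- + N) eq) (cancel (+ M) (+ N))) ⟩
      ((+ 4 ℤ.+ + c) ℤ.+ + 8 ℤ.* + M) ℤ.+ e (+ i ℤ.- + N)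
        ≡⟨ cong (ℤ._+ e (+ i ℤ.- + N)) (cong₂ ℤ._+_ (sym a≡) (sym (ℤP.pos-* 8 M))) ⟩
      + (a + 8 * M) ℤ.+ e (+ i ℤ.- + N) ∎)
      where
      open ≡-Reasoning
      cancel : ∀ x y → x ℤ.+ y ℤ.- y ≡ x
      cancel = solveℤ 2 (λ x y → (x ⊞ y) ∖ y ⩵ x) refl
      identity : ∀ i j N c → j ℤ.* + 8 ℤ.+ quadraticℤ c (1ℤ ℤ.+ i ℤ.- N) ≡ + 4 ℤ.+ c ℤ.+ + 8 ℤ.* (i ℤ.+ j ℤ.- N) ℤ.+ quadraticℤ c (i ℤ.- N)
      identity = solveℤ 4 (λ i j N c → j ⊠ κ (+ 8) ⊞ quadratic₄ c ((κ 1ℤ ⊞ i) ∖ N) ⩵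
        ((κ (+ 4) ⊞ c) ⊞ κ (+ 8) ⊠ ((i ⊞ j) ∖ N)) ⊞ quadratic₄ c (i ∖ N)) refl

    -- The counterpart for a step down: e(x - 1) - e(x) = 4 - c - 8x at x = i - N, and 8i cancels
    -- the dependence on i.
    raise-lower : ∀ N i → q^ (i * 8) · z^ e (+ i ℤ.- + suc N) ≈ q^ (b + 8 * N) · z^ e (+ i ℤ.- + N)
    raise-lower N i = q^·z^ (e≥0 (+ i ℤ.- + suc N)) (e≥0 (+ i ℤ.- + N)) (begin
      + (i * 8) ℤ.+ e (+ i ℤ.- + suc N)
        ≡⟨ cong (ℤ._+ e (+ i ℤ.- + suc N)) (ℤP.pos-* i 8) ⟩
      + i ℤ.* + 8 ℤ.+ e (+ i ℤ.- + suc N)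
        ≡⟨ identity (+ i) (+ N) (+ c) ⟩
      ((+ 4 ℤ.- + c) ℤ.+ + 8 ℤ.* + N) ℤ.+ e (+ i ℤ.- + N)
        ≡⟨ cong (ℤ._+ e (+ i ℤ.- + N)) (cong₂ ℤ._+_ (sym b≡) (sym (ℤP.pos-* 8 N))) ⟩
      + (b + 8 * N) ℤ.+ e (+ i ℤ.- + N) ∎)
      where
      open ≡-Reasoning
      identity : ∀ i N c → i ℤ.* + 8 ℤ.+ quadraticℤ c (i ℤ.- (1ℤ ℤ.+ N)) ≡ + 4 ℤ.- c ℤ.+ + 8 ℤ.* N ℤ.+ quadraticℤ c (i ℤ.- N)
      identity = solveℤ 3 (λ i N c → i ⊠ κ (+ 8) ⊞ quadratic₄ c (i ∖ (κ 1ℤ ⊞ N)) ⩵ ((κ (+ 4) ∖ c) ⊞ κ (+ 8) ⊠ N) ⊞ quadratic₄ c (i ∖ N)) refl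

    shift-index : ∀ i N → z^ e (+ suc i ℤ.- + suc N) ≈ z^ e (+ i ℤ.- + N)
    shift-index i N = z^-cong (cong e (identity (+ i) (+ N)))
      where
      identity : ∀ i N → (+ 1 ℤ.+ i) ℤ.- (+ 1 ℤ.+ N) ≡ i ℤ.- N
      identity = ℤRing.solve-∀

    upper-step : ∀ M N → antidiagonal (suc (M + N)) (term N) ≈ antidiagonal (M + N) (term N) ⊕ q^ (a + 8 * M) · antidiagonal (M + N) (term N)
    upper-step M N = ≈-trans (antidiagonal-pascal (M + N) {u = term N} ≈-refl last step) (⊕-congˡ (antidiagonal-· (M + N) _ (term N)))
      where
      open ≈-Reasoning
      m : ℕ
      m = a + 8 * M
      last : term N (suc (M + N)) 0 ≈ q^ m · term N (M + N) 0
      last = begin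
        z^ e (+ suc (M + N) ℤ.- + N) · onePS ≈⟨ ·-congʳ (·-identityˡ _) ⟨
        (onePS · z^ e (+ suc (M + N) ℤ.- + N)) · onePS ≈⟨ ·-congʳ (raise-upper M N (M + N) 0 (ℕP.+-identityʳ (M + N))) ⟩
        (q^ m · z^ e (+ (M + N) ℤ.- + N)) · onePS ≈⟨ ·-assoc _ _ _ ⟩
        q^ m · (z^ e (+ (M + N) ℤ.- + N) · onePS) ≈⟨ ·-congˡ (·-congˡ (gauss-zero (M + N))) ⟩
        q^ m · term N (M + N) 0 ∎
        where
        gauss-zero : ∀ i → onePS ≈ gauss i 0
        gauss-zero zero = ≈-refl
        gauss-zero (suc i) = ≈-refl
      step : ∀ i j → i + suc j ≡ M + N → term N (suc i) (suc j) ≈ term N (suc i) j ⊕ q^ m · term N i (suc j)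
      step i j eq = begin
        z · gauss (suc i) (suc j)
          ≈⟨ ·-congˡ (gauss-pascal i j) ⟩
        z · (gauss (suc i) j ⊕ q^ (suc j * 8) · gauss i (suc j))
          ≈⟨ solve 4 (λ z g p h → z :* (g :+ p :* h) := z :* g :+ (p :* z) :* h) ≈-refl z (gauss (suc i) j) (q^ (suc j * 8)) (gauss i (suc j)) ⟩
        z · gauss (suc i) j ⊕ (q^ (suc j * 8) · z) · gauss i (suc j)
          ≈⟨ ⊕-congˡ (·-congʳ (raise-upper M N i (suc j) eq)) ⟩
        z · gauss (suc i) j ⊕ (q^ m · z^ e (+ i ℤ.- + N)) · gauss i (suc j)
          ≈⟨ ⊕-congˡ (·-assoc _ _ _) ⟩
        term N (suc i) j ⊕ q^ m · term N i (suc j) ∎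
        where
        z : PS
        z = z^ e (+ suc i ℤ.- + N)

    lower-step : ∀ n N → antidiagonal (suc n) (term (suc N)) ≈ q^ (b + 8 * N) · antidiagonal n (term N) ⊕ antidiagonal n (term N)
    lower-step n N = ≈-trans (antidiagonal-pascal n {u = term (suc N)} {v = λ i j → q^ m · term N i j} first last step) (⊕-congʳ (antidiagonal-· n _ (term N)))
      where
      open ≈-Reasoning
      m : ℕ
      m = b + 8 * N
      first : term (suc N) 0 (suc n) ≈ q^ m · term N 0 n
      first = begin
        z^ e (+ 0 ℤ.- + suc N) · onePS ≈⟨ ·-congʳ (·-identityˡ _) ⟨
        (onePS · z^ e (+ 0 ℤ.- + suc N)) · onePS ≈⟨ ·-congʳ (raise-lower N 0) ⟩
        (q^ m · z^ e (+ 0 ℤ.- + N)) · onePS ≈⟨ ·-assoc _ _ _ ⟩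
        q^ m · term N 0 n ∎
      last : term (suc N) (suc n) 0 ≈ term N n 0
      last = ·-cong (shift-index n N) (gauss-zero n)
        where
        gauss-zero : ∀ i → onePS ≈ gauss i 0
        gauss-zero zero = ≈-refl
        gauss-zero (suc i) = ≈-refl
      step : ∀ i j → i + suc j ≡ n → term (suc N) (suc i) (suc j) ≈ q^ m · term N (suc i) j ⊕ term N i (suc j)
      step i j _ = begin
        z · (gauss i (suc j) ⊕ q^ (suc i * 8) · gauss (suc i) j)
          ≈⟨ solve 4 (λ z g p h → z :* (g :+ p :* h) := (p :* z) :* h :+ z :* g) ≈-refl z (gauss i (suc j)) (q^ (suc i * 8)) (gauss (suc i) j) ⟩
        (q^ (suc i * 8) · z) · gauss (suc i) j ⊕ z · gauss i (suc j)
          ≈⟨ ⊕-cong (·-congʳ (raise-lower N (suc i))) (·-congʳ (shift-index i N)) ⟩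
        (q^ m · z^ e (+ suc i ℤ.- + N)) · gauss (suc i) j ⊕ term N i (suc j)
          ≈⟨ ⊕-congʳ (·-assoc _ _ _) ⟩
        q^ m · term N (suc i) j ⊕ term N i (suc j) ∎
        where
        z : PS
        z = z^ e (+ suc i ℤ.- + suc N)

    -- The finite form of the triple product, an instance of the q-binomial theorem. The induction
    -- adds one factor at a time, each matching a row step of the Gaussian triangle.
    finite : ∀ M N → neg (finPoch a 8 M) · neg (finPoch b 8 N) ≈ antidiagonal (M + N) (term N)
    finite zero zero = begin
      neg onePS · neg onePS ≈⟨ ·-cong neg-onePS neg-onePS ⟩
      onePS · onePS ≈⟨ ·-congʳ (z^-cong (sym (cong (λ s → 0ℤ ℤ.+ s) (ℤP.*-zeroʳ (+ c))))) ⟩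
      z^ e (+ 0 ℤ.- + 0) · onePS ∎
      where open ≈-Reasoning
    finite zero (suc N) = begin
      P · neg (finPoch b 8 (suc N)) ≈⟨ ·-congˡ (neg-finPoch b h₂ N b-odd) ⟩
      P · (R ⊕ q · R) ≈⟨ solve 3 (λ P R q → P :* (R :+ q :* R) := q :* (P :* R) :+ P :* R) ≈-refl P R q ⟩
      q · (P · R) ⊕ P · R ≈⟨ ⊕-cong (·-congˡ (finite zero N)) (finite zero N) ⟩
      q · antidiagonal N (term N) ⊕ antidiagonal N (term N) ≈⟨ lower-step N N ⟨
      antidiagonal (suc N) (term (suc N)) ∎
      where
      open ≈-Reasoning
      P R q : PS
      P = neg onePS
      R = neg (finPoch b 8 N)
      q = q^ (b + 8 * N)
    finite (suc M) N = begin
      neg (finPoch a 8 (suc M)) · R ≈⟨ ·-congʳ (neg-finPoch a h₁ M a-odd) ⟩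
      (P ⊕ q · P) · R ≈⟨ solve 3 (λ P R q → (P :+ q :* P) :* R := P :* R :+ q :* (P :* R)) ≈-refl P R q ⟩
      P · R ⊕ q · (P · R) ≈⟨ ⊕-cong (finite M N) (·-congˡ (finite M N)) ⟩
      A ⊕ q · A ≈⟨ upper-step M N ⟨
      antidiagonal (suc (M + N)) (term N) ∎
      where
      open ≈-Reasoning
      P R q A : PS
      P = neg (finPoch a 8 M)
      R = neg (finPoch b 8 N)
      q = q^ (a + 8 * M)
      A = antidiagonal (M + N) (term N)

    z^-below : ∀ d f {n} → + n ℤ.< d → (z^ d · f) n ≡ 0ℤ
    z^-below (+ k) f (ℤ.+<+ n<k) = q^-below k f n<k

    -- Here N = 2n + 1. An index i farther than n from N has e(i - N) > n, because e x ≥ |x|, and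
    -- contributes nothing to q^n. Otherwise both i and j = 2N - i are at least n, where the
    -- Gaussian binomials have reached their limit.
    term-limit : ∀ n i j → i + j ≡ suc (n + n) + suc (n + n) →
      term (suc (n + n)) i j n ≡ (z^ e (+ i ℤ.- + suc (n + n)) · gauss∞) n
    term-limit n i j eq with ℤ.∣ + i ℤ.- + suc (n + n) ∣ ℕ.≤? n
    ... | no far = trans (z^-below _ (gauss i j) beyond) (sym (z^-below _ gauss∞ beyond))
      where
      beyond : + n ℤ.< e (+ i ℤ.- + suc (n + n))
      beyond = ℤP.<-≤-trans (ℤ.+<+ (ℕP.≰⇒> far)) (bound (+ i ℤ.- + suc (n + n)))
    ... | yes near = ·-at-cong n (λ _ _ → refl) (λ m m≤n → gauss-stable (ℕP.≤-trans m≤n n≤i) (ℕP.≤-trans m≤n n≤j))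
      where
      N : ℕ
      N = suc (n + n)
      distance : + i ℤ.- + N ≡ i ℤ.⊖ N
      distance = ℤP.m-n≡m⊖n i N
      near′ : ℤ.∣ i ℤ.⊖ N ∣ ≤ n
      near′ = subst (λ d → ℤ.∣ d ∣ ≤ n) distance near
      n≤i : n ≤ i
      n≤i with ℕP.≤-total N i
      ... | inj₁ N≤i = ℕP.≤-trans (ℕP.≤-trans (ℕP.m≤m+n n n) (ℕP.n≤1+n (n + n))) N≤i
      ... | inj₂ i≤N = ℕP.+-cancelˡ-≤ n n i (ℕP.≤-trans (ℕP.n≤1+n (n + n)) (ℕP.≤-trans (ℕP.m≤n+m∸n N i)
        (subst (_≤ n + i) (ℕP.+-comm (N ∸ i) i) (ℕP.+-monoˡ-≤ i (subst (_≤ n) (ℤP.∣⊖∣-≤ i≤N) near′)))))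
      n≤j : n ≤ j
      n≤j with ℕP.≤-total N i
      ... | inj₂ i≤N = ℕP.≤-trans (ℕP.≤-trans (ℕP.m≤m+n n n) (ℕP.n≤1+n (n + n)))
        (ℕP.+-cancelˡ-≤ N N j (subst (_≤ N + j) eq (ℕP.+-monoˡ-≤ j i≤N)))
      ... | inj₁ N≤i = ℕP.+-cancelˡ-≤ (N + n) n j (ℕP.≤-trans (subst (_≤ N + N) (sym (ℕP.+-assoc N n n)) (ℕP.+-monoʳ-≤ N (ℕP.n≤1+n (n + n))))
        (subst (_≤ N + n + j) eq (ℕP.+-monoˡ-≤ j (subst (_≤ N + n) (ℕP.m+[n∸m]≡n N≤i)
          (ℕP.+-monoʳ-≤ N (subst (_≤ n) (cong ℤ.∣_∣ (ℤP.⊖-≥ N≤i)) near′))))))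

  -- The coefficient of q^n is taken from the finite identity with M = N = 2n + 1, where the
  -- products, the theta sum and the Gaussian binomials have all become stationary.
  product : neg (poch a 8) · neg (poch b 8) ≈ theta 4 c · gauss∞
  product .at n = begin
    (neg (poch a 8) · neg (poch b 8)) n
      ≡⟨ ·-at-cong n (λ m m≤n → cong (sgn m ℤ.*_) (sym (finPoch-stable a 8 {{a≢0}} N (small m≤n))))
                     (λ m m≤n → cong (sgn m ℤ.*_) (sym (finPoch-stable b 8 {{b≢0}} N (small m≤n)))) ⟩
    (neg (finPoch a 8 N) · neg (finPoch b 8 N)) n
      ≡⟨ finite N N .at n ⟩
    antidiagonal (N + N) (term N) n
      ≡⟨ antidiagonal-at-cong (N + N) n {term N} {λ i _ → z^ e (+ i ℤ.- + N) · gauss∞} (term-limit n) ⟩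
    antidiagonal (N + N) (λ i _ → z^ e (+ i ℤ.- + N) · gauss∞) n
      ≡⟨ antidiagonal-cong (N + N) (λ i _ _ → ·-comm (z^ e (+ i ℤ.- + N)) gauss∞) .at n ⟩
    antidiagonal (N + N) (λ i _ → gauss∞ · z^ e (+ i ℤ.- + N)) n
      ≡⟨ antidiagonal-· (N + N) gauss∞ (λ i _ → z^ e (+ i ℤ.- + N)) .at n ⟩
    (gauss∞ · antidiagonal (N + N) (λ i _ → z^ e (+ i ℤ.- + N))) n
      ≡⟨ ·-at-cong n (λ _ _ → refl) (λ m m≤n → theta-sum m (ℕP.<⇒≤ (small m≤n))) ⟩
    (gauss∞ · theta 4 c) n
      ≡⟨ ·-comm gauss∞ (theta 4 c) .at n ⟩
    (theta 4 c · gauss∞) n ∎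
    where
    open ≡-Reasoning
    N : ℕ
    N = suc (n + n)
    a≢0 : NonZero a
    a≢0 = subst NonZero (sym a-odd) _
    b≢0 : NonZero b
    b≢0 = subst NonZero (sym b-odd) _
    small : ∀ {m} → m ≤ n → m < N
    small m≤n = s≤s (ℕP.≤-trans m≤n (ℕP.m≤m+n n n))
    theta-sum : ∀ m → m ≤ N → antidiagonal (N + N) (λ i _ → z^ e (+ i ℤ.- + N)) m ≡ theta 4 c m
    theta-sum m m≤N = sym (trans (sums (subst (λ d → Gen (quadratic d c) (theta d c)) c+k (gen-theta c k)) N m m≤N) (trans (support-interval c+k) (trans
      (Σ-map (λ i → + i ℤ.- + N) (upTo (suc (N + N))) (λ x → z^ e x) .at m) (antidiagonal-upTo (N + N) id (λ i → z^ e (+ i ℤ.- + N)) .at m))))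
      where
      support-interval : ∀ {d} (p : suc (c + k) ≡ d) → Σ⟨ support (subst (λ d → Gen (quadratic d c) (theta d c)) p (gen-theta c k)) N ⟩ (λ x → z^ quadratic d c x) m
        ≡ Σ⟨ interval N ⟩ (λ x → z^ quadratic d c x) m
      support-interval refl = refl

triple₅₃ : neg (poch 5 8) · neg (poch 3 8) ≈ X₀ · gauss∞
triple₅₃ = TripleProduct.product 1 2 5 3 2 1 refl refl refl refl refl

triple₇₁ : neg (poch 7 8) · neg (poch 1 8) ≈ Y₀ · gauss∞
triple₇₁ = TripleProduct.product 3 0 7 1 3 0 refl refl refl refl refl

-- Ramanujan's relations

·-onePS : ∀ f → f · onePS ≈ f
·-onePS = CommutativeRing.*-identityʳ psRing

·-unit : ∀ {f u} → u ≈ onePS → f · u ≈ f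
·-unit {f} p = ≈-trans (·-congˡ p) (·-onePS f)

unit-·-unit : ∀ {u v} → u ≈ onePS → v ≈ onePS → u · v ≈ onePS
unit-·-unit p r = ≈-trans (·-cong p r) (·-identityˡ onePS)

q : PS
q = q^ 1

iψ iφ : PS
iψ = inv ψ
iφ = inv φ

ψ·iψ : ψ · iψ ≈ onePS
ψ·iψ = inv-inverse (theta-constantTerm 2 1)

φ·iφ : φ · iφ ≈ onePS
φ·iφ = inv-inverse (theta-constantTerm 1 0)

dil-pronic : ∀ k .{{_ : NonZero k}} → dil k pronic ≈ dil (2 * k) {{ℕP.m*n≢0 2 k}} ψ ⊕ dil (2 * k) {{ℕP.m*n≢0 2 k}} ψ
dil-pronic k = ≈-trans (dil-⊕ k (dil 2 ψ) (dil 2 ψ)) (⊕-cong (dil-dil k 2 ψ) (dil-dil k 2 ψ))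

dil-term : ∀ k .{{_ : NonZero k}} c j f → dil k (ι c · (q^ j · f)) ≈ ι c · (q^ (j * k) · dil k f)
dil-term k c j f = ≈-trans (dil-· k (ι c) (q^ j · f)) (·-cong (dil-constant k c) (≈-trans (dil-· k (q^ j) f) (·-congʳ (dil-q^ k j))))

φ-dissection₁ : φ ≈ dil 4 φ ⊕ ι (+ 2) · (q · dil 8 ψ)
φ-dissection₁ = ≈-trans φ-halves (⊕-congˡ (≈-trans (·-congˡ (dil-pronic 4))
  (solve 2 (λ x y → x :* (y :+ y) := con (+ 2) :* (x :* y)) ≈-refl q (dil 8 ψ))))

φ-dissection : ∀ k .{{_ : NonZero k}} →
  dil k φ ≈ dil (4 * k) {{ℕP.m*n≢0 4 k}} φ ⊕ ι (+ 2) · (q^ (1 * k) · dil (8 * k) {{ℕP.m*n≢0 8 k}} ψ)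
φ-dissection k = ≈-trans (dil-cong k φ-dissection₁) (≈-trans (dil-⊕ k (dil 4 φ) (ι (+ 2) · (q · dil 8 ψ)))
  (⊕-cong (dil-dil k 4 φ) (≈-trans (dil-term k (+ 2) 1 (dil 8 ψ)) (·-congˡ (·-congˡ (dil-dil k 8 ψ))))))

φ²-dissection : φ · φ ≈ dil 2 φ · dil 2 φ ⊕ ι (+ 4) · (q · (dil 4 ψ · dil 4 ψ))
φ²-dissection = ≈-trans φ-square (⊕-congˡ (≈-trans (·-congˡ (·-cong (dil-pronic 2) (dil-pronic 2)))
  (solve 2 (λ x y → x :* ((y :+ y) :* (y :+ y)) := con (+ 4) :* (x :* (y :* y))) ≈-refl q (dil 4 ψ))))

φ²-dissection-dil : ∀ k .{{_ : NonZero k}} → let φ₂ₖ = dil (2 * k) {{ℕP.m*n≢0 2 k}} φ ; ψ₄ₖ = dil (4 * k) {{ℕP.m*n≢0 4 k}} ψ in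
  dil k φ · dil k φ ≈ φ₂ₖ · φ₂ₖ ⊕ ι (+ 4) · (q^ (1 * k) · (ψ₄ₖ · ψ₄ₖ))
φ²-dissection-dil k = ≈-trans (≈-sym (dil-· k φ φ)) (≈-trans (dil-cong k φ²-dissection)
  (≈-trans (dil-⊕ k (dil 2 φ · dil 2 φ) (ι (+ 4) · (q · (dil 4 ψ · dil 4 ψ))))
    (⊕-cong (dil-square 2 φ) (≈-trans (dil-term k (+ 4) 1 (dil 4 ψ · dil 4 ψ)) (·-congˡ (·-congˡ (dil-square 4 ψ)))))))
  where
  dil-square : ∀ a .{{_ : NonZero a}} f → let g = dil (a * k) {{ℕP.m*n≢0 a k}} f in dil k (dil a f · dil a f) ≈ g · g
  dil-square a f = ≈-trans (dil-· k (dil a f) (dil a f)) (·-cong (dil-dil k a f) (dil-dil k a f))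

ψ²≈φ·ψ₂ : ψ · ψ ≈ φ · dil 2 ψ
ψ²≈φ·ψ₂ = ≈-trans ψ-square-halves (≈-trans
  (solve 4 (λ a b c d → a :* b :+ c :* (a :* d) := (b :+ c :* d) :* a) ≈-refl (dil 2 ψ) (dil 4 φ) q (dil 4 pronic))
  (·-congʳ (≈-sym φ-halves)))

X₀·Y₀≈ψ·ψ₄ : X₀ · Y₀ ≈ ψ · dil 4 ψ
X₀·Y₀≈ψ·ψ₄ = ≈-trans X₀·Y₀-halves (≈-trans
  (solve 4 (λ a b c d → a :* b :+ c :* (d :* b) := (a :+ c :* d) :* b) ≈-refl (dil 2 X₀) (dil 4 ψ) q (dil 2 Y₀))
  (·-congʳ (≈-sym ψ-halves)))

ψ·ψ₃-dissection : ψ · dil 3 ψ ≈ dil 6 φ · dil 4 ψ ⊕ q · (dil 2 φ · dil 12 ψ)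
ψ·ψ₃-dissection = ≈-trans ψ·ψ₃-quarters (≈-sym (begin
  dil 6 φ · dil 4 ψ ⊕ q · (dil 2 φ · dil 12 ψ)
    ≈⟨ ⊕-cong (·-congʳ (φ-dissection 6)) (·-congˡ (·-congʳ (φ-dissection 2))) ⟩
  (a ⊕ ι (+ 2) · (q^ 6 · b)) · c ⊕ q · ((d ⊕ ι (+ 2) · (q^ 2 · e)) · f)
    ≈⟨ solve 9 (λ a b c d e f q q² q⁶ → (a :+ con (+ 2) :* (q⁶ :* b)) :* c :+ q :* ((d :+ con (+ 2) :* (q² :* e)) :* f)
        := (a :* c :+ q⁶ :* ((b :+ b) :* c)) :+ (q :* (d :* f) :+ (q :* q²) :* ((e :+ e) :* f))) ≈-refl a b c d e f q (q^ 2) (q^ 6) ⟩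
  (a · c ⊕ q^ 6 · ((b ⊕ b) · c)) ⊕ (q · (d · f) ⊕ (q · q^ 2) · ((e ⊕ e) · f))
    ≈⟨ ⊕-cong (⊕-congˡ (·-congˡ (·-congʳ (dil-pronic 24))))
        (⊕-congˡ (·-cong (≈-sym (q^-+ 1 2)) (·-congʳ (dil-pronic 8)))) ⟨
  (a · c ⊕ q^ 6 · (dil 24 pronic · c)) ⊕ (q · (d · f) ⊕ q^ 3 · (dil 8 pronic · f)) ∎))
  where
  open ≈-Reasoning
  a b c d e f : PS
  a = dil 24 φ
  b = dil 48 ψ
  c = dil 4 ψ
  d = dil 8 φ
  e = dil 16 ψ
  f = dil 12 ψ

-- A quotient f / g is kept together with closed forms A of it and A′ of its reciprocal, so that
-- both sides of a claim are carried at once through products, dilations and sign changes.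
record Fraction (f g A A′ : PS) : Set where
  field
    numerator₀ : f 0 ≡ 1ℤ
    denominator₀ : g 0 ≡ 1ℤ
    ratio : f ≈ A · g
    inverse : A · A′ ≈ onePS
open Fraction

fraction-⊘ : ∀ {f g A A′} → Fraction f g A A′ → f ⊘ g ≈ A
fraction-⊘ F = ⊘-unique (denominator₀ F) (≈-sym (ratio F))

fraction-inv : ∀ {f g A A′} → Fraction f g A A′ → inv (f ⊘ g) ≈ A′
fraction-inv {f} {g} F = ≈-sym (inv-unique (cong (ℤ._* 1ℤ) (numerator₀ F)) (≈-trans (·-congʳ (fraction-⊘ F)) (inverse F)))

fraction-⊛ : ∀ {f g A A′ f₁ g₁ B B′} → Fraction f g A A′ → Fraction f₁ g₁ B B′ → Fraction (f ⊛ f₁) (g ⊛ g₁) (A · B) (A′ · B′)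
fraction-⊛ {f} {g} {A} {A′} {f₁} {g₁} {B} {B′} F F₁ = record
  { numerator₀ = cong₂ ℤ._*_ (numerator₀ F) (numerator₀ F₁)
  ; denominator₀ = cong₂ ℤ._*_ (denominator₀ F) (denominator₀ F₁)
  ; ratio = begin
      f ⊛ f₁ ≈⟨ ·≈⊛ f f₁ ⟨
      f · f₁ ≈⟨ ·-cong (ratio F) (ratio F₁) ⟩
      (A · g) · (B · g₁) ≈⟨ solve 4 (λ A g B h → (A :* g) :* (B :* h) := (A :* B) :* (g :* h)) ≈-refl A g B g₁ ⟩
      (A · B) · (g · g₁) ≈⟨ ·-congˡ (·≈⊛ g g₁) ⟩
      (A · B) · (g ⊛ g₁) ∎
  ; inverse = begin
      (A · B) · (A′ · B′) ≈⟨ solve 4 (λ A B C D → (A :* B) :* (C :* D) := (A :* C) :* (B :* D)) ≈-refl A B A′ B′ ⟩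
      (A · A′) · (B · B′) ≈⟨ ·-cong (inverse F) (inverse F₁) ⟩
      onePS · onePS ≈⟨ ·-identityˡ onePS ⟩
      onePS ∎ }
  where open ≈-Reasoning

fraction-swap : ∀ {f g A A′} → Fraction f g A A′ → Fraction g f A′ A
fraction-swap {f} {g} {A} {A′} F = record
  { numerator₀ = denominator₀ F
  ; denominator₀ = numerator₀ F
  ; ratio = begin
      g ≈⟨ ·-identityˡ g ⟨
      onePS · g ≈⟨ ·-congʳ (inverse F) ⟨
      (A · A′) · g ≈⟨ solve 3 (λ A B g → (A :* B) :* g := B :* (A :* g)) ≈-refl A A′ g ⟩
      A′ · (A · g) ≈⟨ ·-congˡ (ratio F) ⟨
      A′ · f ∎
  ; inverse = ≈-trans (·-comm A′ A) (inverse F) }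
  where open ≈-Reasoning

fraction-dil : ∀ k .{{_ : NonZero k}} {f g A A′} → Fraction f g A A′ → Fraction (dil k f) (dil k g) (dil k A) (dil k A′)
fraction-dil k {f} {g} {A} F = record
  { numerator₀ = trans (dil-constantTerm k f) (numerator₀ F)
  ; denominator₀ = trans (dil-constantTerm k g) (denominator₀ F)
  ; ratio = ≈-trans (dil-cong k (ratio F)) (dil-· k A g)
  ; inverse = dil-inverse k (inverse F) }

fraction-neg : ∀ {f g A A′} → Fraction f g A A′ → Fraction (neg f) (neg g) (neg A) (neg A′)
fraction-neg {f} {g} {A} F = record
  { numerator₀ = trans (ℤP.*-identityˡ (f 0)) (numerator₀ F)
  ; denominator₀ = trans (ℤP.*-identityˡ (g 0)) (denominator₀ F)
  ; ratio = ≈-trans (neg-cong (ratio F)) (neg-· A g)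
  ; inverse = neg-inverse (inverse F) }

fraction-≈ : ∀ {f g A A′ B B′} → A ≈ B → A′ ≈ B′ → Fraction f g A A′ → Fraction f g B B′
fraction-≈ p p′ F = record
  { numerator₀ = numerator₀ F ; denominator₀ = denominator₀ F
  ; ratio = ≈-trans (ratio F) (·-congʳ p)
  ; inverse = ≈-trans (·-cong (≈-sym p) (≈-sym p′)) (inverse F) }

fraction-pow : ∀ k {f g A A′} → Fraction f g A A′ → Fraction (powPS k f) (powPS k g) (powPS k A) (powPS k A′)
fraction-pow zero F = record
  { numerator₀ = refl ; denominator₀ = refl ; ratio = ≈-sym (·-identityˡ onePS) ; inverse = ·-identityˡ onePS }
fraction-pow (suc k) {A = A} {A′} F =
  fraction-≈ (·≈⊛ A (powPS k A)) (·≈⊛ A′ (powPS k A′)) (fraction-⊛ F (fraction-pow k F))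

-- X = Σ (-1)^x q^(4x² + x) and Y = Σ (-1)^x q^(4x² + 3x), since the exponents have the parity of x.
-- That G is the quotient of the given products S and T is `S/T`.
X Y G G⁻¹ : PS
X = neg X₀
Y = neg Y₀
G = X · inv Y
G⁻¹ = Y · inv X

X·invX : X · inv X ≈ onePS
X·invX = inv-inverse (trans (ℤP.*-identityˡ (X₀ 0)) (theta-constantTerm 4 1))

Y·invY : Y · inv Y ≈ onePS
Y·invY = inv-inverse (trans (ℤP.*-identityˡ (Y₀ 0)) (theta-constantTerm 4 3))

G·G⁻¹ : G · G⁻¹ ≈ onePS
G·G⁻¹ = begin
  (X · inv Y) · (Y · inv X) ≈⟨ solve 4 (λ x y′ y x′ → (x :* y′) :* (y :* x′) := (x :* x′) :* (y :* y′)) ≈-refl X (inv Y) Y (inv X) ⟩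
  (X · inv X) · (Y · inv Y) ≈⟨ ·-cong X·invX Y·invY ⟩
  onePS · onePS ≈⟨ ·-identityˡ onePS ⟩
  onePS ∎
  where open ≈-Reasoning

-- The triple product was established after q ↦ -q; a second sign change undoes this. What remains
-- next to the theta series, `neg gauss∞ · poch 4 8`, is the same for S and T.
denominator-theta : ∀ a b {θ} → neg (poch a 8) · neg (poch b 8) ≈ θ · gauss∞ →
  poch b 8 ⊛ poch 4 8 ⊛ poch a 8 ≈ neg θ · (neg gauss∞ · poch 4 8)
denominator-theta a b {θ} triple = begin
  poch b 8 ⊛ poch 4 8 ⊛ poch a 8 ≈⟨ ·≈⊛ (poch b 8 ⊛ poch 4 8) (poch a 8) ⟨
  (poch b 8 ⊛ poch 4 8) · poch a 8 ≈⟨ ·-congʳ (·≈⊛ (poch b 8) (poch 4 8)) ⟨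
  (poch b 8 · poch 4 8) · poch a 8 ≈⟨ solve 3 (λ b c a → (b :* c) :* a := (a :* b) :* c) ≈-refl (poch b 8) (poch 4 8) (poch a 8) ⟩
  (poch a 8 · poch b 8) · poch 4 8 ≈⟨ ·-congʳ (·-cong (neg-neg (poch a 8)) (neg-neg (poch b 8))) ⟨
  (neg (neg (poch a 8)) · neg (neg (poch b 8))) · poch 4 8
        ≈⟨ ·-congʳ (neg-· (neg (poch a 8)) (neg (poch b 8))) ⟨
  neg (neg (poch a 8) · neg (poch b 8)) · poch 4 8 ≈⟨ ·-congʳ (≈-trans (neg-cong triple) (neg-· θ gauss∞)) ⟩
  (neg θ · neg gauss∞) · poch 4 8 ≈⟨ ·-assoc _ _ _ ⟩
  neg θ · (neg gauss∞ · poch 4 8) ∎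
  where open ≈-Reasoning

S/T : Fraction S T G G⁻¹
S/T = record
  { numerator₀ = refl
  ; denominator₀ = refl
  ; ratio = ≈-sym (begin
      (X · inv Y) · T ≈⟨ solve 1 (λ g → g := g :* con 1ℤ) ≈-refl ((X · inv Y) · T) ⟩
      -- The factor 1 is replaced by S times its denominator Y · L, so that Y cancels against inv Y,
      -- and X · L against T.
      ((X · inv Y) · T) · ι 1ℤ ≈⟨ ·-congˡ (≈-trans S-inverse onePS≈constant) ⟨
      ((X · inv Y) · T) · ((Y · L) · S) ≈⟨ solve 6 (λ x y′ t y l s → ((x :* y′) :* t) :* ((y :* l) :* s) := ((y :* y′) :* ((x :* l) :* t)) :* s)
        ≈-refl X (inv Y) T Y L S ⟩
      ((Y · inv Y) · ((X · L) · T)) · S ≈⟨ ·-congʳ (·-cong Y·invY T-inverse) ⟩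
      (onePS · onePS) · S ≈⟨ ·-congʳ (·-identityˡ onePS) ⟩
      onePS · S ≈⟨ ·-identityˡ S ⟩
      S ∎)
  ; inverse = G·G⁻¹ }
  where
  open ≈-Reasoning
  L : PS
  L = neg gauss∞ · poch 4 8
  S-inverse : (Y · L) · S ≈ onePS
  S-inverse = ≈-trans (·-congʳ (≈-sym (denominator-theta 7 1 triple₇₁))) (inv-inverse refl)
  T-inverse : (X · L) · T ≈ onePS
  T-inverse = ≈-trans (·-congʳ (≈-sym (denominator-theta 5 3 triple₅₃))) (inv-inverse refl)

iψ₄ : PS
iψ₄ = dil 4 iψ

ψ₄·iψ₄ : dil 4 ψ · iψ₄ ≈ onePS
ψ₄·iψ₄ = dil-inverse 4 ψ·iψ

-- Over the common denominator, the numerator is X² - q Y² = ψ(-q)φ(q²) and the denominator XY =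
-- ψ(-q)ψ(q⁴); ψ(-q) cancels.
G-minus : G ⊖ q · G⁻¹ ≈ dil 2 φ · iψ₄
G-minus = begin
  X · inv Y ⊖ q · (Y · inv X)
    ≈⟨ ⊕-cong (insert X·invX) (⊟-cong (insert Y·invY)) ⟩
  (X · inv Y) · (X · inv X) ⊖ (q · (Y · inv X)) · (Y · inv Y)
    ≈⟨ solve 5 (λ x y x′ y′ q → (x :* y′) :* (x :* x′) :- (q :* (y :* x′)) :* (y :* y′) := (x :* x :- q :* (y :* y)) :* (x′ :* y′))
        ≈-refl X Y (inv X) (inv Y) q ⟩
  (X · X ⊖ q · (Y · Y)) · (inv X · inv Y)
    ≈⟨ ·-cong numerator (insert ψ₄·iψ₄) ⟩
  (neg ψ · dil 2 φ) · ((inv X · inv Y) · (dil 4 ψ · iψ₄))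
    ≈⟨ solve 6 (λ n f x′ y′ p p′ → (n :* f) :* ((x′ :* y′) :* (p :* p′)) := (f :* p′) :* ((n :* p) :* (x′ :* y′)))
        ≈-refl (neg ψ) (dil 2 φ) (inv X) (inv Y) (dil 4 ψ) iψ₄ ⟩
  (dil 2 φ · iψ₄) · ((neg ψ · dil 4 ψ) · (inv X · inv Y))
    ≈⟨ ·-congˡ (·-congʳ denominator) ⟨
  (dil 2 φ · iψ₄) · ((X · Y) · (inv X · inv Y))
    ≈⟨ ·-congˡ (≈-trans (solve 4 (λ x y x′ y′ → (x :* y) :* (x′ :* y′) := (x :* x′) :* (y :* y′)) ≈-refl X Y (inv X) (inv Y))
        (unit-·-unit X·invX Y·invY)) ⟩
  (dil 2 φ · iψ₄) · onePS
    ≈⟨ ·-onePS _ ⟩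
  dil 2 φ · iψ₄ ∎
  where
  open ≈-Reasoning
  insert : ∀ {f u} → u ≈ onePS → f ≈ f · u
  insert p = ≈-sym (·-unit p)
  denominator : X · Y ≈ neg ψ · dil 4 ψ
  denominator = ≈-trans (≈-sym (neg-· X₀ Y₀)) (≈-trans (neg-cong X₀·Y₀≈ψ·ψ₄)
    (≈-trans (neg-· ψ (dil 4 ψ)) (·-congˡ (neg-dil-even 4 ψ))))
  numerator : X · X ⊖ q · (Y · Y) ≈ neg ψ · dil 2 φ
  numerator = ≈-sym (begin
    neg ψ · dil 2 φ ≈⟨ ·-congˡ (neg-dil-even 2 φ) ⟨
    neg ψ · neg (dil 2 φ) ≈⟨ neg-· ψ (dil 2 φ) ⟨
    neg (ψ · dil 2 φ) ≈⟨ neg-cong ψ·φ-halves ⟩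
    neg (X₀ · X₀ ⊕ q · (Y₀ · Y₀)) ≈⟨ neg-⊕ (X₀ · X₀) (q · (Y₀ · Y₀)) ⟩
    neg (X₀ · X₀) ⊕ neg (q · (Y₀ · Y₀)) ≈⟨ ⊕-cong (neg-· X₀ X₀) (≈-trans (neg-· q (Y₀ · Y₀)) (·-cong (neg-q^ 1) (neg-· Y₀ Y₀))) ⟩
    X · X ⊕ (ι ℤ.-1ℤ · q) · (Y · Y) ≈⟨ solve 3 (λ x y q → x :* x :+ (con ℤ.-1ℤ :* q) :* (y :* y) := x :* x :- q :* (y :* y)) ≈-refl X Y q ⟩
    X · X ⊖ q · (Y · Y) ∎)

-- The square is (G - q/G)² + 4q, and φ(q)² = φ(q²)² + 4qψ(q⁴)² shows that it is the square of
-- φ(q)/ψ(q⁴). Comparing constant terms settles the sign.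
G-plus : G ⊕ q · G⁻¹ ≈ φ · iψ₄
G-plus = square-injective left₀ right₀ (begin
  (G ⊕ q · G⁻¹) · (G ⊕ q · G⁻¹)
    ≈⟨ solve 3 (λ g h q → (g :+ q :* h) :* (g :+ q :* h) := (g :- q :* h) :* (g :- q :* h) :+ con (+ 4) :* (q :* (g :* h))) ≈-refl G G⁻¹ q ⟩
  (G ⊖ q · G⁻¹) · (G ⊖ q · G⁻¹) ⊕ ι (+ 4) · (q · (G · G⁻¹))
    ≈⟨ ⊕-cong (·-cong G-minus G-minus) (·-congˡ (·-congˡ (≈-trans G·G⁻¹ (≈-sym unit)))) ⟩
  (dil 2 φ · iψ₄) · (dil 2 φ · iψ₄) ⊕ ι (+ 4) · (q · ((dil 4 ψ · iψ₄) · (dil 4 ψ · iψ₄)))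
    ≈⟨ solve 4 (λ f i q p → (f :* i) :* (f :* i) :+ con (+ 4) :* (q :* ((p :* i) :* (p :* i))) := (f :* f :+ con (+ 4) :* (q :* (p :* p))) :* (i :* i))
        ≈-refl (dil 2 φ) iψ₄ q (dil 4 ψ) ⟩
  (dil 2 φ · dil 2 φ ⊕ ι (+ 4) · (q · (dil 4 ψ · dil 4 ψ))) · (iψ₄ · iψ₄)
    ≈⟨ ·-congʳ φ²-dissection ⟨
  (φ · φ) · (iψ₄ · iψ₄)
    ≈⟨ solve 2 (λ f i → (f :* f) :* (i :* i) := (f :* i) :* (f :* i)) ≈-refl φ iψ₄ ⟩
  (φ · iψ₄) · (φ · iψ₄) ∎)
  where
  open ≈-Reasoning
  unit : (dil 4 ψ · iψ₄) · (dil 4 ψ · iψ₄) ≈ onePS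
  unit = unit-·-unit ψ₄·iψ₄ ψ₄·iψ₄
  right₀ : (φ · iψ₄) 0 ≡ 1ℤ
  right₀ = ·-constantTerm φ iψ₄ (theta-constantTerm 1 0) refl
  left₀ : (G ⊕ q · G⁻¹) 0 ≡ 1ℤ
  left₀ = trans (⊕-q^-at G 1 G⁻¹ (s≤s z≤n)) (·-constantTerm X (inv Y) (trans (ℤP.*-identityˡ (X₀ 0)) (theta-constantTerm 4 1)) refl)

-- Vanishing on arithmetic progressions

open import Algebra.Properties.CommutativeSemigroup ℕP.+-commutativeSemigroup using (x∙yz≈y∙xz)

within-dil₀ : ∀ {m} .{{_ : NonZero m}} k .{{_ : NonZero k}} {f} → Within m (0 ∷ []) f → Within m (0 ∷ []) (dil k f)
within-dil₀ {m} k {f} w n with position k n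
... | nonmultiple r≢0 = inj₁ (dil-nonmultiple k f r≢0)
... | multiple j with w j
... | inj₁ z = inj₁ (trans (dil-multiple k f j) z)
... | inj₂ (here r≡0) = inj₂ (here (trans (ℕD.%-distribˡ-* j k m) (trans (cong (λ r → (r * (k % m)) % m) r≡0) (ℕD.m<n⇒m%n≡m (ℕ.>-nonZero⁻¹ m)))))

within-term : ∀ {m} .{{_ : NonZero m}} c j {R f} → Within m R f → Within m (sumset {m} (0 % m ∷ []) (sumset {m} (j % m ∷ []) R)) (ι c · (q^ j · f))
within-term c j w = within-· (within-constant c) (within-· (within-q^ j) w)

within-⊖ : ∀ {m} .{{_ : NonZero m}} {R R′ f g} → Within m R f → Within m R′ g → Within m (R ++ R′) (f ⊖ g)
within-⊖ w w′ = within-⊕ w (within-⊟ w′)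

-- The offset b is not reduced modulo m: the progression starts at b itself, which leaves room for a
-- stray monomial below b.
record Vanishes (m b : ℕ) (f : PS) : Set where
  constructor vanishing
  field at-progression : ∀ n → f (m * n + b) ≡ 0ℤ
open Vanishes

within-vanishes : ∀ {m} .{{_ : NonZero m}} {R f} b → {False ((b % m) ∈? R)} → Within m R f → Vanishes m b f
within-vanishes {m} {R} b {b∉R} w .at-progression n = within-vanish w (m * n + b) (λ r → toWitnessFalse b∉R (subst (_∈ R) residue r))
  where
  residue : (m * n + b) % m ≡ b % m
  residue = trans (cong (_% m) (trans (ℕP.+-comm (m * n) b) (cong (λ x → b + x) (ℕP.*-comm m n)))) (ℕD.[m+kn]%n≡m%n b n m)

vanishes-q^ : ∀ m b c l → {True (l ℕ.<? b)} → Vanishes m b (ι c · q^ l)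
vanishes-q^ m b c l {l<b} .at-progression n = trans (constant-· c (q^ l) (m * n + b)) (trans
  (cong (c ℤ.*_) (q^-off (λ eq → ℕP.<⇒≢ (ℕP.<-≤-trans (toWitness l<b) (ℕP.m≤n+m b (m * n))) (sym eq)))) (ℤP.*-zeroʳ c))

vanishes-⊕ : ∀ {m b f g} → Vanishes m b f → Vanishes m b g → Vanishes m b (f ⊕ g)
vanishes-⊕ {f = f} {g} v w .at-progression n = trans (⊕-at f g _) (cong₂ ℤ._+_ (v .at-progression n) (w .at-progression n))

vanishes-≈ : ∀ {m b f g} → f ≈ g → Vanishes m b g → Vanishes m b f
vanishes-≈ p v .at-progression n = trans (p .at _) (v .at-progression n)

vanishes-constant⁻¹ : ∀ {m b} c {f} → Vanishes m b (ι (+ suc c) · f) → Vanishes m b f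
vanishes-constant⁻¹ c {f} v .at-progression n with ℤP.i*j≡0⇒i≡0∨j≡0 (+ suc c) (trans (sym (constant-· (+ suc c) f _)) (v .at-progression n))
... | inj₂ z = z

vanishes-q^⁻¹ : ∀ {m b} j {f} → Vanishes m (j + b) (q^ j · f) → Vanishes m b f
vanishes-q^⁻¹ {m} {b} j {f} v .at-progression n = trans (sym (q^-· j f (m * n + b))) (trans (cong (q^ j · f) (x∙yz≈y∙xz j (m * n) b)) (v .at-progression n))

-- The factor q^d moves the coefficients of the reciprocal up by d, so vanishing of A + q^d A′ at mn
-- + d + b compares the series there with its reciprocal at mn + b.
antisymmetric : ∀ {m b} d {A A′ f g} → Fraction f g A A′ → Vanishes m (d + b) (A ⊕ q^ d · A′) →
  ∀ n → (f ⊘ g) (m * n + (d + b)) ≡ - inv (f ⊘ g) (m * n + b)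
antisymmetric {m} {b} d {A} {A′} {f} {g} F v n = begin
  (f ⊘ g) (m * n + (d + b)) ≡⟨ fraction-⊘ F .at _ ⟩
  A (m * n + (d + b)) ≡⟨ cancel _ _ (trans (sym (⊕-at A _ _)) (v .at-progression n)) ⟩
  - (q^ d · A′) (m * n + (d + b)) ≡⟨ cong (λ k → - (q^ d · A′) k) (x∙yz≈y∙xz (m * n) d b) ⟩
  - (q^ d · A′) (d + (m * n + b)) ≡⟨ cong -_ (q^-· d A′ (m * n + b)) ⟩
  - A′ (m * n + b) ≡⟨ cong -_ (fraction-inv F .at _) ⟨
  - inv (f ⊘ g) (m * n + b) ∎
  where
  open ≡-Reasoning
  cancel : ∀ x y → x ℤ.+ y ≡ 0ℤ → x ≡ - y
  cancel x y eq = ℤP.i-j≡0⇒i≡j x (- y) (trans (cong (λ z → x ℤ.+ z) (ℤP.neg-involutive y)) eq)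

symmetric : ∀ {m b} d {A A′ f g} → Fraction f g A A′ → Vanishes m (d + b) (A ⊖ q^ d · A′) →
  ∀ n → (f ⊘ g) (m * n + (d + b)) ≡ inv (f ⊘ g) (m * n + b)
symmetric {m} {b} d {A} {A′} {f} {g} F v n = begin
  (f ⊘ g) (m * n + (d + b)) ≡⟨ fraction-⊘ F .at _ ⟩
  A (m * n + (d + b)) ≡⟨ ℤP.i-j≡0⇒i≡j _ _ (trans (sym (trans (⊕-at A _ _) (cong (λ x → A (m * n + (d + b)) ℤ.+ x) (⊟-at _ _)))) (v .at-progression n)) ⟩
  (q^ d · A′) (m * n + (d + b)) ≡⟨ cong (q^ d · A′) (x∙yz≈y∙xz (m * n) d b) ⟩
  (q^ d · A′) (d + (m * n + b)) ≡⟨ q^-· d A′ (m * n + b) ⟩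
  A′ (m * n + b) ≡⟨ fraction-inv F .at _ ⟨
  inv (f ⊘ g) (m * n + b) ∎
  where
  open ≡-Reasoning

powPS-1 : ∀ f → powPS 1 f ≈ f
powPS-1 f = ≈-trans (≈-sym (·≈⊛ f onePS)) (·-onePS f)

powPS-2 : ∀ f → powPS 2 f ≈ f · f
powPS-2 f = ≈-trans (≈-sym (·≈⊛ f (powPS 1 f))) (·-congˡ (powPS-1 f))

powPS-4 : ∀ f → powPS 4 f ≈ (f · f) · (f · f)
powPS-4 f = ≈-trans (≈-sym (·≈⊛ f _)) (≈-trans (·-congˡ (≈-trans (≈-sym (·≈⊛ f _)) (·-congˡ (powPS-2 f))))
  (solve 1 (λ f → f :* (f :* (f :* f)) := (f :* f) :* (f :* f)) ≈-refl f))

q²≈ : q^ 2 ≈ q · q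
q²≈ = ≈-sym (q^-+ 1 1)

φ₂ φ₄ φ₈ ψ₄ ψ₈ iψ₈ : PS
φ₂ = dil 2 φ
φ₄ = dil 4 φ
φ₈ = dil 8 φ
ψ₄ = dil 4 ψ
ψ₈ = dil 8 ψ
iψ₈ = dil 8 iψ

ψ₈·iψ₈ : ψ₈ · iψ₈ ≈ onePS
ψ₈·iψ₈ = dil-inverse 8 ψ·iψ

ψ₄²≈φ₄·ψ₈ : ψ₄ · ψ₄ ≈ φ₄ · ψ₈
ψ₄²≈φ₄·ψ₈ = ≈-trans (≈-sym (dil-· 4 ψ ψ)) (≈-trans (dil-cong 4 ψ²≈φ·ψ₂) (≈-trans (dil-· 4 φ (dil 2 ψ)) (·-congˡ (dil-dil 4 2 ψ))))

-- From ψ(q⁴)² = φ(q⁴)ψ(q⁸). The gain is that an apparent series in q⁴ is one in q⁸; the claims on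
-- G² modulo 8 depend on it.
φ₄·iψ₄² : φ₄ · (iψ₄ · iψ₄) ≈ iψ₈
φ₄·iψ₄² = begin
  φ₄ · (iψ₄ · iψ₄) ≈⟨ ·-onePS _ ⟨
  (φ₄ · (iψ₄ · iψ₄)) · onePS ≈⟨ ·-congˡ ψ₈·iψ₈ ⟨
  (φ₄ · (iψ₄ · iψ₄)) · (ψ₈ · iψ₈) ≈⟨ solve 4 (λ f i p j → (f :* (i :* i)) :* (p :* j) := (f :* p) :* (i :* i) :* j) ≈-refl φ₄ iψ₄ ψ₈ iψ₈ ⟩
  ((φ₄ · ψ₈) · (iψ₄ · iψ₄)) · iψ₈ ≈⟨ ·-congʳ (·-congʳ ψ₄²≈φ₄·ψ₈) ⟨
  ((ψ₄ · ψ₄) · (iψ₄ · iψ₄)) · iψ₈ ≈⟨ solve 3 (λ p i j → ((p :* p) :* (i :* i)) :* j := (p :* i) :* ((p :* i) :* j)) ≈-refl ψ₄ iψ₄ iψ₈ ⟩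
  (ψ₄ · iψ₄) · ((ψ₄ · iψ₄) · iψ₈) ≈⟨ ·-cong ψ₄·iψ₄ (·-congʳ ψ₄·iψ₄) ⟩
  onePS · (onePS · iψ₈) ≈⟨ ≈-trans (·-identityˡ _) (·-identityˡ _) ⟩
  iψ₈ ∎
  where open ≈-Reasoning

-- Powers of G

part-i : Vanishes 2 1 (G ⊖ q^ 1 · G⁻¹)
part-i = vanishes-≈ G-minus (within-vanishes 1 (within-· (within-dil 2 φ) (within-dil 4 iψ)))

within-φ : Within 4 (0 ∷ 1 ∷ []) φ
within-φ = within-cong (≈-sym φ-dissection₁) (within-⊕ (within-dil 4 φ) (within-term (+ 2) 1 (within-dil 8 ψ)))

part-ii : Vanishes 4 2 (G ⊕ q^ 1 · G⁻¹)
part-ii = vanishes-≈ G-plus (within-vanishes 2 (within-· within-φ (within-dil 4 iψ)))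

-- The square is completed with G - q/G, which is even, and not with G + q/G. The correction 2q lies
-- below the progression.
G²-plus : G · G ⊕ q^ 2 · (G⁻¹ · G⁻¹) ≈ (φ₂ · iψ₄) · (φ₂ · iψ₄) ⊕ ι (+ 2) · q
G²-plus = begin
  G · G ⊕ q^ 2 · (G⁻¹ · G⁻¹)
    ≈⟨ ⊕-congˡ (·-congʳ q²≈) ⟩
  G · G ⊕ (q · q) · (G⁻¹ · G⁻¹)
    ≈⟨ solve 3 (λ g h q → g :* g :+ (q :* q) :* (h :* h) := (g :- q :* h) :* (g :- q :* h) :+ con (+ 2) :* (q :* (g :* h))) ≈-refl G G⁻¹ q ⟩
  (G ⊖ q · G⁻¹) · (G ⊖ q · G⁻¹) ⊕ ι (+ 2) · (q · (G · G⁻¹))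
    ≈⟨ ⊕-cong (·-cong G-minus G-minus) (·-congˡ (·-unit G·G⁻¹)) ⟩
  (φ₂ · iψ₄) · (φ₂ · iψ₄) ⊕ ι (+ 2) · q ∎
  where open ≈-Reasoning

part-iii : Vanishes 2 3 (G · G ⊕ q^ 2 · (G⁻¹ · G⁻¹))
part-iii = vanishes-≈ G²-plus (vanishes-⊕ (within-vanishes 3 (within-· even even)) (vanishes-q^ 2 3 (+ 2) 1))
  where
  even : Within 2 (0 ∷ []) (φ₂ · iψ₄)
  even = within-· (within-dil 2 φ) (within-dil 4 iψ)

-- A difference of squares, hence the product of the two relations. After splitting φ(q), the even
-- part is φ(q²)/ψ(q⁸), whose exponents are 0 and 2 modulo 8; the odd part cannot meet an even
-- offset.
G²-minus : G · G ⊖ q^ 2 · (G⁻¹ · G⁻¹) ≈ (φ₈ ⊕ ι (+ 2) · (q^ 2 · dil 16 ψ)) · iψ₈ ⊕ ι (+ 2) · (q^ 1 · (ψ₈ · (φ₂ · (iψ₄ · iψ₄))))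
G²-minus = begin
  G · G ⊖ q^ 2 · (G⁻¹ · G⁻¹)
    ≈⟨ ⊕-congˡ (⊟-cong (·-congʳ q²≈)) ⟩
  G · G ⊖ (q · q) · (G⁻¹ · G⁻¹)
    ≈⟨ solve 3 (λ g h q → g :* g :- (q :* q) :* (h :* h) := (g :+ q :* h) :* (g :- q :* h)) ≈-refl G G⁻¹ q ⟩
  (G ⊕ q · G⁻¹) · (G ⊖ q · G⁻¹)
    ≈⟨ ·-cong G-plus G-minus ⟩
  (φ · iψ₄) · (φ₂ · iψ₄)
    ≈⟨ ·-congʳ (·-congʳ φ-dissection₁) ⟩
  ((φ₄ ⊕ ι (+ 2) · (q · ψ₈)) · iψ₄) · (φ₂ · iψ₄)
    ≈⟨ solve 5 (λ f q p i g → ((f :+ con (+ 2) :* (q :* p)) :* i) :* (g :* i) := g :* (f :* (i :* i)) :+ con (+ 2) :* (q :* (p :* (g :* (i :* i)))))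
        ≈-refl φ₄ q ψ₈ iψ₄ φ₂ ⟩
  φ₂ · (φ₄ · (iψ₄ · iψ₄)) ⊕ ι (+ 2) · (q · (ψ₈ · (φ₂ · (iψ₄ · iψ₄))))
    ≈⟨ ⊕-congʳ (·-cong (φ-dissection 2) φ₄·iψ₄²) ⟩
  (φ₈ ⊕ ι (+ 2) · (q^ 2 · dil 16 ψ)) · iψ₈ ⊕ ι (+ 2) · (q^ 1 · (ψ₈ · (φ₂ · (iψ₄ · iψ₄)))) ∎
  where open ≈-Reasoning

within-G²-even : Within 8 (0 ∷ 2 ∷ []) ((φ₈ ⊕ ι (+ 2) · (q^ 2 · dil 16 ψ)) · iψ₈)
within-G²-even = within-· (within-⊕ (within-dil 8 φ) (within-term (+ 2) 2 (within-dil 16 ψ))) (within-dil 8 iψ)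

within-G²-odd : Within 2 (1 ∷ []) (ι (+ 2) · (q^ 1 · (ψ₈ · (φ₂ · (iψ₄ · iψ₄)))))
within-G²-odd = within-term (+ 2) 1 (within-· (within-dil 8 ψ) (within-· (within-dil 2 φ)
  (within-· (within-dil 4 iψ) (within-dil 4 iψ))))

vanishes-refine : ∀ {m b f} k → Vanishes m b f → Vanishes (m * k) b f
vanishes-refine {m} {b} {f} k v .at-progression n = trans (cong (λ x → f (x + b)) (ℕP.*-assoc m k n)) (v .at-progression (k * n))

part-iv : Vanishes 8 4 (G · G ⊖ q^ 2 · (G⁻¹ · G⁻¹))
part-iv = vanishes-≈ G²-minus (vanishes-⊕ (within-vanishes 4 within-G²-even) (vanishes-refine 4 (within-vanishes {2} 4 within-G²-odd)))

part-v : Vanishes 8 6 (G · G ⊖ q^ 2 · (G⁻¹ · G⁻¹))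
part-v = vanishes-≈ G²-minus (vanishes-⊕ (within-vanishes 6 within-G²-even) (vanishes-refine 4 (within-vanishes {2} 6 within-G²-odd)))

φ₂²-dissection : φ₂ · φ₂ ≈ φ₄ · φ₄ ⊕ ι (+ 4) · (q^ 2 · (ψ₈ · ψ₈))
φ₂²-dissection = φ²-dissection-dil 2

-- The class 2 modulo 4 collapses to 10q²: completing the square twice leaves 4q² - 2q², and the
-- cross term of φ(q²)⁴ gives 8q²φ(q⁴)²ψ(q⁸)²/ψ(q⁴)⁴ = 8q². The resulting relation is between the
-- fourth power and its own reciprocal, with a minus sign.
part-vi : Vanishes 4 6 ((G · G) · (G · G) ⊕ q^ 4 · ((G⁻¹ · G⁻¹) · (G⁻¹ · G⁻¹)))
part-vi = vanishes-≈ expansion (vanishes-⊕ (vanishes-⊕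
    (within-vanishes 6 (within-· (within-⊕ (within-· four four) (within-term (+ 16) 4 (within-· eight eight))) four′))
    (vanishes-refine 2 (within-vanishes {2} 6 (within-term (+ 4) 1 (within-· two two)))))
    (vanishes-q^ 4 6 (+ 10) 2))
  where
  open ≈-Reasoning
  N : PS
  N = φ₂ · iψ₄
  expansion : (G · G) · (G · G) ⊕ q^ 4 · ((G⁻¹ · G⁻¹) · (G⁻¹ · G⁻¹)) ≈
    ((((φ₄ · φ₄) · (φ₄ · φ₄)) ⊕ ι (+ 16) · (q^ 4 · ((ψ₈ · ψ₈) · (ψ₈ · ψ₈)))) · ((iψ₄ · iψ₄) · (iψ₄ · iψ₄))
      ⊕ ι (+ 4) · (q^ 1 · (N · N))) ⊕ ι (+ 10) · q^ 2
  expansion = begin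
    (G · G) · (G · G) ⊕ q^ 4 · ((G⁻¹ · G⁻¹) · (G⁻¹ · G⁻¹))
      ≈⟨ ⊕-congˡ (·-congʳ (≈-sym (q^-+ 2 2))) ⟩
    (G · G) · (G · G) ⊕ (q^ 2 · q^ 2) · ((G⁻¹ · G⁻¹) · (G⁻¹ · G⁻¹))
      ≈⟨ solve 3 (λ g h p → (g :* g) :* (g :* g) :+ (p :* p) :* ((h :* h) :* (h :* h)) := (g :* g :+ p :* (h :* h)) :* (g :* g :+ p :* (h :* h)) :- con (+ 2) :* (p :* ((g :* h) :* (g :* h))))
        ≈-refl G G⁻¹ (q^ 2) ⟩
    (G · G ⊕ q^ 2 · (G⁻¹ · G⁻¹)) · (G · G ⊕ q^ 2 · (G⁻¹ · G⁻¹)) ⊖ ι (+ 2) · (q^ 2 · ((G · G⁻¹) · (G · G⁻¹)))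
      ≈⟨ ⊕-cong (·-cong G²-plus G²-plus) (⊟-cong (·-congˡ (·-cong q²≈ (≈-trans (·-cong G·G⁻¹ G·G⁻¹) (≈-trans (·-identityˡ onePS) onePS≈constant))))) ⟩
    (N · N ⊕ ι (+ 2) · q) · (N · N ⊕ ι (+ 2) · q) ⊖ ι (+ 2) · ((q · q) · ι 1ℤ)
      ≈⟨ solve 3 (λ f i q → ((f :* i) :* (f :* i) :+ con (+ 2) :* q) :* ((f :* i) :* (f :* i) :+ con (+ 2) :* q) :- con (+ 2) :* ((q :* q) :* con 1ℤ)
        := ((((f :* f) :* (f :* f)) :* ((i :* i) :* (i :* i))) :+ con (+ 4) :* (q :* ((f :* i) :* (f :* i)))) :+ con (+ 2) :* (q :* q)) ≈-refl φ₂ iψ₄ q ⟩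
    (((φ₂ · φ₂) · (φ₂ · φ₂)) · I ⊕ ι (+ 4) · (q · (N · N))) ⊕ ι (+ 2) · (q · q)
      ≈⟨ ⊕-congʳ (⊕-congʳ (·-congʳ (·-cong φ₂²-dissection φ₂²-dissection))) ⟩
    (((φ₄ · φ₄ ⊕ ι (+ 4) · (q^ 2 · (ψ₈ · ψ₈))) · (φ₄ · φ₄ ⊕ ι (+ 4) · (q^ 2 · (ψ₈ · ψ₈)))) · I ⊕ ι (+ 4) · (q · (N · N))) ⊕ ι (+ 2) · (q · q)
      ≈⟨ ⊕-congʳ (⊕-congʳ square) ⟩
    ((H · I ⊕ ι (+ 8) · (q · q)) ⊕ ι (+ 4) · (q · (N · N))) ⊕ ι (+ 2) · (q · q)
      ≈⟨ solve 3 (λ h n p → ((h :+ con (+ 8) :* p) :+ n) :+ con (+ 2) :* p := (h :+ n) :+ con (+ 10) :* p) ≈-refl (H · I) (ι (+ 4) · (q · (N · N))) (q · q) ⟩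
    (H · I ⊕ ι (+ 4) · (q · (N · N))) ⊕ ι (+ 10) · (q · q)
      ≈⟨ ⊕-congˡ (·-congˡ q²≈) ⟨
    (H · I ⊕ ι (+ 4) · (q^ 1 · (N · N))) ⊕ ι (+ 10) · q^ 2 ∎
    where
    I H : PS
    I = (iψ₄ · iψ₄) · (iψ₄ · iψ₄)
    H = ((φ₄ · φ₄) · (φ₄ · φ₄)) ⊕ ι (+ 16) · (q^ 4 · ((ψ₈ · ψ₈) · (ψ₈ · ψ₈)))
    square : ((φ₄ · φ₄ ⊕ ι (+ 4) · (q^ 2 · (ψ₈ · ψ₈))) · (φ₄ · φ₄ ⊕ ι (+ 4) · (q^ 2 · (ψ₈ · ψ₈)))) · I ≈ H · I ⊕ ι (+ 8) · (q · q)
    square = begin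
      ((φ₄ · φ₄ ⊕ ι (+ 4) · (q^ 2 · (ψ₈ · ψ₈))) · (φ₄ · φ₄ ⊕ ι (+ 4) · (q^ 2 · (ψ₈ · ψ₈)))) · I
        ≈⟨ solve 4 (λ f p x i → ((f :* f :+ con (+ 4) :* (x :* (p :* p))) :* (f :* f :+ con (+ 4) :* (x :* (p :* p)))) :* i
        := ((f :* f) :* (f :* f) :+ con (+ 16) :* ((x :* x) :* ((p :* p) :* (p :* p)))) :* i :+ con (+ 8) :* (x :* (((f :* p) :* (f :* p)) :* i))) ≈-refl φ₄ ψ₈ (q^ 2) I ⟩
      ((φ₄ · φ₄) · (φ₄ · φ₄) ⊕ ι (+ 16) · ((q^ 2 · q^ 2) · ((ψ₈ · ψ₈) · (ψ₈ · ψ₈)))) · I ⊕ ι (+ 8) · (q^ 2 · (((φ₄ · ψ₈) · (φ₄ · ψ₈)) · I))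
        ≈⟨ ⊕-cong (·-congʳ (⊕-congˡ (·-congˡ (·-congʳ (q^-+ 2 2))))) (·-congˡ (≈-trans (·-cong q²≈ unit) (·-onePS (q · q)))) ⟩
      H · I ⊕ ι (+ 8) · (q · q) ∎
      where
      unit : ((φ₄ · ψ₈) · (φ₄ · ψ₈)) · I ≈ onePS
      unit = begin
        ((φ₄ · ψ₈) · (φ₄ · ψ₈)) · I ≈⟨ ·-congʳ (·-cong ψ₄²≈φ₄·ψ₈ ψ₄²≈φ₄·ψ₈) ⟨
        ((ψ₄ · ψ₄) · (ψ₄ · ψ₄)) · I ≈⟨ solve 2 (λ p i → ((p :* p) :* (p :* p)) :* ((i :* i) :* (i :* i)) := ((p :* i) :* (p :* i)) :* ((p :* i) :* (p :* i))) ≈-refl ψ₄ iψ₄ ⟩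
        ((ψ₄ · iψ₄) · (ψ₄ · iψ₄)) · ((ψ₄ · iψ₄) · (ψ₄ · iψ₄))
        ≈⟨ ·-cong one one ⟩
        onePS · onePS ≈⟨ ·-identityˡ onePS ⟩
        onePS ∎
        where
        one : (ψ₄ · iψ₄) · (ψ₄ · iψ₄) ≈ onePS
        one = unit-·-unit ψ₄·iψ₄ ψ₄·iψ₄
  four : Within 4 (0 ∷ []) (φ₄ · φ₄)
  four = within-· (within-dil 4 φ) (within-dil 4 φ)
  eight : Within 4 (0 ∷ []) (ψ₈ · ψ₈)
  eight = within-· (within-dil 8 ψ) (within-dil 8 ψ)
  four′ : Within 4 (0 ∷ []) ((iψ₄ · iψ₄) · (iψ₄ · iψ₄))
  four′ = within-· iψ₄² iψ₄²
    where
    iψ₄² : Within 4 (0 ∷ []) (iψ₄ · iψ₄)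
    iψ₄² = within-· (within-dil 4 iψ) (within-dil 4 iψ)
  two : Within 2 (0 ∷ []) N
  two = within-· (within-dil 2 φ) (within-dil 4 iψ)

-- Products and quotients of two dilations of G

G-plus-dil : ∀ k .{{_ : NonZero k}} → dil k G ⊕ q^ (1 * k) · dil k G⁻¹ ≈ dil k φ · dil k iψ₄
G-plus-dil k = ≈-trans (≈-sym (≈-trans (dil-⊕ k G (q · G⁻¹)) (⊕-congˡ (≈-trans (dil-· k q G⁻¹) (·-congʳ (dil-q^ k 1))))))
  (≈-trans (dil-cong k G-plus) (dil-· k φ iψ₄))

G-minus-dil : ∀ k .{{_ : NonZero k}} → dil k G ⊖ q^ (1 * k) · dil k G⁻¹ ≈ dil k φ₂ · dil k iψ₄
G-minus-dil k = ≈-trans (≈-sym (≈-trans (dil-⊕ k G (⊟ (q · G⁻¹))) (⊕-congˡ (≈-trans (dil-⊟ k (q · G⁻¹)) (⊟-cong (≈-trans (dil-· k q G⁻¹) (·-congʳ (dil-q^ k 1))))))))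
  (≈-trans (dil-cong k G-minus) (dil-· k φ₂ iψ₄))

-- The difference of (G + q/G)(Gₖ + q^k/Gₖ) and (G - q/G)(Gₖ - q^k/Gₖ) keeps only the mixed terms
-- Gₖ/G and G/Gₖ. Their sum, in `product-formula`, keeps GGₖ and its reciprocal.
quotient-formula : ∀ k c .{{_ : NonZero k}} → suc c ≡ 1 * k →
  ι (+ 2) · (q^ 1 · (G⁻¹ · dil k G ⊕ q^ c · (G · dil k G⁻¹))) ≈ (φ · dil k φ ⊖ φ₂ · dil k φ₂) · (iψ₄ · dil k iψ₄)
quotient-formula k c eq = begin
  ι (+ 2) · (q^ 1 · (G⁻¹ · Gₖ ⊕ p · (G · Gₖ⁻¹)))
    ≈⟨ solve 6 (λ g h gk hk q p → con (+ 2) :* (q :* (h :* gk :+ p :* (g :* hk))) :=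
        (g :+ q :* h) :* (gk :+ (q :* p) :* hk) :- (g :- q :* h) :* (gk :- (q :* p) :* hk)) ≈-refl G G⁻¹ Gₖ Gₖ⁻¹ q p ⟩
  (G ⊕ q · G⁻¹) · (Gₖ ⊕ (q · p) · Gₖ⁻¹) ⊖ (G ⊖ q · G⁻¹) · (Gₖ ⊖ (q · p) · Gₖ⁻¹)
    ≈⟨ ⊕-cong (·-cong G-plus (≈-trans (⊕-congˡ (·-congʳ qp)) (G-plus-dil k)))
        (⊟-cong (·-cong G-minus (≈-trans (⊕-congˡ (⊟-cong (·-congʳ qp))) (G-minus-dil k)))) ⟩
  (φ · iψ₄) · (dil k φ · dil k iψ₄) ⊖ (φ₂ · iψ₄) · (dil k φ₂ · dil k iψ₄)
    ≈⟨ solve 6 (λ f fk e ek i ik → (f :* i) :* (fk :* ik) :- (e :* i) :* (ek :* ik) := (f :* fk :- e :* ek) :* (i :* ik))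
        ≈-refl φ (dil k φ) φ₂ (dil k φ₂) iψ₄ (dil k iψ₄) ⟩
  (φ · dil k φ ⊖ φ₂ · dil k φ₂) · (iψ₄ · dil k iψ₄) ∎
  where
  open ≈-Reasoning
  Gₖ Gₖ⁻¹ p : PS
  Gₖ = dil k G
  Gₖ⁻¹ = dil k G⁻¹
  p = q^ c
  qp : q · q^ c ≈ q^ (1 * k)
  qp = ≈-trans (q^-+ 1 c) (coeffwise λ n → cong (λ m → q^ m n) eq)

product-formula : ∀ k c .{{_ : NonZero k}} → c ≡ suc (1 * k) →
  ι (+ 2) · (G · dil k G ⊕ q^ c · (G⁻¹ · dil k G⁻¹)) ≈ (φ · dil k φ ⊕ φ₂ · dil k φ₂) · (iψ₄ · dil k iψ₄)
product-formula k c refl = begin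
  ι (+ 2) · (G · Gₖ ⊕ q^ c · (G⁻¹ · Gₖ⁻¹))
    ≈⟨ ·-congˡ (⊕-congˡ (·-congʳ (≈-sym (q^-+ 1 (1 * k))))) ⟩
  ι (+ 2) · (G · Gₖ ⊕ (q · p) · (G⁻¹ · Gₖ⁻¹))
    ≈⟨ solve 6 (λ g h gk hk q p → con (+ 2) :* (g :* gk :+ (q :* p) :* (h :* hk)) :=
        (g :+ q :* h) :* (gk :+ p :* hk) :+ (g :- q :* h) :* (gk :- p :* hk)) ≈-refl G G⁻¹ Gₖ Gₖ⁻¹ q p ⟩
  (G ⊕ q · G⁻¹) · (Gₖ ⊕ p · Gₖ⁻¹) ⊕ (G ⊖ q · G⁻¹) · (Gₖ ⊖ p · Gₖ⁻¹)
    ≈⟨ ⊕-cong (·-cong G-plus (G-plus-dil k)) (·-cong G-minus (G-minus-dil k)) ⟩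
  (φ · iψ₄) · (dil k φ · dil k iψ₄) ⊕ (φ₂ · iψ₄) · (dil k φ₂ · dil k iψ₄)
    ≈⟨ solve 6 (λ f fk e ek i ik → (f :* i) :* (fk :* ik) :+ (e :* i) :* (ek :* ik) := (f :* fk :+ e :* ek) :* (i :* ik))
        ≈-refl φ (dil k φ) φ₂ (dil k φ₂) iψ₄ (dil k iψ₄) ⟩
  (φ · dil k φ ⊕ φ₂ · dil k φ₂) · (iψ₄ · dil k iψ₄) ∎
  where
  open ≈-Reasoning
  Gₖ Gₖ⁻¹ p : PS
  Gₖ = dil k G
  Gₖ⁻¹ = dil k G⁻¹
  p = q^ (1 * k)

within-φ-dil : ∀ k .{{_ : NonZero k}} → Within 4 (0 ∷ sumset {4} (0 ∷ []) (sumset {4} (1 * k % 4 ∷ []) (0 ∷ []))) (dil k φ)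
within-φ-dil k = within-cong (≈-sym (≈-trans (dil-cong k φ-dissection₁)
    (≈-trans (dil-⊕ k φ₄ (ι (+ 2) · (q · ψ₈))) (⊕-congˡ (dil-term k (+ 2) 1 ψ₈)))))
  (within-⊕ (within-dil₀ k (within-dil 4 φ)) (within-term (+ 2) (1 * k) (within-dil₀ k (within-dil 8 ψ))))

within-φ₂-dil : ∀ k .{{_ : NonZero k}} → Within 4 _ (dil k φ₂)
within-φ₂-dil k = within-cong (≈-sym (dil-dil k 2 φ)) (within-φ-dil (2 * k) {{ℕP.m*n≢0 2 k}})

within-φ₂ : Within 4 (0 ∷ 2 ∷ []) φ₂
within-φ₂ = within-φ-dil 2

within-iψ₄·dil : ∀ k .{{_ : NonZero k}} → Within 4 (0 ∷ []) (iψ₄ · dil k iψ₄)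
within-iψ₄·dil k = within-· (within-dil 4 iψ) (within-dil₀ k (within-dil 4 iψ))

within-φ·φ : ∀ k .{{_ : NonZero k}} → Within 4 _ (φ · dil k φ)
within-φ·φ k = within-· within-φ (within-φ-dil k)

-- For k ≡ 1 modulo 4 residues suffice: φ(q)φ(q^k) has exponents 0, 1, 2 modulo 4, and
-- φ(q²)φ(q^(2k)) has even ones, so the class 3 is empty. The other claims for k = 5 and k = 9
-- follow in the same way.
part-viii : Vanishes 4 6 (G⁻¹ · dil 5 G ⊕ q^ 4 · (G · dil 5 G⁻¹))
part-viii = vanishes-q^⁻¹ 1 (vanishes-constant⁻¹ 1 (vanishes-≈ (quotient-formula 5 4 refl)
  (within-vanishes 7 (within-· (within-⊖ (within-φ·φ 5) (within-· within-φ₂ (within-φ₂-dil 5))) (within-iψ₄·dil 5)))))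

part-x : Vanishes 4 10 (G⁻¹ · dil 9 G ⊕ q^ 8 · (G · dil 9 G⁻¹))
part-x = vanishes-q^⁻¹ 1 (vanishes-constant⁻¹ 1 (vanishes-≈ (quotient-formula 9 8 refl)
  (within-vanishes 11 (within-· (within-⊖ (within-φ·φ 9) (within-· within-φ₂ (within-φ₂-dil 9))) (within-iψ₄·dil 9)))))

part-xii : Vanishes 4 7 (G · dil 5 G ⊕ q^ 6 · (G⁻¹ · dil 5 G⁻¹))
part-xii = vanishes-constant⁻¹ 1 (vanishes-≈ (product-formula 5 6 refl)
  (within-vanishes 7 (within-· (within-⊕ (within-φ·φ 5) (within-· within-φ₂ (within-φ₂-dil 5))) (within-iψ₄·dil 5))))

part-xiii : Vanishes 4 11 (G · dil 9 G ⊕ q^ 10 · (G⁻¹ · dil 9 G⁻¹))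
part-xiii = vanishes-constant⁻¹ 1 (vanishes-≈ (product-formula 9 10 refl)
  (within-vanishes 11 (within-· (within-⊕ (within-φ·φ 9) (within-· within-φ₂ (within-φ₂-dil 9))) (within-iψ₄·dil 9))))

ψ₄·ψ₁₂-dissection : ψ₄ · dil 12 ψ ≈ dil 24 φ · dil 16 ψ ⊕ q^ 4 · (φ₈ · dil 48 ψ)
ψ₄·ψ₁₂-dissection = begin
  ψ₄ · dil 12 ψ ≈⟨ ·-congˡ (dil-dil 4 3 ψ) ⟨
  dil 4 ψ · dil 4 (dil 3 ψ) ≈⟨ dil-· 4 ψ (dil 3 ψ) ⟨
  dil 4 (ψ · dil 3 ψ) ≈⟨ dil-cong 4 ψ·ψ₃-dissection ⟩
  dil 4 (dil 6 φ · dil 4 ψ ⊕ q · (dil 2 φ · dil 12 ψ)) ≈⟨ dil-⊕ 4 (dil 6 φ · dil 4 ψ) (q · (dil 2 φ · dil 12 ψ)) ⟩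
  dil 4 (dil 6 φ · dil 4 ψ) ⊕ dil 4 (q · (dil 2 φ · dil 12 ψ)) ≈⟨ ⊕-cong (dil-· 4 (dil 6 φ) (dil 4 ψ)) (≈-trans (dil-· 4 q (dil 2 φ · dil 12 ψ))
        (·-cong (dil-q^ 4 1) (dil-· 4 (dil 2 φ) (dil 12 ψ)))) ⟩
  dil 4 (dil 6 φ) · dil 4 (dil 4 ψ) ⊕ q^ 4 · (dil 4 (dil 2 φ) · dil 4 (dil 12 ψ))
    ≈⟨ ⊕-cong (·-cong (dil-dil 4 6 φ) (dil-dil 4 4 ψ)) (·-congˡ (·-cong (dil-dil 4 2 φ) (dil-dil 4 12 ψ))) ⟩
  dil 24 φ · dil 16 ψ ⊕ q^ 4 · (φ₈ · dil 48 ψ) ∎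
  where open ≈-Reasoning

-- For k = 3 the obstruction is the class 2 modulo 4 of φ(q²)φ(q⁶). It equals 2q²ψ(q⁴)ψ(q¹²), whose
-- ψ's are precisely the denominator, so only 2q² survives the division.
φ₂·φ₆-dissection : φ₂ · dil 6 φ ≈ (φ₈ · dil 24 φ ⊕ ι (+ 4) · (q^ 8 · (dil 16 ψ · dil 48 ψ))) ⊕ ι (+ 2) · (q^ 2 · (ψ₄ · dil 12 ψ))
φ₂·φ₆-dissection = begin
  φ₂ · dil 6 φ
    ≈⟨ ·-cong (φ-dissection 2) (φ-dissection 6) ⟩
  (φ₈ ⊕ ι (+ 2) · (q^ 2 · dil 16 ψ)) · (dil 24 φ ⊕ ι (+ 2) · (q^ 6 · dil 48 ψ))
    ≈⟨ ·-congˡ (⊕-congˡ (·-congˡ (·-congʳ (≈-sym (q^-+ 2 4))))) ⟩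
  (φ₈ ⊕ ι (+ 2) · (q^ 2 · dil 16 ψ)) · (dil 24 φ ⊕ ι (+ 2) · ((q^ 2 · q^ 4) · dil 48 ψ))
    ≈⟨ solve 6 (λ f p g r x y → (f :+ con (+ 2) :* (x :* p)) :* (g :+ con (+ 2) :* ((x :* y) :* r)) :=
        (f :* g :+ con (+ 4) :* (((x :* x) :* y) :* (p :* r))) :+ con (+ 2) :* (x :* (g :* p :+ y :* (f :* r))))
        ≈-refl φ₈ (dil 16 ψ) (dil 24 φ) (dil 48 ψ) (q^ 2) (q^ 4) ⟩
  (φ₈ · dil 24 φ ⊕ ι (+ 4) · (((q^ 2 · q^ 2) · q^ 4) · (dil 16 ψ · dil 48 ψ))) ⊕ ι (+ 2) · (q^ 2 · (dil 24 φ · dil 16 ψ ⊕ q^ 4 · (φ₈ · dil 48 ψ)))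
    ≈⟨ ⊕-cong (⊕-congˡ (·-congˡ (·-congʳ (≈-trans (·-congʳ (q^-+ 2 2)) (q^-+ 4 4))))) (·-congˡ (·-congˡ (≈-sym ψ₄·ψ₁₂-dissection))) ⟩
  (φ₈ · dil 24 φ ⊕ ι (+ 4) · (q^ 8 · (dil 16 ψ · dil 48 ψ))) ⊕ ι (+ 2) · (q^ 2 · (ψ₄ · dil 12 ψ)) ∎
  where open ≈-Reasoning

ψ₁₂·iψ₁₂ : dil 12 ψ · dil 3 iψ₄ ≈ onePS
ψ₁₂·iψ₁₂ = ≈-trans (·-congʳ (≈-sym (dil-dil 3 4 ψ))) (dil-inverse 3 ψ₄·iψ₄)

W : PS
W = φ₈ · dil 24 φ ⊕ ι (+ 4) · (q^ 8 · (dil 16 ψ · dil 48 ψ))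

within-W : Within 4 (0 ∷ 0 ∷ []) W
within-W = within-⊕ (within-· (within-dil 8 φ) (within-dil 24 φ))
  (within-term (+ 4) 8 (within-· (within-dil 16 ψ) (within-dil 48 ψ)))

I₃ : PS
I₃ = iψ₄ · dil 3 iψ₄

φ₂·φ₆-split : φ₂ · dil 3 φ₂ ≈ W ⊕ ι (+ 2) · (q^ 2 · (ψ₄ · dil 12 ψ))
φ₂·φ₆-split = ≈-trans (·-congˡ (dil-dil 3 2 φ)) φ₂·φ₆-dissection

split-constant : (ι (+ 2) · (q^ 2 · (ψ₄ · dil 12 ψ))) · I₃ ≈ ι (+ 2) · q^ 2
split-constant = begin
  (ι (+ 2) · (q^ 2 · (ψ₄ · dil 12 ψ))) · (iψ₄ · dil 3 iψ₄)
    ≈⟨ solve 5 (λ x p r i j → (con (+ 2) :* (x :* (p :* r))) :* (i :* j) := (con (+ 2) :* x) :* ((p :* i) :* (r :* j))) ≈-refl (q^ 2) ψ₄ (dil 12 ψ) iψ₄ (dil 3 iψ₄) ⟩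
  (ι (+ 2) · q^ 2) · ((ψ₄ · iψ₄) · (dil 12 ψ · dil 3 iψ₄))
    ≈⟨ ·-congˡ (unit-·-unit ψ₄·iψ₄ ψ₁₂·iψ₁₂) ⟩
  (ι (+ 2) · q^ 2) · onePS
    ≈⟨ ·-onePS _ ⟩
  ι (+ 2) · q^ 2 ∎
  where open ≈-Reasoning

part-vii : Vanishes 4 5 (G⁻¹ · dil 3 G ⊕ q^ 2 · (G · dil 3 G⁻¹))
part-vii = vanishes-q^⁻¹ 1 (vanishes-constant⁻¹ 1 (vanishes-≈ (begin
  ι (+ 2) · (q^ 1 · (G⁻¹ · dil 3 G ⊕ q^ 2 · (G · dil 3 G⁻¹)))
    ≈⟨ quotient-formula 3 2 refl ⟩
  (φ · dil 3 φ ⊖ φ₂ · dil 3 φ₂) · I₃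
    ≈⟨ ·-congʳ (⊕-congˡ (⊟-cong φ₂·φ₆-split)) ⟩
  (φ · dil 3 φ ⊖ (W ⊕ ι (+ 2) · (q^ 2 · (ψ₄ · dil 12 ψ)))) · I₃
    ≈⟨ solve 4 (λ f w c i → (f :- (w :+ c)) :* i := (f :- w) :* i :+ con (- + 1) :* (c :* i)) ≈-refl _ _ _ _ ⟩
  (φ · dil 3 φ ⊖ W) · I₃ ⊕ ι (- + 1) · ((ι (+ 2) · (q^ 2 · (ψ₄ · dil 12 ψ))) · I₃)
    ≈⟨ ⊕-congˡ (≈-trans (·-congˡ split-constant) (solve 1 (λ x → con (- + 1) :* (con (+ 2) :* x) := con (- + 2) :* x) ≈-refl (q^ 2))) ⟩
  (φ · dil 3 φ ⊖ W) · I₃ ⊕ ι (- + 2) · q^ 2 ∎)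
  (vanishes-⊕ (within-vanishes 6 (within-· (within-⊖ (within-φ·φ 3) within-W) (within-iψ₄·dil 3))) (vanishes-q^ 4 6 (- + 2) 2))))
  where open ≈-Reasoning

part-xi : Vanishes 4 6 (G · dil 3 G ⊕ q^ 4 · (G⁻¹ · dil 3 G⁻¹))
part-xi = vanishes-constant⁻¹ 1 (vanishes-≈ (begin
  ι (+ 2) · (G · dil 3 G ⊕ q^ 4 · (G⁻¹ · dil 3 G⁻¹))
    ≈⟨ product-formula 3 4 refl ⟩
  (φ · dil 3 φ ⊕ φ₂ · dil 3 φ₂) · I₃
    ≈⟨ ·-congʳ (⊕-congˡ φ₂·φ₆-split) ⟩
  (φ · dil 3 φ ⊕ (W ⊕ ι (+ 2) · (q^ 2 · (ψ₄ · dil 12 ψ)))) · I₃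
    ≈⟨ solve 4 (λ f w c i → (f :+ (w :+ c)) :* i := (f :+ w) :* i :+ c :* i) ≈-refl _ _ _ _ ⟩
  (φ · dil 3 φ ⊕ W) · I₃ ⊕ (ι (+ 2) · (q^ 2 · (ψ₄ · dil 12 ψ))) · I₃
    ≈⟨ ⊕-congˡ split-constant ⟩
  (φ · dil 3 φ ⊕ W) · I₃ ⊕ ι (+ 2) · q^ 2 ∎)
  (vanishes-⊕ (within-vanishes 6 (within-· (within-⊕ (within-φ·φ 3) within-W) (within-iψ₄·dil 3))) (vanishes-q^ 4 6 (+ 2) 2)))
  where open ≈-Reasoning

odd₇ : PS
odd₇ = ι (+ 2) · (q^ 1 · (ψ₈ · dil 28 φ)) ⊕ ι (+ 2) · (q^ 7 · (φ₄ · dil 56 ψ))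

-- For k = 7 the class 0 modulo 4 itself must disappear. It is Θ₇(q⁴) in φ(q)φ(q⁷) and Θ₇(q⁸) in
-- φ(q²)φ(q¹⁴). By `Θ₇-dil` these differ by 2q⁴ψ(q⁴)ψ(q²⁸), which the denominator reduces to 2q⁴.
φ·φ₇-dissection : φ · dil 7 φ ≈ dil 4 Θ₇ ⊕ odd₇
φ·φ₇-dissection = begin
  φ · dil 7 φ
    ≈⟨ ·-cong φ-dissection₁ (φ-dissection 7) ⟩
  (φ₄ ⊕ ι (+ 2) · (q · ψ₈)) · (dil 28 φ ⊕ ι (+ 2) · (q^ 7 · dil 56 ψ))
    ≈⟨ solve 6 (λ f p g r x y → (f :+ con (+ 2) :* (x :* p)) :* (g :+ con (+ 2) :* (y :* r)) :=
        (f :* g :+ (x :* y) :* ((p :+ p) :* (r :+ r))) :+ (con (+ 2) :* (x :* (p :* g)) :+ con (+ 2) :* (y :* (f :* r))))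
        ≈-refl φ₄ ψ₈ (dil 28 φ) (dil 56 ψ) q (q^ 7) ⟩
  (φ₄ · dil 28 φ ⊕ (q · q^ 7) · ((ψ₈ ⊕ ψ₈) · (dil 56 ψ ⊕ dil 56 ψ))) ⊕ odd₇
    ≈⟨ ⊕-congʳ Θ ⟨
  dil 4 Θ₇ ⊕ odd₇ ∎
  where
  open ≈-Reasoning
  Θ : dil 4 Θ₇ ≈ φ₄ · dil 28 φ ⊕ (q · q^ 7) · ((ψ₈ ⊕ ψ₈) · (dil 56 ψ ⊕ dil 56 ψ))
  Θ = begin
    dil 4 (φ · dil 7 φ ⊕ q^ 2 · (pronic · dil 7 pronic))
      ≈⟨ dil-⊕ 4 (φ · dil 7 φ) (q^ 2 · (pronic · dil 7 pronic)) ⟩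
    dil 4 (φ · dil 7 φ) ⊕ dil 4 (q^ 2 · (pronic · dil 7 pronic))
      ≈⟨ ⊕-cong (≈-trans (dil-· 4 φ (dil 7 φ)) (·-congˡ (dil-dil 4 7 φ)))
        (≈-trans (dil-· 4 (q^ 2) (pronic · dil 7 pronic)) (·-cong (≈-trans (dil-q^ 4 2) (≈-sym (q^-+ 1 7)))
        (≈-trans (dil-· 4 pronic (dil 7 pronic)) (·-cong (dil-pronic 4) (≈-trans (dil-dil 4 7 pronic) (dil-pronic 28)))))) ⟩
    φ₄ · dil 28 φ ⊕ (q · q^ 7) · ((ψ₈ ⊕ ψ₈) · (dil 56 ψ ⊕ dil 56 ψ)) ∎

Θ₇-dil : dil 4 Θ₇ ≈ dil 8 Θ₇ ⊕ ι (+ 2) · (q^ 4 · (ψ₄ · dil 28 ψ))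
Θ₇-dil = begin
  dil 4 Θ₇
    ≈⟨ dil-cong 4 (≈-trans Θ₇-halves (⊕-congˡ (solve 1 (λ x → x :+ x := con (+ 2) :* x) ≈-refl (q · (ψ · dil 7 ψ))))) ⟩
  dil 4 (dil 2 Θ₇ ⊕ ι (+ 2) · (q · (ψ · dil 7 ψ)))
    ≈⟨ dil-⊕ 4 (dil 2 Θ₇) (ι (+ 2) · (q · (ψ · dil 7 ψ))) ⟩
  dil 4 (dil 2 Θ₇) ⊕ dil 4 (ι (+ 2) · (q · (ψ · dil 7 ψ)))
    ≈⟨ ⊕-cong (dil-dil 4 2 Θ₇) (≈-trans (dil-term 4 (+ 2) 1 (ψ · dil 7 ψ)) (·-congˡ (·-cong ≈-refl
        (≈-trans (dil-· 4 ψ (dil 7 ψ)) (·-congˡ (dil-dil 4 7 ψ)))))) ⟩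
  dil 8 Θ₇ ⊕ ι (+ 2) · (q^ 4 · (ψ₄ · dil 28 ψ)) ∎
  where open ≈-Reasoning

I₇ : PS
I₇ = iψ₄ · dil 7 iψ₄

within-odd₇ : Within 4 (1 ∷ 3 ∷ []) odd₇
within-odd₇ = within-⊕ (within-term (+ 2) 1 (within-· (within-dil 8 ψ) (within-dil 28 φ)))
  (within-term (+ 2) 7 (within-· (within-dil 4 φ) (within-dil 56 ψ)))

within-dil-odd₇ : Within 4 (2 ∷ 2 ∷ []) (dil 2 odd₇)
within-dil-odd₇ = within-cong (≈-sym (≈-trans (dil-⊕ 2 (ι (+ 2) · (q^ 1 · (ψ₈ · dil 28 φ))) (ι (+ 2) · (q^ 7 · (φ₄ · dil 56 ψ))))
    (⊕-cong (dil-term 2 (+ 2) 1 (ψ₈ · dil 28 φ)) (dil-term 2 (+ 2) 7 (φ₄ · dil 56 ψ)))))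
  (within-⊕ (within-term (+ 2) 2 (within-dil₀ 2 (within-· (within-dil 8 ψ) (within-dil 28 φ))))
    (within-term (+ 2) 14 (within-dil₀ 2 (within-· (within-dil 4 φ) (within-dil 56 ψ)))))

φ₂·φ₁₄ : φ₂ · dil 7 φ₂ ≈ dil 8 Θ₇ ⊕ dil 2 odd₇
φ₂·φ₁₄ = begin
  φ₂ · dil 7 φ₂ ≈⟨ ·-congˡ (≈-trans (dil-dil 7 2 φ) (≈-sym (dil-dil 2 7 φ))) ⟩
  dil 2 φ · dil 2 (dil 7 φ) ≈⟨ dil-· 2 φ (dil 7 φ) ⟨
  dil 2 (φ · dil 7 φ) ≈⟨ dil-cong 2 φ·φ₇-dissection ⟩
  dil 2 (dil 4 Θ₇ ⊕ odd₇) ≈⟨ dil-⊕ 2 (dil 4 Θ₇) odd₇ ⟩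
  dil 2 (dil 4 Θ₇) ⊕ dil 2 odd₇ ≈⟨ ⊕-congʳ (dil-dil 2 4 Θ₇) ⟩
  dil 8 Θ₇ ⊕ dil 2 odd₇ ∎
  where open ≈-Reasoning

part-ix : Vanishes 4 7 (G⁻¹ · dil 7 G ⊕ q^ 6 · (G · dil 7 G⁻¹))
part-ix = vanishes-q^⁻¹ 1 (vanishes-constant⁻¹ 1 (vanishes-≈ (begin
  ι (+ 2) · (q^ 1 · (G⁻¹ · dil 7 G ⊕ q^ 6 · (G · dil 7 G⁻¹)))
    ≈⟨ quotient-formula 7 6 refl ⟩
  (φ · dil 7 φ ⊖ φ₂ · dil 7 φ₂) · I₇
    ≈⟨ ·-congʳ (⊕-cong (≈-trans φ·φ₇-dissection (⊕-congʳ Θ₇-dil)) (⊟-cong φ₂·φ₁₄)) ⟩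
  (((dil 8 Θ₇ ⊕ ι (+ 2) · (q^ 4 · (ψ₄ · dil 28 ψ))) ⊕ odd₇) ⊖ (dil 8 Θ₇ ⊕ dil 2 odd₇)) · (iψ₄ · dil 7 iψ₄)
    ≈⟨ solve 8 (λ z x p r o e i j → (((z :+ con (+ 2) :* (x :* (p :* r))) :+ o) :- (z :+ e)) :* (i :* j) :=
        (o :- e) :* (i :* j) :+ (con (+ 2) :* x) :* ((p :* i) :* (r :* j))) ≈-refl (dil 8 Θ₇) (q^ 4) ψ₄ (dil 28 ψ) odd₇ (dil 2 odd₇) iψ₄ (dil 7 iψ₄) ⟩
  (odd₇ ⊖ dil 2 odd₇) · I₇ ⊕ (ι (+ 2) · q^ 4) · ((ψ₄ · iψ₄) · (dil 28 ψ · dil 7 iψ₄))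
    ≈⟨ ⊕-congˡ (·-unit (unit-·-unit ψ₄·iψ₄ ψ₂₈·iψ₂₈)) ⟩
  (odd₇ ⊖ dil 2 odd₇) · I₇ ⊕ ι (+ 2) · q^ 4 ∎)
  (vanishes-⊕ (within-vanishes 8 (within-· (within-⊖ within-odd₇ within-dil-odd₇) (within-iψ₄·dil 7))) (vanishes-q^ 4 8 (+ 2) 4))))
  where
  open ≈-Reasoning
  ψ₂₈·iψ₂₈ : dil 28 ψ · dil 7 iψ₄ ≈ onePS
  ψ₂₈·iψ₂₈ = ≈-trans (·-congʳ (≈-sym (dil-dil 7 4 ψ))) (dil-inverse 7 ψ₄·iψ₄)

constant-cancel : ∀ c {f g} → ι (+ suc c) · f ≈ ι (+ suc c) · g → f ≈ g
constant-cancel c = ·-cancel {ι (+ suc c)} (λ ())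

quotient₂ : G⁻¹ · dil 2 G ⊕ q^ 1 · (G · dil 2 G⁻¹) ≈ φ₂ · iψ₄
quotient₂ = q^-cancel 1 (constant-cancel 1 (begin
  ι (+ 2) · (q^ 1 · (G⁻¹ · dil 2 G ⊕ q^ 1 · (G · dil 2 G⁻¹)))
    ≈⟨ quotient-formula 2 1 refl ⟩
  (φ · φ₂ ⊖ φ₂ · dil 2 φ₂) · (iψ₄ · dil 2 iψ₄)
    ≈⟨ ·-cong (⊕-cong (·-congʳ φ-dissection₁) (⊟-cong (·-congˡ (dil-dil 2 2 φ)))) (·-congˡ (dil-dil 2 4 iψ)) ⟩
  ((φ₄ ⊕ ι (+ 2) · (q · ψ₈)) · φ₂ ⊖ φ₂ · φ₄) · (iψ₄ · iψ₈)
    ≈⟨ solve 6 (λ f q p g i j → ((f :+ con (+ 2) :* (q :* p)) :* g :- g :* f) :* (i :* j) := con (+ 2) :* (q :* ((g :* i) :* (p :* j)))) ≈-refl φ₄ q ψ₈ φ₂ iψ₄ iψ₈ ⟩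
  ι (+ 2) · (q · ((φ₂ · iψ₄) · (ψ₈ · iψ₈)))
    ≈⟨ ·-congˡ (·-congˡ (·-unit ψ₈·iψ₈)) ⟩
  ι (+ 2) · (q · (φ₂ · iψ₄)) ∎))
  where open ≈-Reasoning

part-xiv : Vanishes 4 2 (dil 2 G⁻¹ · dil 4 G ⊕ q^ 2 · (dil 2 G · dil 4 G⁻¹))
part-xiv = vanishes-≈ (begin
  dil 2 G⁻¹ · dil 4 G ⊕ q^ 2 · (dil 2 G · dil 4 G⁻¹)
    ≈⟨ ⊕-cong (·-congˡ (dil-dil 2 2 G)) (·-cong (dil-q^ 2 1) (·-congˡ (dil-dil 2 2 G⁻¹))) ⟨
  dil 2 G⁻¹ · dil 2 (dil 2 G) ⊕ dil 2 (q^ 1) · (dil 2 G · dil 2 (dil 2 G⁻¹))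
    ≈⟨ ⊕-cong (dil-· 2 G⁻¹ (dil 2 G)) (≈-trans (dil-· 2 (q^ 1) (G · dil 2 G⁻¹)) (·-congˡ (dil-· 2 G (dil 2 G⁻¹)))) ⟨
  dil 2 (G⁻¹ · dil 2 G) ⊕ dil 2 (q^ 1 · (G · dil 2 G⁻¹))
    ≈⟨ dil-⊕ 2 (G⁻¹ · dil 2 G) (q^ 1 · (G · dil 2 G⁻¹)) ⟨
  dil 2 (G⁻¹ · dil 2 G ⊕ q^ 1 · (G · dil 2 G⁻¹))
    ≈⟨ dil-cong 2 quotient₂ ⟩
  dil 2 (φ₂ · iψ₄)
    ≈⟨ dil-· 2 φ₂ iψ₄ ⟩
  dil 2 φ₂ · dil 2 iψ₄
    ≈⟨ ·-cong (dil-dil 2 2 φ) (dil-dil 2 4 iψ) ⟩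
  φ₄ · iψ₈ ∎)
  (within-vanishes 2 (within-· (within-dil 4 φ) (within-dil 8 iψ)))
  where open ≈-Reasoning

-- The series ρ₅

neg-φ : neg φ ≈ φ₄ ⊖ ι (+ 2) · (q · ψ₈)
neg-φ = begin
  neg φ ≈⟨ neg-cong φ-dissection₁ ⟩
  neg (φ₄ ⊕ ι (+ 2) · (q · ψ₈)) ≈⟨ neg-⊕ φ₄ (ι (+ 2) · (q · ψ₈)) ⟩
  neg φ₄ ⊕ neg (ι (+ 2) · (q · ψ₈)) ≈⟨ ⊕-cong (neg-dil-even 4 φ) (≈-trans (neg-· (ι (+ 2)) (q · ψ₈))
        (·-cong (neg-constant (+ 2)) (≈-trans (neg-· q ψ₈) (·-cong (neg-q^ 1) (neg-dil-even 8 ψ))))) ⟩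
  φ₄ ⊕ ι (+ 2) · ((ι ℤ.-1ℤ · q) · ψ₈) ≈⟨ solve 3 (λ f q p → f :+ con (+ 2) :* ((con ℤ.-1ℤ :* q) :* p) := f :- con (+ 2) :* (q :* p)) ≈-refl φ₄ q ψ₈ ⟩
  φ₄ ⊖ ι (+ 2) · (q · ψ₈) ∎
  where open ≈-Reasoning

neg-q·G⁻¹ : neg (q · G⁻¹) ≈ ⊟ (q · neg G⁻¹)
neg-q·G⁻¹ = ≈-trans (neg-· q G⁻¹) (≈-trans (·-congʳ (neg-q^ 1)) (solve 2 (λ q g → (con ℤ.-1ℤ :* q) :* g := :- (q :* g)) ≈-refl q (neg G⁻¹)))

neg-G-minus : neg G ⊖ q · neg G⁻¹ ≈ neg φ · iψ₄
neg-G-minus = begin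
  neg G ⊖ q · neg G⁻¹ ≈⟨ ⊕-congˡ neg-q·G⁻¹ ⟨
  neg G ⊕ neg (q · G⁻¹) ≈⟨ neg-⊕ G (q · G⁻¹) ⟨
  neg (G ⊕ q · G⁻¹) ≈⟨ neg-cong G-plus ⟩
  neg (φ · iψ₄) ≈⟨ neg-· φ iψ₄ ⟩
  neg φ · neg iψ₄ ≈⟨ ·-congˡ (neg-dil-even 4 iψ) ⟩
  neg φ · iψ₄ ∎
  where open ≈-Reasoning

neg-G-plus : neg G ⊕ q · neg G⁻¹ ≈ φ₂ · iψ₄
neg-G-plus = begin
  neg G ⊕ q · neg G⁻¹ ≈⟨ ⊕-congˡ (solve 1 (λ x → x := :- (:- x)) ≈-refl (q · neg G⁻¹)) ⟩
  neg G ⊖ ⊟ (q · neg G⁻¹) ≈⟨ ⊕-congˡ (⊟-cong neg-q·G⁻¹) ⟨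
  neg G ⊖ neg (q · G⁻¹) ≈⟨ ⊕-congˡ (neg-⊟ (q · G⁻¹)) ⟨
  neg G ⊕ neg (⊟ (q · G⁻¹)) ≈⟨ neg-⊕ G (⊟ (q · G⁻¹)) ⟨
  neg (G ⊖ q · G⁻¹) ≈⟨ neg-cong G-minus ⟩
  neg (φ₂ · iψ₄) ≈⟨ neg-· φ₂ iψ₄ ⟩
  neg φ₂ · neg iψ₄ ≈⟨ ·-cong (neg-dil-even 2 φ) (neg-dil-even 4 iψ) ⟩
  φ₂ · iψ₄ ∎
  where open ≈-Reasoning

-- The odd part of φ: φ(q) = φ₄ + s and φ(-q) = φ₄ - s.
s : PS
s = ι (+ 2) · (q · ψ₈)

φ₂²≈φ₄²+s² : φ₂ · φ₂ ≈ φ₄ · φ₄ ⊕ s · s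
φ₂²≈φ₄²+s² = ≈-trans φ₂²-dissection (⊕-congˡ (≈-trans (·-congˡ (·-congʳ q²≈))
  (solve 2 (λ q p → con (+ 4) :* ((q :* q) :* (p :* p)) := (con (+ 2) :* (q :* p)) :* (con (+ 2) :* (q :* p))) ≈-refl q ψ₈)))

G-plus₂ : dil 2 G ⊕ q^ 2 · dil 2 G⁻¹ ≈ φ₂ · iψ₈
G-plus₂ = ≈-trans (G-plus-dil 2) (·-congˡ (dil-dil 2 4 iψ))

G-minus₂ : dil 2 G ⊖ q^ 2 · dil 2 G⁻¹ ≈ φ₄ · iψ₈
G-minus₂ = ≈-trans (G-minus-dil 2) (·-cong (dil-dil 2 2 φ) (dil-dil 2 4 iψ))

-- 2G is the sum of the two relations and 2G(-q) the sum of their images under q ↦ -q. In the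
-- product of these sums φ(q²)² = φ(q⁴)² + s² eliminates s, and the outcome is again a sum of the
-- two relations, now at q².
G·neg-G : G · neg G ≈ dil 2 G
G·neg-G = constant-cancel 3 (begin
  ι (+ 4) · (G · neg G)
    ≈⟨ solve 5 (λ g h n m q → con (+ 4) :* (g :* n) := ((g :+ q :* h) :+ (g :- q :* h)) :* ((n :+ q :* m) :+ (n :- q :* m))) ≈-refl G G⁻¹ (neg G) (neg G⁻¹) q ⟩
  ((G ⊕ q · G⁻¹) ⊕ (G ⊖ q · G⁻¹)) · ((neg G ⊕ q · neg G⁻¹) ⊕ (neg G ⊖ q · neg G⁻¹))
    ≈⟨ ·-cong (⊕-cong (≈-trans G-plus (·-congʳ φ-dissection₁)) G-minus) (⊕-cong neg-G-plus (≈-trans neg-G-minus (·-congʳ neg-φ))) ⟩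
  ((φ₄ ⊕ s) · iψ₄ ⊕ φ₂ · iψ₄) · (φ₂ · iψ₄ ⊕ (φ₄ ⊖ s) · iψ₄)
    ≈⟨ solve 4 (λ a s b i → ((a :+ s) :* i :+ b :* i) :* (b :* i :+ (a :- s) :* i) := ((b :* b :- s :* s) :+ (con (+ 2) :* b :+ a) :* a) :* (i :* i)) ≈-refl φ₄ s φ₂ iψ₄ ⟩
  ((φ₂ · φ₂ ⊖ s · s) ⊕ (ι (+ 2) · φ₂ ⊕ φ₄) · φ₄) · (iψ₄ · iψ₄)
    ≈⟨ ·-congʳ (⊕-congʳ (⊕-congʳ φ₂²≈φ₄²+s²)) ⟩
  (((φ₄ · φ₄ ⊕ s · s) ⊖ s · s) ⊕ (ι (+ 2) · φ₂ ⊕ φ₄) · φ₄) · (iψ₄ · iψ₄)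
    ≈⟨ solve 4 (λ a s b i → (((a :* a :+ s :* s) :- s :* s) :+ (con (+ 2) :* b :+ a) :* a) :* i := con (+ 2) :* ((b :+ a) :* (a :* i))) ≈-refl φ₄ s φ₂ (iψ₄ · iψ₄) ⟩
  ι (+ 2) · ((φ₂ ⊕ φ₄) · (φ₄ · (iψ₄ · iψ₄)))
    ≈⟨ ·-congˡ (≈-trans (·-congˡ φ₄·iψ₄²) (solve 3 (λ a b i → (b :+ a) :* i := b :* i :+ a :* i) ≈-refl φ₄ φ₂ iψ₈)) ⟩
  ι (+ 2) · (φ₂ · iψ₈ ⊕ φ₄ · iψ₈)
    ≈⟨ ·-congˡ (⊕-cong G-plus₂ G-minus₂) ⟨
  ι (+ 2) · ((dil 2 G ⊕ q^ 2 · dil 2 G⁻¹) ⊕ (dil 2 G ⊖ q^ 2 · dil 2 G⁻¹))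
    ≈⟨ solve 3 (λ g h p → con (+ 2) :* ((g :+ p :* h) :+ (g :- p :* h)) := con (+ 4) :* g) ≈-refl (dil 2 G) (dil 2 G⁻¹) (q^ 2) ⟩
  ι (+ 4) · dil 2 G ∎)
  where open ≈-Reasoning

neg-G : neg G ≈ dil 2 G · G⁻¹
neg-G = ≈-sym (begin
  dil 2 G · G⁻¹ ≈⟨ ·-congʳ G·neg-G ⟨
  (G · neg G) · G⁻¹ ≈⟨ solve 3 (λ g n h → (g :* n) :* h := n :* (g :* h)) ≈-refl G (neg G) G⁻¹ ⟩
  neg G · (G · G⁻¹) ≈⟨ ·-unit G·G⁻¹ ⟩
  neg G ∎)
  where open ≈-Reasoning

neg-G⁻¹ : neg G⁻¹ ≈ G · dil 2 G⁻¹
neg-G⁻¹ = begin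
  neg G⁻¹ ≈⟨ ·-unit (dil-inverse 2 G·G⁻¹) ⟨
  neg G⁻¹ · (dil 2 G · dil 2 G⁻¹) ≈⟨ ·-congˡ (·-congʳ G·neg-G) ⟨
  neg G⁻¹ · ((G · neg G) · dil 2 G⁻¹) ≈⟨ solve 4 (λ m g n k → m :* ((g :* n) :* k) := (g :* k) :* (n :* m)) ≈-refl (neg G⁻¹) G (neg G) (dil 2 G⁻¹) ⟩
  (G · dil 2 G⁻¹) · (neg G · neg G⁻¹) ≈⟨ ·-unit (neg-inverse G·G⁻¹) ⟩
  G · dil 2 G⁻¹ ∎
  where open ≈-Reasoning

iφ₄ i₁₆ : PS
iφ₄ = dil 4 iφ
i₁₆ = dil 16 iψ

φ₄·iφ₄ : φ₄ · iφ₄ ≈ onePS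
φ₄·iφ₄ = dil-inverse 4 φ·iφ

ψ₁₆·i₁₆ : dil 16 ψ · i₁₆ ≈ onePS
ψ₁₆·i₁₆ = dil-inverse 16 ψ·iψ

ψ₈·iψ₄² : ψ₈ · (iψ₄ · iψ₄) ≈ iφ₄
ψ₈·iψ₄² = begin
  ψ₈ · (iψ₄ · iψ₄) ≈⟨ ·-unit φ₄·iφ₄ ⟨
  (ψ₈ · (iψ₄ · iψ₄)) · (φ₄ · iφ₄) ≈⟨ solve 4 (λ p i f j → (p :* (i :* i)) :* (f :* j) := (f :* (i :* i)) :* p :* j) ≈-refl ψ₈ iψ₄ φ₄ iφ₄ ⟩
  ((φ₄ · (iψ₄ · iψ₄)) · ψ₈) · iφ₄ ≈⟨ ·-congʳ (·-congʳ φ₄·iψ₄²) ⟩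
  (iψ₈ · ψ₈) · iφ₄ ≈⟨ ·-congʳ (≈-trans (·-comm iψ₈ ψ₈) ψ₈·iψ₈) ⟩
  onePS · iφ₄ ≈⟨ ·-identityˡ iφ₄ ⟩
  iφ₄ ∎
  where open ≈-Reasoning

-- Here 2q/G is the difference of the two relations, and 2G(-q) is the sum of their images. The
-- result displays the even part φ(q²)/φ(q⁴) and the odd part separately.
neg-quotient : neg G · G⁻¹ ≈ (φ₂ ⊖ s) · iφ₄
neg-quotient = q^-cancel 1 (constant-cancel 3 (begin
  ι (+ 4) · (q · (neg G · G⁻¹))
    ≈⟨ solve 5 (λ g h n m q → con (+ 4) :* (q :* (n :* h)) := ((g :+ q :* h) :- (g :- q :* h)) :* ((n :+ q :* m) :+ (n :- q :* m))) ≈-refl G G⁻¹ (neg G) (neg G⁻¹) q ⟩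
  ((G ⊕ q · G⁻¹) ⊖ (G ⊖ q · G⁻¹)) · ((neg G ⊕ q · neg G⁻¹) ⊕ (neg G ⊖ q · neg G⁻¹))
    ≈⟨ ·-cong (⊕-cong (≈-trans G-plus (·-congʳ φ-dissection₁)) (⊟-cong G-minus)) (⊕-cong neg-G-plus (≈-trans neg-G-minus (·-congʳ neg-φ))) ⟩
  ((φ₄ ⊕ s) · iψ₄ ⊖ φ₂ · iψ₄) · (φ₂ · iψ₄ ⊕ (φ₄ ⊖ s) · iψ₄)
    ≈⟨ solve 4 (λ a s b i → ((a :+ s) :* i :- b :* i) :* (b :* i :+ (a :- s) :* i) := (con (+ 2) :* (b :* s) :+ (a :* a :- s :* s) :- b :* b) :* (i :* i)) ≈-refl φ₄ s φ₂ iψ₄ ⟩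
  (ι (+ 2) · (φ₂ · s) ⊕ (φ₄ · φ₄ ⊖ s · s) ⊖ φ₂ · φ₂) · (iψ₄ · iψ₄)
    ≈⟨ ·-congʳ (⊕-congˡ (⊟-cong φ₂²≈φ₄²+s²)) ⟩
  (ι (+ 2) · (φ₂ · s) ⊕ (φ₄ · φ₄ ⊖ s · s) ⊖ (φ₄ · φ₄ ⊕ s · s)) · (iψ₄ · iψ₄)
    ≈⟨ solve 5 (λ a b q p i → (con (+ 2) :* (b :* (con (+ 2) :* (q :* p))) :+ (a :* a :- (con (+ 2) :* (q :* p)) :* (con (+ 2) :* (q :* p))) :- (a :* a :+ (con (+ 2) :* (q :* p)) :* (con (+ 2) :* (q :* p)))) :* i
        := con (+ 4) :* (q :* ((b :- con (+ 2) :* (q :* p)) :* (p :* i)))) ≈-refl φ₄ φ₂ q ψ₈ (iψ₄ · iψ₄) ⟩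
  ι (+ 4) · (q · ((φ₂ ⊖ s) · (ψ₈ · (iψ₄ · iψ₄))))
    ≈⟨ ·-congˡ (·-congˡ (·-congˡ ψ₈·iψ₄²)) ⟩
  ι (+ 4) · (q · ((φ₂ ⊖ s) · iφ₄)) ∎))
  where open ≈-Reasoning

neg-quotient⁻¹ : neg G⁻¹ · G ≈ (φ₂ ⊕ s) · iφ₄
neg-quotient⁻¹ = begin
  neg G⁻¹ · G                    ≈⟨ ≈-trans (·-comm (neg G⁻¹) G) (·-congʳ (≈-sym (neg-neg G))) ⟩
  neg (neg G) · neg G⁻¹          ≈⟨ neg-· (neg G) G⁻¹ ⟨
  neg (neg G · G⁻¹)              ≈⟨ ≈-trans (neg-cong neg-quotient) (neg-· (φ₂ ⊖ s) iφ₄) ⟩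
  neg (φ₂ ⊖ s) · neg iφ₄         ≈⟨ ·-cong (≈-trans (neg-⊕ φ₂ (⊟ s)) (⊕-cong (neg-dil-even 2 φ) neg-⊟s)) (neg-dil-even 4 iφ) ⟩
  (φ₂ ⊕ s) · iφ₄                 ∎
  where
  open ≈-Reasoning
  neg-⊟s : neg (⊟ s) ≈ s
  neg-⊟s = ≈-trans (neg-⊟ s) (≈-trans (⊟-cong (≈-trans (neg-· (ι (+ 2)) (q · ψ₈)) (·-cong (neg-constant (+ 2))
    (≈-trans (neg-· q ψ₈) (·-cong (neg-q^ 1) (neg-dil-even 8 ψ))))))
    (solve 2 (λ q p → :- (con (+ 2) :* ((con ℤ.-1ℤ :* q) :* p)) := con (+ 2) :* (q :* p)) ≈-refl q ψ₈))

G-plus₄ : dil 4 G ⊕ q^ 4 · dil 4 G⁻¹ ≈ φ₄ · i₁₆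
G-plus₄ = ≈-trans (G-plus-dil 4) (·-congˡ (dil-dil 4 4 iψ))

G-minus₄ : dil 4 G ⊖ q^ 4 · dil 4 G⁻¹ ≈ φ₈ · i₁₆
G-minus₄ = ≈-trans (G-minus-dil 4) (·-cong (dil-dil 4 2 φ) (dil-dil 4 4 iψ))

R₅ R₅⁻¹ E₅ : PS
R₅ = (neg G · G⁻¹) · dil 4 G
R₅⁻¹ = (neg G⁻¹ · G) · dil 4 G⁻¹
E₅ = ψ₈ · (φ₈ · (iφ₄ · i₁₆))

-- Inverting G(-q)/G(q) only changes the sign of s. So the even part of this quotient multiplies
-- G(q⁴) + q⁴/G(q⁴) and the odd part the difference; the numerator φ(q⁴) of the former cancels the
-- denominator φ(q⁴). In `R₅-minus` the roles are exchanged and the odd part is simplified instead.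
R₅-plus : R₅ ⊕ q^ 4 · R₅⁻¹ ≈ φ₂ · i₁₆ ⊖ ι (+ 2) · (q^ 1 · E₅)
R₅-plus = begin
  (neg G · G⁻¹) · dil 4 G ⊕ q^ 4 · ((neg G⁻¹ · G) · dil 4 G⁻¹)
    ≈⟨ ⊕-cong (·-congʳ neg-quotient) (·-congˡ (·-congʳ neg-quotient⁻¹)) ⟩
  ((φ₂ ⊖ s) · iφ₄) · dil 4 G ⊕ q^ 4 · (((φ₂ ⊕ s) · iφ₄) · dil 4 G⁻¹)
    ≈⟨ solve 6 (λ b s i g h p → ((b :- s) :* i) :* g :+ p :* (((b :+ s) :* i) :* h) := (b :* i) :* (g :+ p :* h) :- (s :* i) :* (g :- p :* h)) ≈-refl φ₂ s iφ₄ (dil 4 G) (dil 4 G⁻¹) (q^ 4) ⟩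
  (φ₂ · iφ₄) · (dil 4 G ⊕ q^ 4 · dil 4 G⁻¹) ⊖ (s · iφ₄) · (dil 4 G ⊖ q^ 4 · dil 4 G⁻¹)
    ≈⟨ ⊕-cong (·-congˡ G-plus₄) (⊟-cong (·-congˡ G-minus₄)) ⟩
  (φ₂ · iφ₄) · (φ₄ · i₁₆) ⊖ (s · iφ₄) · (φ₈ · i₁₆)
    ≈⟨ solve 7 (λ b i f j q p g → (b :* i) :* (f :* j) :- ((con (+ 2) :* (q :* p)) :* i) :* (g :* j) := (b :* j) :* (f :* i) :- con (+ 2) :* (q :* (p :* (g :* (i :* j)))))
        ≈-refl φ₂ iφ₄ φ₄ i₁₆ q ψ₈ φ₈ ⟩
  (φ₂ · i₁₆) · (φ₄ · iφ₄) ⊖ ι (+ 2) · (q · E₅)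
    ≈⟨ ⊕-congʳ (·-unit φ₄·iφ₄) ⟩
  φ₂ · i₁₆ ⊖ ι (+ 2) · (q^ 1 · E₅) ∎
  where open ≈-Reasoning

R₅-minus : R₅ ⊖ q^ 4 · R₅⁻¹ ≈ φ₂ · (φ₈ · (iφ₄ · i₁₆)) ⊖ ι (+ 2) · (q^ 1 · (ψ₈ · i₁₆))
R₅-minus = begin
  (neg G · G⁻¹) · dil 4 G ⊖ q^ 4 · ((neg G⁻¹ · G) · dil 4 G⁻¹)
    ≈⟨ ⊕-cong (·-congʳ neg-quotient) (⊟-cong (·-congˡ (·-congʳ neg-quotient⁻¹))) ⟩
  ((φ₂ ⊖ s) · iφ₄) · dil 4 G ⊖ q^ 4 · (((φ₂ ⊕ s) · iφ₄) · dil 4 G⁻¹)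
    ≈⟨ solve 6 (λ b s i g h p → ((b :- s) :* i) :* g :- p :* (((b :+ s) :* i) :* h) := (b :* i) :* (g :- p :* h) :- (s :* i) :* (g :+ p :* h)) ≈-refl φ₂ s iφ₄ (dil 4 G) (dil 4 G⁻¹) (q^ 4) ⟩
  (φ₂ · iφ₄) · (dil 4 G ⊖ q^ 4 · dil 4 G⁻¹) ⊖ (s · iφ₄) · (dil 4 G ⊕ q^ 4 · dil 4 G⁻¹)
    ≈⟨ ⊕-cong (·-congˡ G-minus₄) (⊟-cong (·-congˡ G-plus₄)) ⟩
  (φ₂ · iφ₄) · (φ₈ · i₁₆) ⊖ (s · iφ₄) · (φ₄ · i₁₆)
    ≈⟨ solve 7 (λ b i f j q p g → (b :* i) :* (g :* j) :- ((con (+ 2) :* (q :* p)) :* i) :* (f :* j) := b :* (g :* (i :* j)) :- (con (+ 2) :* (q :* (p :* j))) :* (f :* i))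
        ≈-refl φ₂ iφ₄ φ₄ i₁₆ q ψ₈ φ₈ ⟩
  φ₂ · (φ₈ · (iφ₄ · i₁₆)) ⊖ (ι (+ 2) · (q · (ψ₈ · i₁₆))) · (φ₄ · iφ₄)
    ≈⟨ ⊕-congˡ (⊟-cong (·-unit φ₄·iφ₄)) ⟩
  φ₂ · (φ₈ · (iφ₄ · i₁₆)) ⊖ ι (+ 2) · (q^ 1 · (ψ₈ · i₁₆)) ∎
  where open ≈-Reasoning

R₅-plus′ : R₅ ⊕ q^ 4 · R₅⁻¹ ≈ (φ₈ · i₁₆ ⊖ ι (+ 2) · (q^ 1 · E₅)) ⊕ ι (+ 2) · q^ 2
R₅-plus′ = begin
  R₅ ⊕ q^ 4 · R₅⁻¹
    ≈⟨ R₅-plus ⟩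
  φ₂ · i₁₆ ⊖ E
    ≈⟨ ⊕-congʳ (·-congʳ (φ-dissection 2)) ⟩
  (φ₈ ⊕ ι (+ 2) · (q^ 2 · dil 16 ψ)) · i₁₆ ⊖ E
    ≈⟨ solve 5 (λ f p x i e → (f :+ con (+ 2) :* (x :* p)) :* i :- e := (f :* i :- e) :+ (con (+ 2) :* x) :* (p :* i)) ≈-refl φ₈ (dil 16 ψ) (q^ 2) i₁₆ E ⟩
  (φ₈ · i₁₆ ⊖ E) ⊕ (ι (+ 2) · q^ 2) · (dil 16 ψ · i₁₆)
    ≈⟨ ⊕-congˡ (·-unit ψ₁₆·i₁₆) ⟩
  (φ₈ · i₁₆ ⊖ E) ⊕ ι (+ 2) · q^ 2 ∎
  where
  open ≈-Reasoning
  E : PS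
  E = ι (+ 2) · (q^ 1 · E₅)

within-E₅ : Within 4 (0 ∷ []) E₅
within-E₅ = within-· (within-dil 8 ψ) (within-· (within-dil 8 φ) (within-· (within-dil 4 iφ) (within-dil 16 iψ)))

part-xv : Vanishes 4 6 (R₅ ⊕ q^ 4 · R₅⁻¹)
part-xv = vanishes-≈ R₅-plus′ (vanishes-⊕ (within-vanishes 6 (within-⊖ (within-· (within-dil 8 φ) (within-dil 16 iψ)) (within-term (+ 2) 1 within-E₅)))
  (vanishes-q^ 4 6 (+ 2) 2))

part-xvii : Vanishes 8 4 (R₅ ⊕ q^ 4 · R₅⁻¹)
part-xvii = vanishes-≈ R₅-plus′ (vanishes-⊕ (vanishes-⊕ (within-vanishes 4 (within-· (within-dil 8 φ) (within-dil 16 iψ)))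
  (vanishes-refine 2 (within-vanishes {4} 4 (within-⊟ (within-term (+ 2) 1 within-E₅))))) (vanishes-q^ 8 4 (+ 2) 2))

within-R₅-even : Within 4 (0 ∷ 2 ∷ []) (φ₂ · (φ₈ · (iφ₄ · i₁₆)))
within-R₅-even = within-· within-φ₂ (within-· (within-dil 8 φ) (within-· (within-dil 4 iφ) (within-dil 16 iψ)))

part-xvi : Vanishes 4 7 (R₅ ⊖ q^ 4 · R₅⁻¹)
part-xvi = vanishes-≈ R₅-minus (within-vanishes 7 (within-⊖ within-R₅-even (within-term (+ 2) 1 (within-· (within-dil 8 ψ) (within-dil 16 iψ)))))

part-xviii : Vanishes 8 5 (R₅ ⊖ q^ 4 · R₅⁻¹)
part-xviii = vanishes-≈ R₅-minus (vanishes-⊕ (vanishes-refine 2 (within-vanishes {4} 5 within-R₅-even))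
  (within-vanishes 5 (within-⊟ (within-term (+ 2) 1 (within-· (within-dil 8 ψ) (within-dil 16 iψ))))))

R₅·R₅⁻¹ : R₅ · R₅⁻¹ ≈ onePS
R₅·R₅⁻¹ = begin
  ((neg G · G⁻¹) · dil 4 G) · ((neg G⁻¹ · G) · dil 4 G⁻¹)
    ≈⟨ solve 6 (λ n h k m g l → ((n :* h) :* k) :* ((m :* g) :* l) := (n :* m) :* ((g :* h) :* (k :* l))) ≈-refl (neg G) G⁻¹ (dil 4 G) (neg G⁻¹) G (dil 4 G⁻¹) ⟩
  (neg G · neg G⁻¹) · ((G · G⁻¹) · (dil 4 G · dil 4 G⁻¹))
    ≈⟨ ·-cong (neg-inverse G·G⁻¹) (·-cong G·G⁻¹ (dil-inverse 4 G·G⁻¹)) ⟩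
  onePS · (onePS · onePS)
    ≈⟨ ≈-trans (·-identityˡ _) (·-identityˡ _) ⟩
  onePS ∎
  where open ≈-Reasoning

φ₄²-dissection : φ₄ · φ₄ ≈ φ₈ · φ₈ ⊕ ι (+ 4) · (q^ 4 · (dil 16 ψ · dil 16 ψ))
φ₄²-dissection = φ²-dissection-dil 4

-- The class 4 modulo 8 comes from φ(q²)², dissected twice: it contributes 4q⁴ψ(q¹⁶)²/ψ(q¹⁶)² = 4q⁴,
-- and completing the square removes 2q⁴. The remaining monomial 2q⁴ lies below 12.
part-xix : Vanishes 8 12 (R₅ · R₅ ⊕ q^ 8 · (R₅⁻¹ · R₅⁻¹))
part-xix = vanishes-≈ (begin
  R₅ · R₅ ⊕ q^ 8 · (R₅⁻¹ · R₅⁻¹)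
    ≈⟨ ⊕-congˡ (·-congʳ (≈-sym (q^-+ 4 4))) ⟩
  R₅ · R₅ ⊕ (q^ 4 · q^ 4) · (R₅⁻¹ · R₅⁻¹)
    ≈⟨ solve 3 (λ r t x → r :* r :+ (x :* x) :* (t :* t) := (r :+ x :* t) :* (r :+ x :* t) :- con (+ 2) :* (x :* (r :* t))) ≈-refl R₅ R₅⁻¹ (q^ 4) ⟩
  (R₅ ⊕ q^ 4 · R₅⁻¹) · (R₅ ⊕ q^ 4 · R₅⁻¹) ⊖ ι (+ 2) · (q^ 4 · (R₅ · R₅⁻¹))
    ≈⟨ ⊕-cong (·-cong R₅-plus R₅-plus) (⊟-cong (·-congˡ (·-unit R₅·R₅⁻¹))) ⟩
  (φ₂ · i₁₆ ⊖ ι (+ 2) · (q · E₅)) · (φ₂ · i₁₆ ⊖ ι (+ 2) · (q · E₅)) ⊖ ι (+ 2) · q^ 4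
    ≈⟨ solve 5 (λ b i q e x → (b :* i :- con (+ 2) :* (q :* e)) :* (b :* i :- con (+ 2) :* (q :* e)) :- con (+ 2) :* x :=
        ((b :* b) :* (i :* i) :+ (con (+ 4) :* ((q :* q) :* (e :* e)) :- con (+ 4) :* (q :* (b :* (i :* e))))) :- con (+ 2) :* x) ≈-refl φ₂ i₁₆ q E₅ (q^ 4) ⟩
  ((φ₂ · φ₂) · (i₁₆ · i₁₆) ⊕ (ι (+ 4) · ((q · q) · (E₅ · E₅)) ⊖ ι (+ 4) · (q · (φ₂ · (i₁₆ · E₅))))) ⊖ ι (+ 2) · q^ 4
    ≈⟨ ⊕-congʳ (⊕-cong (·-congʳ (≈-trans φ₂²-dissection (⊕-congʳ φ₄²-dissection))) (⊕-congʳ (·-congˡ (·-congʳ (≈-sym q²≈))))) ⟩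
  (((φ₈ · φ₈ ⊕ ι (+ 4) · (q^ 4 · (dil 16 ψ · dil 16 ψ))) ⊕ ι (+ 4) · (q^ 2 · (ψ₈ · ψ₈))) · (i₁₆ · i₁₆) ⊕ (K₂ ⊖ K₁)) ⊖ ι (+ 2) · q^ 4
    ≈⟨ solve 7 (λ f x p y u i k → (((f :+ con (+ 4) :* (x :* (p :* p))) :+ con (+ 4) :* (y :* u)) :* (i :* i) :+ k) :- con (+ 2) :* x :=
        (f :* (i :* i) :+ (con (+ 4) :* (y :* (u :* (i :* i))) :+ k)) :+ (con (+ 4) :* (x :* ((p :* i) :* (p :* i))) :- con (+ 2) :* x))
        ≈-refl (φ₈ · φ₈) (q^ 4) (dil 16 ψ) (q^ 2) (ψ₈ · ψ₈) i₁₆ (K₂ ⊖ K₁) ⟩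
  ((φ₈ · φ₈) · (i₁₆ · i₁₆) ⊕ (ι (+ 4) · (q^ 2 · ((ψ₈ · ψ₈) · (i₁₆ · i₁₆))) ⊕ (K₂ ⊖ K₁)))
    ⊕ (ι (+ 4) · (q^ 4 · ((dil 16 ψ · i₁₆) · (dil 16 ψ · i₁₆))) ⊖ ι (+ 2) · q^ 4)
    ≈⟨ ⊕-congˡ (≈-trans (⊕-congʳ (·-congˡ (·-unit (unit-·-unit ψ₁₆·i₁₆ ψ₁₆·i₁₆))))
        (solve 1 (λ x → con (+ 4) :* x :- con (+ 2) :* x := con (+ 2) :* x) ≈-refl (q^ 4))) ⟩
  ((φ₈ · φ₈) · (i₁₆ · i₁₆) ⊕ (ι (+ 4) · (q^ 2 · ((ψ₈ · ψ₈) · (i₁₆ · i₁₆))) ⊕ (K₂ ⊖ K₁))) ⊕ ι (+ 2) · q^ 4 ∎)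
  (vanishes-⊕ (vanishes-⊕
      (within-vanishes 12 (within-· (within-· (within-dil 8 φ) (within-dil 8 φ)) (within-· (within-dil 16 iψ) (within-dil 16 iψ))))
      (vanishes-refine 2 (within-vanishes {4} 12 (within-⊕ (within-term (+ 4) 2 (within-· (within-· (within-dil 8 ψ) (within-dil 8 ψ)) (within-· (within-dil 16 iψ) (within-dil 16 iψ))))
        (within-⊖ (within-term (+ 4) 2 (within-· within-E₅ within-E₅)) (within-term (+ 4) 1 (within-· within-φ₂ (within-· (within-dil 16 iψ) within-E₅))))))))
    (vanishes-q^ 8 12 (+ 2) 4))
  where
  open ≈-Reasoning
  K₁ K₂ : PS
  K₁ = ι (+ 4) · (q^ 1 · (φ₂ · (i₁₆ · E₅)))
  K₂ = ι (+ 4) · (q^ 2 · (E₅ · E₅))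

-- The series ρ₇ and ρ₈

-- Unlike in `within-dil₀`, the modulus grows with the exponents. Even series dilated by 4 thus have
-- exponents divisible by 8.
within-dil-scaled : ∀ {m} .{{_ : NonZero m}} k .{{_ : NonZero k}} .{{_ : NonZero (m * k)}} {f} → Within m (0 ∷ []) f → Within (m * k) (0 ∷ []) (dil k f)
within-dil-scaled {m} k {f} w n with position k n
... | nonmultiple r≢0 = inj₁ (dil-nonmultiple k f r≢0)
... | multiple j with w j
... | inj₁ z = inj₁ (trans (dil-multiple k f j) z)
... | inj₂ (here r≡0) = inj₂ (here (trans (cong (λ x → (x * k) % (m * k)) (trans (ℕD.m≡m%n+[m/n]*n j m) (cong (_+ j / m * m) r≡0)))
        (trans (cong (_% (m * k)) (ℕP.*-assoc (j / m) m k)) (ℕD.m*n%n≡0 (j / m) (m * k)))))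

-- η = φ(-q²) and η₃ = φ(-q⁶). The sign change precedes the dilation; in the other order the result
-- would be φ(q²) and φ(q⁶).
η η₃ iη iη₃ : PS
η = dil 2 (neg φ)
η₃ = dil 6 (neg φ)
iη = dil 2 (neg iφ)
iη₃ = dil 6 (neg iφ)

η·iη : η · iη ≈ onePS
η·iη = dil-inverse 2 (neg-inverse φ·iφ)

η₃·iη₃ : η₃ · iη₃ ≈ onePS
η₃·iη₃ = dil-inverse 6 (neg-inverse φ·iφ)

dil-neg-φ : ∀ k .{{_ : NonZero k}} →
  dil k (neg φ) ≈ dil (4 * k) {{ℕP.m*n≢0 4 k}} φ ⊖ ι (+ 2) · (q^ (1 * k) · dil (8 * k) {{ℕP.m*n≢0 8 k}} ψ)
dil-neg-φ k = ≈-trans (dil-cong k neg-φ) (≈-trans (dil-⊕ k φ₄ (⊟ s)) (⊕-cong (dil-dil k 4 φ)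
  (≈-trans (dil-⊟ k s) (⊟-cong (≈-trans (dil-term k (+ 2) 1 ψ₈) (·-congˡ (·-congˡ (dil-dil k 8 ψ))))))))

η² : η · η ≈ φ₄ · φ₄ ⊖ s · s
η² = begin
  dil 2 (neg φ) · dil 2 (neg φ) ≈⟨ dil-· 2 (neg φ) (neg φ) ⟨
  dil 2 (neg φ · neg φ) ≈⟨ dil-cong 2 (neg-· φ φ) ⟨
  dil 2 (neg (φ · φ)) ≈⟨ dil-cong 2 (≈-trans (neg-cong φ²-dissection) (neg-⊕ (φ₂ · φ₂) (ι (+ 4) · (q · (ψ₄ · ψ₄))))) ⟩
  dil 2 (neg (φ₂ · φ₂) ⊕ neg (ι (+ 4) · (q · (ψ₄ · ψ₄))))
    ≈⟨ dil-cong 2 (⊕-cong (≈-trans (neg-· φ₂ φ₂) (·-cong (neg-dil-even 2 φ) (neg-dil-even 2 φ)))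
        (≈-trans (neg-· (ι (+ 4)) (q · (ψ₄ · ψ₄))) (·-cong (neg-constant (+ 4)) (≈-trans (neg-· q (ψ₄ · ψ₄)) (·-cong (neg-q^ 1)
        (≈-trans (neg-· ψ₄ ψ₄) (·-cong (neg-dil-even 4 ψ) (neg-dil-even 4 ψ)))))))) ⟩
  dil 2 (φ₂ · φ₂ ⊕ ι (+ 4) · ((ι ℤ.-1ℤ · q) · (ψ₄ · ψ₄)))
    ≈⟨ dil-cong 2 (⊕-congˡ (solve 2 (λ q p → con (+ 4) :* ((con ℤ.-1ℤ :* q) :* p) := con (- + 4) :* (q :* p)) ≈-refl q (ψ₄ · ψ₄))) ⟩
  dil 2 (φ₂ · φ₂ ⊕ ι (- + 4) · (q · (ψ₄ · ψ₄)))
    ≈⟨ dil-⊕ 2 (φ₂ · φ₂) (ι (- + 4) · (q · (ψ₄ · ψ₄))) ⟩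
  dil 2 (φ₂ · φ₂) ⊕ dil 2 (ι (- + 4) · (q · (ψ₄ · ψ₄)))
    ≈⟨ ⊕-cong (≈-trans (dil-· 2 φ₂ φ₂) (·-cong (dil-dil 2 2 φ) (dil-dil 2 2 φ)))
        (≈-trans (dil-term 2 (- + 4) 1 (ψ₄ · ψ₄)) (·-cong ≈-refl
        (·-cong q²≈ (≈-trans (dil-· 2 ψ₄ ψ₄) (·-cong (dil-dil 2 4 ψ) (dil-dil 2 4 ψ)))))) ⟩
  φ₄ · φ₄ ⊕ ι (- + 4) · ((q · q) · (ψ₈ · ψ₈))
    ≈⟨ solve 3 (λ f q p → f :* f :+ con (- + 4) :* ((q :* q) :* (p :* p)) := f :* f :- (con (+ 2) :* (q :* p)) :* (con (+ 2) :* (q :* p))) ≈-refl φ₄ q ψ₈ ⟩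
  φ₄ · φ₄ ⊖ s · s ∎
  where open ≈-Reasoning

-- The squares agree: ψ(q)²ψ(-q)² = ψ(q²)²φ(q)φ(-q), and φ(q)φ(-q) = φ₄² - s² = φ(-q²)².
ψ·neg-ψ : ψ · neg ψ ≈ dil 2 ψ · η
ψ·neg-ψ = square-injective {ψ · neg ψ} {dil 2 ψ · η}
  (·-constantTerm ψ (neg ψ) ψ₀ (trans (ℤP.*-identityˡ (ψ 0)) ψ₀))
  (·-constantTerm (dil 2 ψ) η (trans (dil-constantTerm 2 ψ) ψ₀) (trans (dil-constantTerm 2 (neg φ)) (trans (ℤP.*-identityˡ (φ 0)) (theta-constantTerm 1 0))))
  (begin
  (ψ · neg ψ) · (ψ · neg ψ) ≈⟨ solve 2 (λ p n → (p :* n) :* (p :* n) := (p :* p) :* (n :* n)) ≈-refl ψ (neg ψ) ⟩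
  (ψ · ψ) · (neg ψ · neg ψ) ≈⟨ ·-cong ψ²≈φ·ψ₂ (≈-trans (≈-sym (neg-· ψ ψ)) (≈-trans (neg-cong ψ²≈φ·ψ₂) (≈-trans (neg-· φ (dil 2 ψ)) (·-congˡ (neg-dil-even 2 ψ))))) ⟩
  (φ · dil 2 ψ) · (neg φ · dil 2 ψ) ≈⟨ ·-cong (·-congʳ φ-dissection₁) (·-congʳ neg-φ) ⟩
  ((φ₄ ⊕ s) · dil 2 ψ) · ((φ₄ ⊖ s) · dil 2 ψ) ≈⟨ solve 3 (λ a s p → ((a :+ s) :* p) :* ((a :- s) :* p) := (p :* p) :* (a :* a :- s :* s)) ≈-refl φ₄ s (dil 2 ψ) ⟩
  (dil 2 ψ · dil 2 ψ) · (φ₄ · φ₄ ⊖ s · s) ≈⟨ ·-congˡ η² ⟨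
  (dil 2 ψ · dil 2 ψ) · (η · η) ≈⟨ solve 2 (λ p n → (p :* p) :* (n :* n) := (p :* n) :* (p :* n)) ≈-refl (dil 2 ψ) η ⟩
  (dil 2 ψ · η) · (dil 2 ψ · η) ∎)
  where
  open ≈-Reasoning
  ψ₀ : ψ 0 ≡ 1ℤ
  ψ₀ = theta-constantTerm 2 1

ψ₃ ψ₂ ψ₆ ψ₁₂ φ₆ iψ₂ iψ₃ iψ₆ : PS
ψ₃ = dil 3 ψ
ψ₂ = dil 2 ψ
ψ₆ = dil 6 ψ
ψ₁₂ = dil 12 ψ
φ₆ = dil 6 φ
iψ₂ = dil 2 iψ
iψ₃ = dil 3 iψ
iψ₆ = dil 6 iψ

α β : PS
α = φ₆ · ψ₄
β = φ₂ · ψ₁₂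

neg-ψ·ψ₃ : neg (ψ · ψ₃) ≈ α ⊖ q · β
neg-ψ·ψ₃ = begin
  neg (ψ · ψ₃) ≈⟨ neg-cong ψ·ψ₃-dissection ⟩
  neg (α ⊕ q · β) ≈⟨ neg-⊕ α (q · β) ⟩
  neg α ⊕ neg (q · β) ≈⟨ ⊕-cong (≈-trans (neg-· φ₆ ψ₄) (·-cong (neg-dil-even 6 φ) (neg-dil-even 4 ψ)))
        (≈-trans (neg-· q β) (·-cong (neg-q^ 1) (≈-trans (neg-· φ₂ ψ₁₂) (·-cong (neg-dil-even 2 φ) (neg-dil-even 12 ψ))))) ⟩
  α ⊕ (ι ℤ.-1ℤ · q) · β ≈⟨ solve 3 (λ a q b → a :+ (con ℤ.-1ℤ :* q) :* b := a :- q :* b) ≈-refl α q β ⟩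
  α ⊖ q · β ∎
  where open ≈-Reasoning

ψ₃·neg-ψ₃ : ψ₃ · neg ψ₃ ≈ ψ₆ · η₃
ψ₃·neg-ψ₃ = begin
  ψ₃ · neg ψ₃ ≈⟨ ·-congˡ neg-dil-3 ⟩
  dil 3 ψ · dil 3 (neg ψ) ≈⟨ dil-· 3 ψ (neg ψ) ⟨
  dil 3 (ψ · neg ψ) ≈⟨ ≈-trans (dil-cong 3 ψ·neg-ψ) (dil-· 3 ψ₂ η) ⟩
  dil 3 ψ₂ · dil 3 η ≈⟨ ·-cong (dil-dil 3 2 ψ) (dil-dil 3 2 (neg φ)) ⟩
  ψ₆ · η₃ ∎
  where
  open ≈-Reasoning
  neg-dil-3 : neg (dil 3 ψ) ≈ dil 3 (neg ψ)
  neg-dil-3 = dil-unique 3 (λ m → cong₂ ℤ._*_ (sgn-triple m) (dil-multiple 3 ψ m))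
    (λ n r≢0 → trans (cong (sgn n ℤ.*_) (dil-nonmultiple 3 ψ {n} r≢0)) (ℤP.*-zeroʳ (sgn n)))
    where
    sgn-triple : ∀ m → sgn (m * 3) ≡ sgn m
    sgn-triple zero = refl
    sgn-triple (suc m) = cong -_ (trans (ℤP.neg-involutive (sgn (m * 3))) (sgn-triple m))

-- ψ(−q)ψ(−q³) rationalises the denominator: its product with ψ(q)ψ(q³) is even.
iψ·iψ₃ : iψ · iψ₃ ≈ (α ⊖ q · β) · ((iψ₂ · iψ₆) · (iη · iη₃))
iψ·iψ₃ = begin
  iψ · iψ₃
    ≈⟨ ·-unit unit ⟨
  (iψ · iψ₃) · (((ψ₂ · iψ₂) · (ψ₆ · iψ₆)) · ((η · iη) · (η₃ · iη₃)))
    ≈⟨ solve 9 (λ i p j r k e f g h → i :* (((p :* j) :* (r :* k)) :* ((e :* f) :* (g :* h))) := (i :* ((p :* e) :* (r :* g))) :* ((j :* k) :* (f :* h)))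
        ≈-refl (iψ · iψ₃) ψ₂ iψ₂ ψ₆ iψ₆ η iη η₃ iη₃ ⟩
  ((iψ · iψ₃) · ((ψ₂ · η) · (ψ₆ · η₃))) · D
    ≈⟨ ·-congʳ (·-congˡ (·-cong ψ·neg-ψ ψ₃·neg-ψ₃)) ⟨
  ((iψ · iψ₃) · ((ψ · neg ψ) · (ψ₃ · neg ψ₃))) · D
    ≈⟨ ·-congʳ (solve 6 (λ i k p n r m → (i :* k) :* ((p :* n) :* (r :* m)) := (n :* m) :* ((p :* i) :* (r :* k))) ≈-refl iψ iψ₃ ψ (neg ψ) ψ₃ (neg ψ₃)) ⟩
  ((neg ψ · neg ψ₃) · ((ψ · iψ) · (ψ₃ · iψ₃))) · D
    ≈⟨ ·-congʳ (·-unit (unit-·-unit ψ·iψ (dil-inverse 3 ψ·iψ))) ⟩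
  (neg ψ · neg ψ₃) · D
    ≈⟨ ·-congʳ (≈-trans (≈-sym (neg-· ψ ψ₃)) neg-ψ·ψ₃) ⟩
  (α ⊖ q · β) · D ∎
  where
  open ≈-Reasoning
  D : PS
  D = (iψ₂ · iψ₆) · (iη · iη₃)
  unit : ((ψ₂ · iψ₂) · (ψ₆ · iψ₆)) · ((η · iη) · (η₃ · iη₃)) ≈ onePS
  unit = unit-·-unit (unit-·-unit (dil-inverse 2 ψ·iψ) (dil-inverse 6 ψ·iψ)) (unit-·-unit η·iη η₃·iη₃)

-- φ(-q²)φ(-q⁶) and φ(q²)φ(q⁶) differ just in the sign of the class 2 modulo 4, which is
-- 2q²ψ(q⁴)ψ(q¹²).
η·η₃ : φ₂ · φ₆ ⊖ ι (+ 4) · (q^ 2 · (ψ₄ · ψ₁₂)) ≈ η · η₃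
η·η₃ = ≈-sym (begin
  η · η₃
    ≈⟨ ·-cong (dil-neg-φ 2) (dil-neg-φ 6) ⟩
  (a ⊖ ι (+ 2) · u) · (b ⊖ ι (+ 2) · v)
    ≈⟨ solve 4 (λ a b u v → (a :- con (+ 2) :* u) :* (b :- con (+ 2) :* v) := (a :* b :+ con (+ 4) :* (u :* v)) :- con (+ 2) :* (u :* b :+ v :* a)) ≈-refl a b u v ⟩
  (a · b ⊕ ι (+ 4) · (u · v)) ⊖ ι (+ 2) · (u · b ⊕ v · a)
    ≈⟨ solve 5 (λ a b u v w → (a :* b :+ con (+ 4) :* (u :* v)) :- con (+ 2) :* (u :* b :+ v :* a) := (a :+ con (+ 2) :* u) :* (b :+ con (+ 2) :* v) :- con (+ 4) :* (u :* b :+ v :* a)) ≈-refl a b u v a ⟩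
  (a ⊕ ι (+ 2) · u) · (b ⊕ ι (+ 2) · v) ⊖ ι (+ 4) · (u · b ⊕ v · a)
    ≈⟨ ⊕-cong (·-cong (φ-dissection 2) (φ-dissection 6)) (⊟-cong (·-congˡ cross)) ⟨
  φ₂ · φ₆ ⊖ ι (+ 4) · (q^ 2 · (ψ₄ · ψ₁₂)) ∎)
  where
  open ≈-Reasoning
  a b u v : PS
  a = dil 8 φ
  b = dil 24 φ
  u = q^ 2 · dil 16 ψ
  v = q^ 6 · dil 48 ψ
  cross : q^ 2 · (ψ₄ · ψ₁₂) ≈ u · b ⊕ v · a
  cross = begin
    q^ 2 · (ψ₄ · ψ₁₂)
      ≈⟨ ·-congˡ ψ₄·ψ₁₂-dissection ⟩
    q^ 2 · (b · dil 16 ψ ⊕ q^ 4 · (a · dil 48 ψ))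
      ≈⟨ solve 6 (λ x y a b p r → x :* (b :* p :+ y :* (a :* r)) := (x :* p) :* b :+ ((x :* y) :* r) :* a) ≈-refl (q^ 2) (q^ 4) a b (dil 16 ψ) (dil 48 ψ) ⟩
    u · b ⊕ ((q^ 2 · q^ 4) · dil 48 ψ) · a
      ≈⟨ ⊕-congˡ (·-congʳ (·-congʳ (q^-+ 2 4))) ⟩
    u · b ⊕ v · a ∎

iη² : (η · η₃) · (iη · iη₃) ≈ onePS
iη² = ≈-trans (solve 4 (λ e g f h → (e :* g) :* (f :* h) := (e :* f) :* (g :* h)) ≈-refl η η₃ iη iη₃) (unit-·-unit η·iη η₃·iη₃)

ψ²-dil : ∀ k .{{_ : NonZero k}} → dil k ψ · dil k ψ ≈ dil k φ · dil (2 * k) {{ℕP.m*n≢0 2 k}} ψ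
ψ²-dil k = ≈-trans (≈-sym (dil-· k ψ ψ)) (≈-trans (dil-cong k ψ²≈φ·ψ₂) (≈-trans (dil-· k φ ψ₂) (·-congˡ (dil-dil k 2 ψ))))

inverse² : ∀ {f g h} → f · g ≈ onePS → f · f ≈ h → h · (g · g) ≈ onePS
inverse² {f} {g} p p² = ≈-trans (·-congʳ (≈-sym p²)) (≈-trans (solve 2 (λ f g → (f :* f) :* (g :* g) := (f :* g) :* (f :* g)) ≈-refl f g) (unit-·-unit p p))

-- At q⁴ these are the quotients that remain in the critical class modulo 4 in `R₇-dissection` and
-- `R₈-dissection`; their own parity decides the class modulo 8.
U V : PS
U = (φ · φ) · (ψ₆ · (iψ · (iψ₃ · iψ₂)))
V = (dil 3 φ · dil 3 φ) · (ψ₂ · (iψ · (iψ₃ · iψ₆)))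

U-odd V-even : PS
U-odd = (ι (+ 4) · ((ψ₄ · ψ₄) · α) ⊖ (φ₂ · φ₂) · β) · ((iψ₂ · iψ₂) · (iη · iη₃))
V-even = ((φ₆ · φ₆) · α ⊖ ι (+ 4) · (q^ 4 · ((ψ₁₂ · ψ₁₂) · β))) · ((iψ₆ · iψ₆) · (iη · iη₃))

-- Once the denominator is rationalised, the even part is φ(q²)ψ(q⁴)/ψ(q²)² times (φ₂φ₆ -
-- 4q²ψ₄ψ₁₂)/(ηη₃), and both factors are 1. For `V` the same combination makes the odd part equal to
-- -q.
U-dissection : U ≈ onePS ⊕ q · U-odd
U-dissection = begin
  (φ · φ) · (ψ₆ · (iψ · (iψ₃ · iψ₂)))
    ≈⟨ solve 5 (λ f p i k j → f :* (p :* (i :* (k :* j))) := f :* ((i :* k) :* (p :* j))) ≈-refl (φ · φ) ψ₆ iψ iψ₃ iψ₂ ⟩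
  (φ · φ) · ((iψ · iψ₃) · (ψ₆ · iψ₂))
    ≈⟨ ·-cong φ²-dissection (·-congʳ iψ·iψ₃) ⟩
  (φ₂ · φ₂ ⊕ ι (+ 4) · (q · (ψ₄ · ψ₄))) · (((φ₆ · ψ₄ ⊖ q · (φ₂ · ψ₁₂)) · ((iψ₂ · iψ₆) · H)) · (ψ₆ · iψ₂))
    ≈⟨ solve 9 (λ f p g r q j k h e → (f :* f :+ con (+ 4) :* (q :* (p :* p))) :* (((g :* p :- q :* (f :* r)) :* ((j :* k) :* h)) :* (e :* j)) :=
        (((f :* p) :* (j :* j)) :* ((f :* g :- con (+ 4) :* ((q :* q) :* (p :* r))) :* h) :+ q :* ((con (+ 4) :* ((p :* p) :* (g :* p)) :- (f :* f) :* (f :* r)) :* ((j :* j) :* h))) :* (e :* k))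
        ≈-refl φ₂ ψ₄ φ₆ ψ₁₂ q iψ₂ iψ₆ H ψ₆ ⟩
  (((φ₂ · ψ₄) · (iψ₂ · iψ₂)) · ((φ₂ · φ₆ ⊖ ι (+ 4) · ((q · q) · (ψ₄ · ψ₁₂))) · H) ⊕ q · U-odd) · (ψ₆ · iψ₆)
    ≈⟨ ·-unit (dil-inverse 6 ψ·iψ) ⟩
  ((φ₂ · ψ₄) · (iψ₂ · iψ₂)) · ((φ₂ · φ₆ ⊖ ι (+ 4) · ((q · q) · (ψ₄ · ψ₁₂))) · H) ⊕ q · U-odd
    ≈⟨ ⊕-congʳ (≈-trans (·-cong (inverse² (dil-inverse 2 ψ·iψ) (ψ²-dil 2))
        (≈-trans (·-congʳ (≈-trans (⊕-congˡ (⊟-cong (·-congˡ (·-congʳ (≈-sym q²≈))))) η·η₃)) iη²)) (·-identityˡ onePS)) ⟩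
  onePS ⊕ q · U-odd ∎
  where
  open ≈-Reasoning
  H : PS
  H = iη · iη₃

φ₃²-dissection : dil 3 φ · dil 3 φ ≈ φ₆ · φ₆ ⊕ ι (+ 4) · (q^ 3 · (ψ₁₂ · ψ₁₂))
φ₃²-dissection = φ²-dissection-dil 3

V-dissection : V ≈ V-even ⊖ q
V-dissection = begin
  (dil 3 φ · dil 3 φ) · (ψ₂ · (iψ · (iψ₃ · iψ₆)))
    ≈⟨ solve 5 (λ f p i k j → f :* (p :* (i :* (k :* j))) := f :* ((i :* k) :* (p :* j))) ≈-refl (dil 3 φ · dil 3 φ) ψ₂ iψ iψ₃ iψ₆ ⟩
  (dil 3 φ · dil 3 φ) · ((iψ · iψ₃) · (ψ₂ · iψ₆))
    ≈⟨ ·-cong (≈-trans φ₃²-dissection (⊕-congˡ (·-congˡ (·-congʳ (≈-sym (q^-+ 1 2)))))) (·-congʳ iψ·iψ₃) ⟩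
  (φ₆ · φ₆ ⊕ ι (+ 4) · ((q · q^ 2) · (ψ₁₂ · ψ₁₂))) · (((φ₆ · ψ₄ ⊖ q · (φ₂ · ψ₁₂)) · ((iψ₂ · iψ₆) · H)) · (ψ₂ · iψ₆))
    ≈⟨ solve 10 (λ g r p f q x j k h e → (g :* g :+ con (+ 4) :* ((q :* x) :* (r :* r))) :* (((g :* p :- q :* (f :* r)) :* ((j :* k) :* h)) :* (e :* k)) :=
        ((g :* g) :* (g :* p) :- con (+ 4) :* (((q :* q) :* x) :* ((r :* r) :* (f :* r)))) :* ((k :* k) :* h) :* (e :* j)
        :- (q :* (((g :* r) :* (k :* k)) :* ((f :* g :- con (+ 4) :* (x :* (p :* r))) :* h))) :* (e :* j))
        ≈-refl φ₆ ψ₁₂ ψ₄ φ₂ q (q^ 2) iψ₂ iψ₆ H ψ₂ ⟩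
  (((φ₆ · φ₆) · α ⊖ ι (+ 4) · (((q · q) · q^ 2) · ((ψ₁₂ · ψ₁₂) · β))) · ((iψ₆ · iψ₆) · H)) · (ψ₂ · iψ₂)
    ⊖ (q · (((φ₆ · ψ₁₂) · (iψ₆ · iψ₆)) · ((φ₂ · φ₆ ⊖ ι (+ 4) · (q^ 2 · (ψ₄ · ψ₁₂))) · H))) · (ψ₂ · iψ₂)
    ≈⟨ ⊕-cong (·-unit (dil-inverse 2 ψ·iψ)) (⊟-cong (·-unit (dil-inverse 2 ψ·iψ))) ⟩
  ((φ₆ · φ₆) · α ⊖ ι (+ 4) · (((q · q) · q^ 2) · ((ψ₁₂ · ψ₁₂) · β))) · ((iψ₆ · iψ₆) · H)
    ⊖ q · (((φ₆ · ψ₁₂) · (iψ₆ · iψ₆)) · ((φ₂ · φ₆ ⊖ ι (+ 4) · (q^ 2 · (ψ₄ · ψ₁₂))) · H))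
    ≈⟨ ⊕-cong (·-congʳ (⊕-congˡ (⊟-cong (·-congˡ (·-congʳ (≈-trans (·-congʳ (≈-sym q²≈)) (q^-+ 2 2)))))))
        (⊟-cong (·-unit (unit-·-unit (inverse² (dil-inverse 6 ψ·iψ) (ψ²-dil 6)) (≈-trans (·-congʳ η·η₃) iη²)))) ⟩
  V-even ⊖ q ∎
  where
  open ≈-Reasoning
  H : PS
  H = iη · iη₃

within-H : Within 2 (0 ∷ []) (iη · iη₃)
within-H = within-· (within-dil 2 (neg iφ)) (within-dil 6 (neg iφ))

within-α : Within 2 (0 ∷ []) α
within-α = within-· (within-dil 6 φ) (within-dil 4 ψ)

within-β : Within 2 (0 ∷ []) β
within-β = within-· (within-dil 2 φ) (within-dil 12 ψ)

within-collapse : ∀ {m} .{{_ : NonZero m}} {r f} → Within m (r ∷ r ∷ []) f → Within m (r ∷ []) f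
within-collapse w n with w n
... | inj₁ z = inj₁ z
... | inj₂ (here p) = inj₂ (here p)
... | inj₂ (there p) = inj₂ p

within-U-odd : Within 2 (0 ∷ []) U-odd
within-U-odd = within-collapse (within-· (within-⊖ (within-· (within-constant (+ 4)) (within-· (within-· ψ₄′ ψ₄′) within-α)) (within-· (within-· φ₂′ φ₂′) within-β))
  (within-· (within-· iψ₂′ iψ₂′) within-H))
  where
  ψ₄′ = within-dil {2} 4 ψ
  φ₂′ = within-dil {2} 2 φ
  iψ₂′ = within-dil {2} 2 iψ

within-V-even : Within 2 (0 ∷ []) V-even
within-V-even = within-collapse (within-· (within-⊖ (within-· (within-· φ₆′ φ₆′) within-α) (within-term (+ 4) 4 (within-· (within-· ψ₁₂′ ψ₁₂′) within-β)))
  (within-· (within-· iψ₆′ iψ₆′) within-H))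
  where
  φ₆′ = within-dil {2} 6 φ
  ψ₁₂′ = within-dil {2} 12 ψ
  iψ₆′ = within-dil {2} 6 iψ

i₁₂ i₂₄ : PS
i₁₂ = dil 12 iψ
i₂₄ = dil 24 iψ

-- The odd part of φ(q³), in the role of `s`.
t : PS
t = ι (+ 2) · (q^ 3 · dil 24 ψ)

φ₃-split : dil 3 φ ≈ dil 12 φ ⊕ t
φ₃-split = φ-dissection 3

φ₆² : φ₆ · φ₆ ≈ dil 12 φ · dil 12 φ ⊕ t · t
φ₆² = ≈-trans (φ²-dissection-dil 6) (⊕-congˡ (≈-trans (·-congˡ (·-congʳ (≈-sym (q^-+ 3 3))))
  (solve 2 (λ x p → con (+ 4) :* ((x :* x) :* (p :* p)) := (con (+ 2) :* (x :* p)) :* (con (+ 2) :* (x :* p))) ≈-refl (q^ 3) (dil 24 ψ))))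

G-plus₃ : dil 3 G ⊕ q^ 3 · dil 3 G⁻¹ ≈ dil 3 φ · i₁₂
G-plus₃ = ≈-trans (G-plus-dil 3) (·-congˡ (dil-dil 3 4 iψ))

G-minus₃ : dil 3 G ⊖ q^ 3 · dil 3 G⁻¹ ≈ φ₆ · i₁₂
G-minus₃ = ≈-trans (G-minus-dil 3) (·-cong (dil-dil 3 2 φ) (dil-dil 3 4 iψ))

G-plus₆ : dil 6 G ⊕ q^ 6 · dil 6 G⁻¹ ≈ φ₆ · i₂₄
G-plus₆ = ≈-trans (G-plus-dil 6) (·-congˡ (dil-dil 6 4 iψ))

G-minus₆ : dil 6 G ⊖ q^ 6 · dil 6 G⁻¹ ≈ dil 12 φ · i₂₄
G-minus₆ = ≈-trans (G-minus-dil 6) (·-cong (dil-dil 6 2 φ) (dil-dil 6 4 iψ))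

dil-product₄ : ∀ f g h j k → dil 4 ((f · f) · (g · (h · (j · k)))) ≈ (dil 4 f · dil 4 f) · (dil 4 g · (dil 4 h · (dil 4 j · dil 4 k)))
dil-product₄ f g h j k = ≈-trans (dil-· 4 (f · f) (g · (h · (j · k)))) (·-cong (dil-· 4 f f)
  (≈-trans (dil-· 4 g (h · (j · k))) (·-congˡ (≈-trans (dil-· 4 h (j · k)) (·-congˡ (dil-· 4 j k))))))

R₇ R₇⁻¹ : PS
R₇ = (G · (dil 2 G⁻¹ · dil 2 G⁻¹)) · dil 3 G
R₇⁻¹ = (G⁻¹ · (dil 2 G · dil 2 G)) · dil 3 G⁻¹

-- Put A = GG₃, B = q⁴/A, C = G₂², D = q⁴/C. The relations give A ± B and C ± D, and (A + B)(C + D)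
-- - (A - B)(C - D) = 2(AD + BC) with AD + BC = q⁴(R₇ + 1/R₇). A factor 2qψ(q⁸) splits off the
-- numerator and cancels, which leaves q³ on the left.
R₇-equation : ι (+ 4) · (q^ 3 · (R₇ ⊕ R₇⁻¹)) ≈
  (dil 3 φ · ((ι (+ 2) · (φ₄ · φ₄) ⊖ φ₄ · s) ⊕ s · s) ⊕ (φ₂ · φ₆) · (s ⊖ ι (+ 2) · φ₄)) · (iψ₄ · (i₁₂ · iψ₈))
R₇-equation = q^-cancel 1 (constant-cancel 1 (begin
  ι (+ 2) · (q · (ι (+ 4) · (q^ 3 · (R₇ ⊕ R₇⁻¹))))
    ≈⟨ solve 3 (λ q x r → con (+ 2) :* (q :* (con (+ 4) :* (x :* r))) := con (+ 8) :* ((q :* x) :* r)) ≈-refl q (q^ 3) (R₇ ⊕ R₇⁻¹) ⟩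
  ι (+ 8) · ((q · q^ 3) · (R₇ ⊕ R₇⁻¹))
    ≈⟨ ·-congˡ (·-congʳ (≈-trans (q^-+ 1 3) (≈-sym (q^-+ 2 2)))) ⟩
  ι (+ 8) · ((q^ 2 · q^ 2) · (R₇ ⊕ R₇⁻¹))
    ≈⟨ ⊕⊖-products ⟩
  (PP ⊕ MM) · (P₂ · P₂ ⊕ M₂ · M₂) ⊖ (PM ⊕ MP) · (ι (+ 2) · (P₂ · M₂))
    ≈⟨ ⊕-cong (·-cong (⊕-cong (·-cong G-plus G-plus₃) (·-cong G-minus G-minus₃)) (⊕-cong (·-cong G-plus₂ G-plus₂) (·-cong G-minus₂ G-minus₂)))
        (⊟-cong (·-cong (⊕-cong (·-cong G-plus G-minus₃) (·-cong G-minus G-plus₃)) (·-congˡ (·-cong G-plus₂ G-minus₂)))) ⟩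
  ((φ · iψ₄) · (d · i₁₂) ⊕ (b · iψ₄) · (e · i₁₂)) · ((b · iψ₈) · (b · iψ₈) ⊕ (c · iψ₈) · (c · iψ₈))
    ⊖ ((φ · iψ₄) · (e · i₁₂) ⊕ (b · iψ₄) · (d · i₁₂)) · (ι (+ 2) · ((b · iψ₈) · (c · iψ₈)))
    ≈⟨ solve 8 (λ a b c d e i j k → ((a :* i) :* (d :* j) :+ (b :* i) :* (e :* j)) :* ((b :* k) :* (b :* k) :+ (c :* k) :* (c :* k))
        :- ((a :* i) :* (e :* j) :+ (b :* i) :* (d :* j)) :* (con (+ 2) :* ((b :* k) :* (c :* k)))
        := ((a :* d :+ b :* e) :* (b :* b :+ c :* c) :- con (+ 2) :* ((a :* e) :* (b :* c) :+ (b :* b) :* (d :* c))) :* ((i :* (j :* k)) :* k))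
        ≈-refl φ b c d e iψ₄ i₁₂ iψ₈ ⟩
  ((φ · d ⊕ b · e) · (b · b ⊕ c · c) ⊖ ι (+ 2) · ((φ · e) · (b · c) ⊕ (b · b) · (d · c))) · (J · iψ₈)
    ≈⟨ ·-congʳ (⊕-cong (·-cong (⊕-congʳ (·-congʳ φ-dissection₁)) (⊕-congʳ φ₂²≈φ₄²+s²))
        (⊟-cong (·-congˡ (⊕-cong (·-congʳ (·-congʳ φ-dissection₁)) (·-congʳ φ₂²≈φ₄²+s²))))) ⟩
  (((c ⊕ s) · d ⊕ b · e) · ((c · c ⊕ s · s) ⊕ c · c) ⊖ ι (+ 2) · (((c ⊕ s) · e) · (b · c) ⊕ (c · c ⊕ s · s) · (d · c))) · (J · iψ₈)
    ≈⟨ solve 8 (λ b c d e q p j i → let s = con (+ 2) :* (q :* p) in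
        (((c :+ s) :* d :+ b :* e) :* ((c :* c :+ s :* s) :+ c :* c) :- con (+ 2) :* (((c :+ s) :* e) :* (b :* c) :+ (c :* c :+ s :* s) :* (d :* c))) :* (j :* i)
        := con (+ 2) :* (q :* ((d :* ((con (+ 2) :* (c :* c) :- c :* s) :+ s :* s) :+ (b :* e) :* (s :- con (+ 2) :* c)) :* j)) :* (p :* i)) ≈-refl b c d e q ψ₈ J iψ₈ ⟩
  (ι (+ 2) · (q · (K · J))) · (ψ₈ · iψ₈)
    ≈⟨ ·-unit ψ₈·iψ₈ ⟩
  ι (+ 2) · (q · (K · J)) ∎))
  where
  open ≈-Reasoning
  b c d e J K P₂ M₂ PP MM PM MP : PS
  b = φ₂
  c = φ₄
  d = dil 3 φ
  e = φ₆
  J = iψ₄ · (i₁₂ · iψ₈)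
  K = d · ((ι (+ 2) · (c · c) ⊖ c · s) ⊕ s · s) ⊕ (b · e) · (s ⊖ ι (+ 2) · c)
  P₂ = dil 2 G ⊕ q^ 2 · dil 2 G⁻¹
  M₂ = dil 2 G ⊖ q^ 2 · dil 2 G⁻¹
  PP = (G ⊕ q · G⁻¹) · (dil 3 G ⊕ q^ 3 · dil 3 G⁻¹)
  MM = (G ⊖ q · G⁻¹) · (dil 3 G ⊖ q^ 3 · dil 3 G⁻¹)
  PM = (G ⊕ q · G⁻¹) · (dil 3 G ⊖ q^ 3 · dil 3 G⁻¹)
  MP = (G ⊖ q · G⁻¹) · (dil 3 G ⊕ q^ 3 · dil 3 G⁻¹)
  ⊕⊖-products : ι (+ 8) · ((q^ 2 · q^ 2) · (R₇ ⊕ R₇⁻¹)) ≈ (PP ⊕ MM) · (P₂ · P₂ ⊕ M₂ · M₂) ⊖ (PM ⊕ MP) · (ι (+ 2) · (P₂ · M₂))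
  ⊕⊖-products = begin
    ι (+ 8) · ((q^ 2 · q^ 2) · (R₇ ⊕ R₇⁻¹))
      ≈⟨ solve 7 (λ g h k l u v x → con (+ 8) :* ((x :* x) :* ((g :* (v :* v)) :* k :+ (h :* (u :* u)) :* l)) :=
        con (+ 8) :* (((g :* k) :* ((x :* v) :* (x :* v))) :+ ((x :* x) :* (h :* l)) :* (u :* u))) ≈-refl G G⁻¹ (dil 3 G) (dil 3 G⁻¹) (dil 2 G) (dil 2 G⁻¹) (q^ 2) ⟩
    ι (+ 8) · (((G · dil 3 G) · (y · y)) ⊕ ((q^ 2 · q^ 2) · (G⁻¹ · dil 3 G⁻¹)) · (dil 2 G · dil 2 G))
      ≈⟨ ·-congˡ (⊕-congˡ (·-congʳ (·-congʳ (≈-trans (q^-+ 2 2) (≈-sym (q^-+ 1 3)))))) ⟩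
    ι (+ 8) · (((G · dil 3 G) · (y · y)) ⊕ ((q · q^ 3) · (G⁻¹ · dil 3 G⁻¹)) · (dil 2 G · dil 2 G))
      ≈⟨ solve 8 (λ g h k l u y q x → con (+ 8) :* (((g :* k) :* (y :* y)) :+ ((q :* x) :* (h :* l)) :* (u :* u)) :=
        ((g :+ q :* h) :* (k :+ x :* l) :+ (g :- q :* h) :* (k :- x :* l)) :* ((u :+ y) :* (u :+ y) :+ (u :- y) :* (u :- y))
        :- ((g :+ q :* h) :* (k :- x :* l) :+ (g :- q :* h) :* (k :+ x :* l)) :* (con (+ 2) :* ((u :+ y) :* (u :- y))))
        ≈-refl G G⁻¹ (dil 3 G) (dil 3 G⁻¹) (dil 2 G) y q (q^ 3) ⟩
    (PP ⊕ MM) · (P₂ · P₂ ⊕ M₂ · M₂) ⊖ (PM ⊕ MP) · (ι (+ 2) · (P₂ · M₂)) ∎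
    where
    y : PS
    y = q^ 2 · dil 2 G⁻¹

within-s : Within 4 (1 ∷ []) s
within-s = within-term (+ 2) 1 (within-dil 8 ψ)

within-t : Within 4 (3 ∷ []) t
within-t = within-term (+ 2) 3 (within-dil 24 ψ)

within-φ₄ : Within 4 (0 ∷ []) φ₄
within-φ₄ = within-dil 4 φ

within-φ₁₂ : Within 4 (0 ∷ []) (dil 12 φ)
within-φ₁₂ = within-dil 12 φ

-- The terms of the numerator outside the class 3 modulo 4. The two omitted ones are
-- 4q³φ(q⁴)²ψ(q²⁴), which yields 4q³U(q⁴), and 4q³ψ(q⁴)ψ(q¹²)ψ(q⁸), which the denominator reduces to
-- 4q³.
remainder₇ : PS
remainder₇ = (dil 12 φ · ((ι (+ 2) · (φ₄ · φ₄) ⊖ φ₄ · s) ⊕ s · s) ⊕ t · (s · s ⊖ φ₄ · s))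
  ⊕ (W · (s ⊖ ι (+ 2) · φ₄) ⊖ ι (+ 4) · (q^ 2 · ((ψ₄ · ψ₁₂) · φ₄)))

within-remainder₇ : Within 4 _ (remainder₇ · (iψ₄ · (i₁₂ · iψ₈)))
within-remainder₇ = within-·
  (within-⊕ (within-⊕ (within-· within-φ₁₂ (within-⊕ (within-⊖ (within-· (within-constant (+ 2)) (within-· within-φ₄ within-φ₄)) (within-· within-φ₄ within-s)) (within-· within-s within-s)))
      (within-· within-t (within-⊖ (within-· within-s within-s) (within-· within-φ₄ within-s))))
    (within-⊖ (within-· within-W (within-⊖ within-s (within-· (within-constant (+ 2)) within-φ₄)))
      (within-term (+ 4) 2 (within-· (within-· (within-dil 4 ψ) (within-dil 12 ψ)) within-φ₄))))
  (within-· (within-dil 4 iψ) (within-· (within-dil 12 iψ) (within-dil 8 iψ)))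

R₇-dissection : ι (+ 4) · (q^ 3 · (R₇ ⊕ R₇⁻¹)) ≈
  (remainder₇ · (iψ₄ · (i₁₂ · iψ₈)) ⊕ ι (+ 4) · (q^ 7 · dil 4 U-odd)) ⊕ ι (+ 8) · q^ 3
R₇-dissection = begin
  ι (+ 4) · (q^ 3 · (R₇ ⊕ R₇⁻¹))
    ≈⟨ R₇-equation ⟩
  (dil 3 φ · ((ι (+ 2) · (φ₄ · φ₄) ⊖ φ₄ · s) ⊕ s · s) ⊕ (φ₂ · φ₆) · (s ⊖ ι (+ 2) · φ₄)) · (iψ₄ · (i₁₂ · iψ₈))
    ≈⟨ ·-congʳ (⊕-cong (·-congʳ φ₃-split) (·-congʳ (≈-trans φ₂·φ₆-dissection (⊕-congˡ (·-congˡ (·-congʳ q²≈)))))) ⟩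
  ((dil 12 φ ⊕ t) · ((ι (+ 2) · (φ₄ · φ₄) ⊖ φ₄ · s) ⊕ s · s) ⊕ (W ⊕ ι (+ 2) · ((q · q) · (ψ₄ · ψ₁₂))) · (s ⊖ ι (+ 2) · φ₄)) · (iψ₄ · (i₁₂ · iψ₈))
    ≈⟨ solve 12 (λ f x r c q p w u v i j k → let s = con (+ 2) :* (q :* p) ; t = con (+ 2) :* (x :* r) in
        ((f :+ t) :* ((con (+ 2) :* (c :* c) :- c :* s) :+ s :* s) :+ (w :+ con (+ 2) :* ((q :* q) :* (u :* v))) :* (s :- con (+ 2) :* c)) :* (i :* (j :* k))
        := (((f :* ((con (+ 2) :* (c :* c) :- c :* s) :+ s :* s) :+ t :* (s :* s :- c :* s)) :+ (w :* (s :- con (+ 2) :* c) :- con (+ 4) :* ((q :* q) :* ((u :* v) :* c)))) :* (i :* (j :* k))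
        :+ con (+ 4) :* (x :* ((c :* c) :* (r :* (i :* (j :* k)))))) :+ con (+ 4) :* ((q :* (q :* q)) :* ((u :* i) :* ((v :* j) :* (p :* k)))))
        ≈-refl (dil 12 φ) (q^ 3) (dil 24 ψ) φ₄ q ψ₈ W ψ₄ ψ₁₂ iψ₄ i₁₂ iψ₈ ⟩
  (((dil 12 φ · ((ι (+ 2) · (φ₄ · φ₄) ⊖ φ₄ · s) ⊕ s · s) ⊕ t · (s · s ⊖ φ₄ · s)) ⊕ (W · (s ⊖ ι (+ 2) · φ₄) ⊖ ι (+ 4) · ((q · q) · ((ψ₄ · ψ₁₂) · φ₄)))) · J
    ⊕ ι (+ 4) · (q^ 3 · ((φ₄ · φ₄) · (dil 24 ψ · J)))) ⊕ ι (+ 4) · ((q · (q · q)) · ((ψ₄ · iψ₄) · ((ψ₁₂ · i₁₂) · (ψ₈ · iψ₈))))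
    ≈⟨ ⊕-cong (⊕-cong (·-congʳ (⊕-congˡ (⊕-congˡ (⊟-cong (·-congˡ (·-congʳ (≈-sym q²≈))))))) (·-congˡ (·-congˡ U₄)))
        (·-congˡ (≈-trans (·-cong (≈-trans (·-congˡ (≈-sym q²≈)) (q^-+ 1 2)) units) (·-onePS _))) ⟩
  (remainder₇ · J ⊕ ι (+ 4) · (q^ 3 · (onePS ⊕ q^ 4 · dil 4 U-odd))) ⊕ ι (+ 4) · q^ 3
    ≈⟨ ⊕-congʳ (⊕-congˡ (·-congˡ (≈-trans (·-distribˡ (q^ 3) onePS (q^ 4 · dil 4 U-odd)) (⊕-cong (·-onePS _) (≈-trans (≈-sym (·-assoc _ _ _)) (·-congʳ (q^-+ 3 4))))))) ⟩
  (remainder₇ · J ⊕ ι (+ 4) · (q^ 3 ⊕ q^ 7 · dil 4 U-odd)) ⊕ ι (+ 4) · q^ 3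
    ≈⟨ solve 3 (λ r x u → (r :+ con (+ 4) :* (x :+ u)) :+ con (+ 4) :* x := (r :+ con (+ 4) :* u) :+ con (+ 8) :* x) ≈-refl (remainder₇ · J) (q^ 3) (q^ 7 · dil 4 U-odd) ⟩
  (remainder₇ · J ⊕ ι (+ 4) · (q^ 7 · dil 4 U-odd)) ⊕ ι (+ 8) · q^ 3 ∎
  where
  open ≈-Reasoning
  J : PS
  J = iψ₄ · (i₁₂ · iψ₈)
  units : (ψ₄ · iψ₄) · ((ψ₁₂ · i₁₂) · (ψ₈ · iψ₈)) ≈ onePS
  units = unit-·-unit ψ₄·iψ₄ (unit-·-unit (dil-inverse 12 ψ·iψ) ψ₈·iψ₈)
  U₄ : (φ₄ · φ₄) · (dil 24 ψ · J) ≈ onePS ⊕ q^ 4 · dil 4 U-odd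
  U₄ = begin
    (φ₄ · φ₄) · (dil 24 ψ · (iψ₄ · (i₁₂ · iψ₈)))
      ≈⟨ ·-congˡ (·-cong (dil-dil 4 6 ψ) (·-congˡ (·-cong (dil-dil 4 3 iψ) (dil-dil 4 2 iψ)))) ⟨
    (φ₄ · φ₄) · (dil 4 ψ₆ · (iψ₄ · (dil 4 iψ₃ · dil 4 iψ₂)))
      ≈⟨ dil-product₄ φ ψ₆ iψ iψ₃ iψ₂ ⟨
    dil 4 U
      ≈⟨ ≈-trans (dil-cong 4 U-dissection) (dil-⊕ 4 onePS (q · U-odd)) ⟩
    dil 4 onePS ⊕ dil 4 (q · U-odd)
      ≈⟨ ⊕-cong (dil-q^ 4 0) (≈-trans (dil-· 4 q U-odd) (·-congʳ (dil-q^ 4 1))) ⟩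
    onePS ⊕ q^ 4 · dil 4 U-odd ∎

-- The monomial 8q³ of `R₇-dissection`, divided by 4q³, is the constant term 2 of R₇ + 1/R₇. The
-- progression therefore has to begin at 8: at exponent 0 both coefficients are 1.
part-xxi : Vanishes 8 8 (R₇ ⊕ q^ 0 · R₇⁻¹)
part-xxi = vanishes-≈ (⊕-congˡ (·-identityˡ R₇⁻¹)) (vanishes-q^⁻¹ 3 (vanishes-constant⁻¹ 3 (vanishes-≈ R₇-dissection (vanishes-⊕
  (vanishes-⊕ (vanishes-refine 2 (within-vanishes {4} 11 within-remainder₇))
    (within-vanishes 11 (within-term (+ 4) 7 (within-dil-scaled {2} 4 within-U-odd))))
  (vanishes-q^ 8 11 (+ 8) 3)))))

R₈ R₈⁻¹ : PS
R₈ = (G · dil 3 G⁻¹) · (dil 6 G · dil 6 G)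
R₈⁻¹ = (G⁻¹ · dil 3 G) · (dil 6 G⁻¹ · dil 6 G⁻¹)

-- The same device with A = q³G/G₃, B = qG₃/G, C = G₆², D = q¹²/C, where AC + BD = q³(R₈ + q¹⁰/R₈).
-- This time the factor 2q³ψ(q²⁴) splits off and cancels.
R₈-equation : ι (+ 4) · (R₈ ⊕ q^ 10 · R₈⁻¹) ≈
  (φ · ((ι (+ 2) · (dil 12 φ · dil 12 φ) ⊖ dil 12 φ · t) ⊕ t · t) ⊕ (φ₂ · φ₆) · (ι (+ 2) · dil 12 φ ⊖ t)) · (iψ₄ · (i₁₂ · i₂₄))
R₈-equation = q^-cancel 3 (constant-cancel 1 (begin
  ι (+ 2) · (q^ 3 · (ι (+ 4) · (R₈ ⊕ q^ 10 · R₈⁻¹)))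
    ≈⟨ ·-congˡ (·-cong (≈-sym (q^-+ 1 2)) (·-congˡ (⊕-congˡ (·-congʳ (≈-sym (q^-+ 4 6)))))) ⟩
  ι (+ 2) · ((q · q^ 2) · (ι (+ 4) · (R₈ ⊕ (q^ 4 · q^ 6) · R₈⁻¹)))
    ≈⟨ products ⟩
  (PP ⊖ MM) · (P₆ · P₆ ⊕ M₆ · M₆) ⊖ (PM ⊖ MP) · (ι (+ 2) · (P₆ · M₆))
    ≈⟨ ⊕-cong (·-cong (⊕-cong (·-cong G-plus G-plus₃) (⊟-cong (·-cong G-minus G-minus₃))) (⊕-cong (·-cong G-plus₆ G-plus₆) (·-cong G-minus₆ G-minus₆)))
        (⊟-cong (·-cong (⊕-cong (·-cong G-plus G-minus₃) (⊟-cong (·-cong G-minus G-plus₃))) (·-congˡ (·-cong G-plus₆ G-minus₆)))) ⟩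
  ((a · iψ₄) · (d · i₁₂) ⊖ (b · iψ₄) · (e · i₁₂)) · ((e · i₂₄) · (e · i₂₄) ⊕ (f · i₂₄) · (f · i₂₄))
    ⊖ ((a · iψ₄) · (e · i₁₂) ⊖ (b · iψ₄) · (d · i₁₂)) · (ι (+ 2) · ((e · i₂₄) · (f · i₂₄)))
    ≈⟨ solve 8 (λ a b d e f i j k → ((a :* i) :* (d :* j) :- (b :* i) :* (e :* j)) :* ((e :* k) :* (e :* k) :+ (f :* k) :* (f :* k))
        :- ((a :* i) :* (e :* j) :- (b :* i) :* (d :* j)) :* (con (+ 2) :* ((e :* k) :* (f :* k)))
        := ((a :* d :- b :* e) :* (e :* e :+ f :* f) :- con (+ 2) :* ((e :* e) :* (a :* f) :- (b :* e) :* (d :* f))) :* ((i :* (j :* k)) :* k))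
        ≈-refl a b d e f iψ₄ i₁₂ i₂₄ ⟩
  ((a · d ⊖ b · e) · (e · e ⊕ f · f) ⊖ ι (+ 2) · ((e · e) · (a · f) ⊖ (b · e) · (d · f))) · (J · i₂₄)
    ≈⟨ ·-congʳ (⊕-cong (·-cong (⊕-congʳ (·-congˡ φ₃-split)) (⊕-congʳ φ₆²))
        (⊟-cong (·-congˡ (⊕-cong (·-congʳ φ₆²) (⊟-cong (·-congˡ (·-congʳ φ₃-split))))))) ⟩
  ((a · (f ⊕ t) ⊖ b · e) · ((f · f ⊕ t · t) ⊕ f · f) ⊖ ι (+ 2) · ((f · f ⊕ t · t) · (a · f) ⊖ (b · e) · ((f ⊕ t) · f))) · (J · i₂₄)
    ≈⟨ solve 8 (λ a b e f x r j i → let t = con (+ 2) :* (x :* r) in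
        ((a :* (f :+ t) :- b :* e) :* ((f :* f :+ t :* t) :+ f :* f) :- con (+ 2) :* ((f :* f :+ t :* t) :* (a :* f) :- (b :* e) :* ((f :+ t) :* f))) :* (j :* i)
        := con (+ 2) :* (x :* ((a :* ((con (+ 2) :* (f :* f) :- f :* t) :+ t :* t) :+ (b :* e) :* (con (+ 2) :* f :- t)) :* j)) :* (r :* i)) ≈-refl a b e f (q^ 3) (dil 24 ψ) J i₂₄ ⟩
  (ι (+ 2) · (q^ 3 · (K · J))) · (dil 24 ψ · i₂₄)
    ≈⟨ ·-unit (dil-inverse 24 ψ·iψ) ⟩
  ι (+ 2) · (q^ 3 · (K · J)) ∎))
  where
  open ≈-Reasoning
  a b d e f J K P₆ M₆ PP MM PM MP : PS
  a = φ
  b = φ₂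
  d = dil 3 φ
  e = φ₆
  f = dil 12 φ
  J = iψ₄ · (i₁₂ · i₂₄)
  K = a · ((ι (+ 2) · (f · f) ⊖ f · t) ⊕ t · t) ⊕ (b · e) · (ι (+ 2) · f ⊖ t)
  P₆ = dil 6 G ⊕ q^ 6 · dil 6 G⁻¹
  M₆ = dil 6 G ⊖ q^ 6 · dil 6 G⁻¹
  PP = (G ⊕ q · G⁻¹) · (dil 3 G ⊕ q^ 3 · dil 3 G⁻¹)
  MM = (G ⊖ q · G⁻¹) · (dil 3 G ⊖ q^ 3 · dil 3 G⁻¹)
  PM = (G ⊕ q · G⁻¹) · (dil 3 G ⊖ q^ 3 · dil 3 G⁻¹)
  MP = (G ⊖ q · G⁻¹) · (dil 3 G ⊕ q^ 3 · dil 3 G⁻¹)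
  products : ι (+ 2) · ((q · q^ 2) · (ι (+ 4) · (R₈ ⊕ (q^ 4 · q^ 6) · R₈⁻¹))) ≈ (PP ⊖ MM) · (P₆ · P₆ ⊕ M₆ · M₆) ⊖ (PM ⊖ MP) · (ι (+ 2) · (P₆ · M₆))
  products = begin
    ι (+ 2) · ((q · q^ 2) · (ι (+ 4) · (R₈ ⊕ (q^ 4 · q^ 6) · R₈⁻¹)))
      ≈⟨ solve 10 (λ g h k l u v q x y z → con (+ 2) :* ((q :* x) :* (con (+ 4) :* ((g :* l) :* (u :* u) :+ (y :* z) :* ((h :* k) :* (v :* v))))) :=
        con (+ 8) :* (q :* (x :* ((g :* l) :* (u :* u)) :+ (x :* y) :* (z :* ((h :* k) :* (v :* v)))))) ≈-refl G G⁻¹ (dil 3 G) (dil 3 G⁻¹) (dil 6 G) (dil 6 G⁻¹) q (q^ 2) (q^ 4) (q^ 6) ⟩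
    ι (+ 8) · (q · (q^ 2 · ((G · dil 3 G⁻¹) · (dil 6 G · dil 6 G)) ⊕ (q^ 2 · q^ 4) · (q^ 6 · ((G⁻¹ · dil 3 G) · (dil 6 G⁻¹ · dil 6 G⁻¹)))))
      ≈⟨ ·-congˡ (·-congˡ (⊕-congˡ (·-congʳ (q^-+ 2 4)))) ⟩
    ι (+ 8) · (q · (q^ 2 · ((G · dil 3 G⁻¹) · (dil 6 G · dil 6 G)) ⊕ q^ 6 · (q^ 6 · ((G⁻¹ · dil 3 G) · (dil 6 G⁻¹ · dil 6 G⁻¹)))))
      ≈⟨ solve 9 (λ g h k l u v q x z → con (+ 8) :* (q :* (x :* ((g :* l) :* (u :* u)) :+ z :* (z :* ((h :* k) :* (v :* v))))) :=
        ((g :+ q :* h) :* (k :+ (q :* x) :* l) :- (g :- q :* h) :* (k :- (q :* x) :* l)) :* ((u :+ z :* v) :* (u :+ z :* v) :+ (u :- z :* v) :* (u :- z :* v))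
        :- ((g :+ q :* h) :* (k :- (q :* x) :* l) :- (g :- q :* h) :* (k :+ (q :* x) :* l)) :* (con (+ 2) :* ((u :+ z :* v) :* (u :- z :* v))))
        ≈-refl G G⁻¹ (dil 3 G) (dil 3 G⁻¹) (dil 6 G) (dil 6 G⁻¹) q (q^ 2) (q^ 6) ⟩
    ((G ⊕ q · G⁻¹) · (dil 3 G ⊕ (q · q^ 2) · dil 3 G⁻¹) ⊖ (G ⊖ q · G⁻¹) · (dil 3 G ⊖ (q · q^ 2) · dil 3 G⁻¹)) · (P₆ · P₆ ⊕ M₆ · M₆)
      ⊖ ((G ⊕ q · G⁻¹) · (dil 3 G ⊖ (q · q^ 2) · dil 3 G⁻¹) ⊖ (G ⊖ q · G⁻¹) · (dil 3 G ⊕ (q · q^ 2) · dil 3 G⁻¹)) · (ι (+ 2) · (P₆ · M₆))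
      ≈⟨ ⊕-cong (·-congʳ (⊕-cong (·-congˡ plus) (⊟-cong (·-congˡ minus)))) (⊟-cong (·-congʳ (⊕-cong (·-congˡ minus) (⊟-cong (·-congˡ plus))))) ⟩
    (PP ⊖ MM) · (P₆ · P₆ ⊕ M₆ · M₆) ⊖ (PM ⊖ MP) · (ι (+ 2) · (P₆ · M₆)) ∎
    where
    plus : dil 3 G ⊕ (q · q^ 2) · dil 3 G⁻¹ ≈ dil 3 G ⊕ q^ 3 · dil 3 G⁻¹
    plus = ⊕-congˡ (·-congʳ (q^-+ 1 2))
    minus : dil 3 G ⊖ (q · q^ 2) · dil 3 G⁻¹ ≈ dil 3 G ⊖ q^ 3 · dil 3 G⁻¹
    minus = ⊕-congˡ (⊟-cong (·-congʳ (q^-+ 1 2)))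

-- The terms outside the class 1 modulo 4. The omitted ones give 4qV(q⁴) and -4q⁵; since the odd
-- part of V is -q, they leave -8q⁵ and exponents 1 modulo 8.
remainder₈ : PS
remainder₈ = (φ₄ · ((ι (+ 2) · (dil 12 φ · dil 12 φ) ⊖ dil 12 φ · t) ⊕ t · t) ⊕ s · (t · t ⊖ dil 12 φ · t))
  ⊕ (W · (ι (+ 2) · dil 12 φ ⊖ t) ⊕ ι (+ 4) · (q^ 2 · ((ψ₄ · ψ₁₂) · dil 12 φ)))

within-remainder₈ : Within 4 _ (remainder₈ · (iψ₄ · (i₁₂ · i₂₄)))
within-remainder₈ = within-·
  (within-⊕ (within-⊕ (within-· within-φ₄ (within-⊕ (within-⊖ (within-· (within-constant (+ 2)) (within-· within-φ₁₂ within-φ₁₂)) (within-· within-φ₁₂ within-t)) (within-· within-t within-t)))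
      (within-· within-s (within-⊖ (within-· within-t within-t) (within-· within-φ₁₂ within-t))))
    (within-⊕ (within-· within-W (within-⊖ (within-· (within-constant (+ 2)) within-φ₁₂) within-t))
      (within-term (+ 4) 2 (within-· (within-· (within-dil 4 ψ) (within-dil 12 ψ)) within-φ₁₂))))
  (within-· (within-dil 4 iψ) (within-· (within-dil 12 iψ) (within-dil 24 iψ)))

R₈-dissection : ι (+ 4) · (R₈ ⊕ q^ 10 · R₈⁻¹) ≈
  (remainder₈ · (iψ₄ · (i₁₂ · i₂₄)) ⊕ ι (+ 4) · (q^ 1 · dil 4 V-even)) ⊕ ι (- + 8) · q^ 5
R₈-dissection = begin
  ι (+ 4) · (R₈ ⊕ q^ 10 · R₈⁻¹)
    ≈⟨ R₈-equation ⟩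
  (φ · ((ι (+ 2) · (dil 12 φ · dil 12 φ) ⊖ dil 12 φ · t) ⊕ t · t) ⊕ (φ₂ · φ₆) · (ι (+ 2) · dil 12 φ ⊖ t)) · J
    ≈⟨ ·-congʳ (⊕-cong (·-congʳ φ-dissection₁) (·-congʳ φ₂·φ₆-dissection)) ⟩
  ((φ₄ ⊕ s) · ((ι (+ 2) · (dil 12 φ · dil 12 φ) ⊖ dil 12 φ · t) ⊕ t · t) ⊕ (W ⊕ ι (+ 2) · (q^ 2 · (ψ₄ · ψ₁₂))) · (ι (+ 2) · dil 12 φ ⊖ t)) · J
    ≈⟨ solve 13 (λ f x r c q p w u v i j k y → let s = con (+ 2) :* (q :* p) ; t = con (+ 2) :* (x :* r) in
        ((c :+ s) :* ((con (+ 2) :* (f :* f) :- f :* t) :+ t :* t) :+ (w :+ con (+ 2) :* (y :* (u :* v))) :* (con (+ 2) :* f :- t)) :* (i :* (j :* k))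
        := (((c :* ((con (+ 2) :* (f :* f) :- f :* t) :+ t :* t) :+ s :* (t :* t :- f :* t)) :+ (w :* (con (+ 2) :* f :- t) :+ con (+ 4) :* (y :* ((u :* v) :* f)))) :* (i :* (j :* k))
        :+ con (+ 4) :* (q :* ((f :* f) :* (p :* (i :* (j :* k)))))) :+ con (- + 4) :* ((y :* x) :* ((u :* i) :* ((v :* j) :* (r :* k)))))
        ≈-refl (dil 12 φ) (q^ 3) (dil 24 ψ) φ₄ q ψ₈ W ψ₄ ψ₁₂ iψ₄ i₁₂ i₂₄ (q^ 2) ⟩
  (remainder₈ · J ⊕ ι (+ 4) · (q · ((dil 12 φ · dil 12 φ) · (ψ₈ · J)))) ⊕ ι (- + 4) · ((q^ 2 · q^ 3) · ((ψ₄ · iψ₄) · ((ψ₁₂ · i₁₂) · (dil 24 ψ · i₂₄))))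
    ≈⟨ ⊕-cong (⊕-congˡ (·-congˡ (·-congˡ V₄))) (·-congˡ (≈-trans (·-cong (q^-+ 2 3) units) (·-onePS _))) ⟩
  (remainder₈ · J ⊕ ι (+ 4) · (q · (dil 4 V-even ⊖ q^ 4))) ⊕ ι (- + 4) · q^ 5
    ≈⟨ ⊕-congʳ (⊕-congˡ (·-congˡ (≈-trans (solve 3 (λ q v y → q :* (v :- y) := q :* v :- q :* y) ≈-refl q (dil 4 V-even) (q^ 4)) (⊕-congˡ (⊟-cong (q^-+ 1 4)))))) ⟩
  (remainder₈ · J ⊕ ι (+ 4) · (q · dil 4 V-even ⊖ q^ 5)) ⊕ ι (- + 4) · q^ 5
    ≈⟨ solve 3 (λ r v y → (r :+ con (+ 4) :* (v :- y)) :+ con (- + 4) :* y := (r :+ con (+ 4) :* v) :+ con (- + 8) :* y) ≈-refl (remainder₈ · J) (q · dil 4 V-even) (q^ 5) ⟩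
  (remainder₈ · J ⊕ ι (+ 4) · (q^ 1 · dil 4 V-even)) ⊕ ι (- + 8) · q^ 5 ∎
  where
  open ≈-Reasoning
  J : PS
  J = iψ₄ · (i₁₂ · i₂₄)
  units : (ψ₄ · iψ₄) · ((ψ₁₂ · i₁₂) · (dil 24 ψ · i₂₄)) ≈ onePS
  units = unit-·-unit ψ₄·iψ₄ (unit-·-unit (dil-inverse 12 ψ·iψ) (dil-inverse 24 ψ·iψ))
  V₄ : (dil 12 φ · dil 12 φ) · (ψ₈ · J) ≈ dil 4 V-even ⊖ q^ 4
  V₄ = begin
    (dil 12 φ · dil 12 φ) · (ψ₈ · (iψ₄ · (i₁₂ · i₂₄)))
      ≈⟨ ·-cong (·-cong (dil-dil 4 3 φ) (dil-dil 4 3 φ)) (·-cong (dil-dil 4 2 ψ) (·-congˡ (·-cong (dil-dil 4 3 iψ) (dil-dil 4 6 iψ)))) ⟨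
    (dil 4 (dil 3 φ) · dil 4 (dil 3 φ)) · (dil 4 ψ₂ · (iψ₄ · (dil 4 iψ₃ · dil 4 iψ₆)))
      ≈⟨ dil-product₄ (dil 3 φ) ψ₂ iψ iψ₃ iψ₆ ⟨
    dil 4 V
      ≈⟨ ≈-trans (dil-cong 4 V-dissection) (dil-⊕ 4 V-even (⊟ q)) ⟩
    dil 4 V-even ⊕ dil 4 (⊟ q)
      ≈⟨ ⊕-congˡ (≈-trans (dil-⊟ 4 q) (⊟-cong (dil-q^ 4 1))) ⟩
    dil 4 V-even ⊖ q^ 4 ∎

part-xxii : Vanishes 8 13 (R₈ ⊕ q^ 10 · R₈⁻¹)
part-xxii = vanishes-constant⁻¹ 3 (vanishes-≈ R₈-dissection (vanishes-⊕
  (vanishes-⊕ (vanishes-refine 2 (within-vanishes {4} 13 within-remainder₈))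
    (within-vanishes 13 (within-term (+ 4) 1 (within-dil-scaled {2} 4 within-V-even))))
  (vanishes-q^ 8 13 (- + 8) 5)))

-- The theorem

fraction-denominator : ∀ {f g g′ A A′} → g ≈ g′ → Fraction f g A A′ → Fraction f g′ A A′
fraction-denominator p F = record
  { numerator₀ = numerator₀ F ; denominator₀ = trans (sym (p .at 0)) (denominator₀ F)
  ; ratio = ≈-trans (ratio F) (·-congˡ p) ; inverse = inverse F }

T/S : Fraction T S G⁻¹ G
T/S = fraction-swap S/T

ρ₁-fraction : ∀ k → Fraction (powPS k S) (powPS k T) (powPS k G) (powPS k G⁻¹)
ρ₁-fraction k = fraction-pow k S/T

ρ₁-fraction-1 : Fraction (powPS 1 S) (powPS 1 T) G G⁻¹
ρ₁-fraction-1 = fraction-≈ (powPS-1 G) (powPS-1 G⁻¹) (ρ₁-fraction 1)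

ρ₁-fraction-2 : Fraction (powPS 2 S) (powPS 2 T) (G · G) (G⁻¹ · G⁻¹)
ρ₁-fraction-2 = fraction-≈ (powPS-2 G) (powPS-2 G⁻¹) (ρ₁-fraction 2)

ρ₁-fraction-4 : Fraction (powPS 4 S) (powPS 4 T) ((G · G) · (G · G)) ((G⁻¹ · G⁻¹) · (G⁻¹ · G⁻¹))
ρ₁-fraction-4 = fraction-≈ (powPS-4 G) (powPS-4 G⁻¹) (ρ₁-fraction 4)

ρ₂-fraction : ∀ k .{{_ : NonZero k}} → Fraction (T ⊛ dil k S) (S ⊛ dil k T) (G⁻¹ · dil k G) (G · dil k G⁻¹)
ρ₂-fraction k = fraction-⊛ T/S (fraction-dil k S/T)

ρ₃-fraction : ∀ k .{{_ : NonZero k}} → Fraction (S ⊛ dil k S) (T ⊛ dil k T) (G · dil k G) (G⁻¹ · dil k G⁻¹)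
ρ₃-fraction k = fraction-⊛ S/T (fraction-dil k S/T)

ρ₄-fraction : Fraction (dil 2 T ⊛ dil 4 S) (dil 2 S ⊛ dil 4 T) (dil 2 G⁻¹ · dil 4 G) (dil 2 G · dil 4 G⁻¹)
ρ₄-fraction = fraction-⊛ (fraction-dil 2 T/S) (fraction-dil 4 S/T)

ρ₅-fraction : ∀ k → Fraction (powPS k (neg S) ⊛ powPS k T ⊛ powPS k (dil 4 S)) (powPS k S ⊛ powPS k (neg T) ⊛ powPS k (dil 4 T))
  ((powPS k (neg G) · powPS k G⁻¹) · powPS k (dil 4 G)) ((powPS k (neg G⁻¹) · powPS k G) · powPS k (dil 4 G⁻¹))
ρ₅-fraction k = fraction-⊛ (fraction-denominator commute (fraction-⊛ (fraction-pow k (fraction-neg S/T)) (fraction-pow k T/S))) (fraction-pow k (fraction-dil 4 S/T))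
  where
  commute : powPS k (neg T) ⊛ powPS k S ≈ powPS k S ⊛ powPS k (neg T)
  commute = ≈-trans (≈-sym (·≈⊛ (powPS k (neg T)) (powPS k S))) (≈-trans (·-comm _ _) (·≈⊛ (powPS k S) (powPS k (neg T))))

ρ₅-fraction-1 : Fraction (powPS 1 (neg S) ⊛ powPS 1 T ⊛ powPS 1 (dil 4 S)) (powPS 1 S ⊛ powPS 1 (neg T) ⊛ powPS 1 (dil 4 T)) R₅ R₅⁻¹
ρ₅-fraction-1 = fraction-≈ (·-cong (·-cong (powPS-1 (neg G)) (powPS-1 G⁻¹)) (powPS-1 (dil 4 G)))
  (·-cong (·-cong (powPS-1 (neg G⁻¹)) (powPS-1 G)) (powPS-1 (dil 4 G⁻¹))) (ρ₅-fraction 1)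

ρ₅-fraction-2 : Fraction (powPS 2 (neg S) ⊛ powPS 2 T ⊛ powPS 2 (dil 4 S)) (powPS 2 S ⊛ powPS 2 (neg T) ⊛ powPS 2 (dil 4 T)) (R₅ · R₅) (R₅⁻¹ · R₅⁻¹)
ρ₅-fraction-2 = fraction-≈ (square (neg G) G⁻¹ (dil 4 G)) (square (neg G⁻¹) G (dil 4 G⁻¹)) (ρ₅-fraction 2)
  where
  square : ∀ f g h → (powPS 2 f · powPS 2 g) · powPS 2 h ≈ ((f · g) · h) · ((f · g) · h)
  square f g h = ≈-trans (·-cong (·-cong (powPS-2 f) (powPS-2 g)) (powPS-2 h))
    (solve 3 (λ f g h → ((f :* f) :* (g :* g)) :* (h :* h) := ((f :* g) :* h) :* ((f :* g) :* h)) ≈-refl f g h)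

cancel₂ : ∀ k .{{_ : NonZero k}} f → (dil k G · f) · dil k G⁻¹ ≈ f
cancel₂ k f = ≈-trans (solve 3 (λ g f h → (g :* f) :* h := (g :* h) :* f) ≈-refl (dil k G) f (dil k G⁻¹)) (≈-trans (·-congʳ (dil-inverse k G·G⁻¹)) (·-identityˡ f))

cancel₂⁻¹ : ∀ k .{{_ : NonZero k}} f → (f · dil k G⁻¹) · dil k G ≈ f
cancel₂⁻¹ k f = ≈-trans (solve 3 (λ g f h → (f :* h) :* g := (g :* f) :* h) ≈-refl (dil k G) f (dil k G⁻¹)) (cancel₂ k f)

-- By G(-q) = G(q²)/G(q) the factors at q² cancel, and ρ₆ is the same series as ρ₂ for k = 3.
ρ₆-fraction : Fraction (neg S ⊛ dil 2 T ⊛ dil 3 S) (neg T ⊛ dil 2 S ⊛ dil 3 T) (G⁻¹ · dil 3 G) (G · dil 3 G⁻¹)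
ρ₆-fraction = fraction-≈ (·-congʳ (≈-trans (·-congʳ neg-G) (cancel₂ 2 G⁻¹))) (·-congʳ (≈-trans (·-congʳ neg-G⁻¹) (cancel₂⁻¹ 2 G)))
  (fraction-⊛ (fraction-⊛ (fraction-neg S/T) (fraction-dil 2 T/S)) (fraction-dil 3 S/T))

ρ₇-fraction : Fraction (neg T ⊛ dil 2 T ⊛ dil 3 S) (neg S ⊛ dil 2 S ⊛ dil 3 T) R₇ R₇⁻¹
ρ₇-fraction = fraction-≈ (·-congʳ (≈-trans (·-congʳ neg-G⁻¹) (·-assoc _ _ _)))
  (·-congʳ (≈-trans (·-congʳ neg-G) (solve 2 (λ u h → (u :* h) :* u := h :* (u :* u)) ≈-refl (dil 2 G) G⁻¹)))
  (fraction-⊛ (fraction-⊛ (fraction-neg T/S) (fraction-dil 2 T/S)) (fraction-dil 3 S/T))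

dil-3-neg-G : dil 3 (neg G) ≈ dil 6 G · dil 3 G⁻¹
dil-3-neg-G = ≈-trans (dil-cong 3 neg-G) (≈-trans (dil-· 3 (dil 2 G) G⁻¹) (·-congʳ (dil-dil 3 2 G)))

dil-3-neg-G⁻¹ : dil 3 (neg G⁻¹) ≈ dil 3 G · dil 6 G⁻¹
dil-3-neg-G⁻¹ = ≈-trans (dil-cong 3 neg-G⁻¹) (≈-trans (dil-· 3 G (dil 2 G⁻¹)) (·-congˡ (dil-dil 3 2 G⁻¹)))

ρ₈-fraction : Fraction (S ⊛ dil 3 (neg S) ⊛ dil 6 S) (T ⊛ dil 3 (neg T) ⊛ dil 6 T) R₈ R₈⁻¹
ρ₈-fraction = fraction-≈
  (≈-trans (·-congʳ (·-congˡ dil-3-neg-G)) (solve 3 (λ g u l → (g :* (u :* l)) :* u := (g :* l) :* (u :* u)) ≈-refl G (dil 6 G) (dil 3 G⁻¹)))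
  (≈-trans (·-congʳ (·-congˡ dil-3-neg-G⁻¹)) (solve 3 (λ h v k → (h :* (k :* v)) :* v := (h :* k) :* (v :* v)) ≈-refl G⁻¹ (dil 6 G⁻¹) (dil 3 G)))
  (fraction-⊛ (fraction-⊛ S/T (fraction-dil 3 (fraction-neg S/T))) (fraction-dil 6 S/T))

-- The factors at q⁶ cancel because 1/G(-q³) = G(q³)/G(q⁶), so ρ₉ is the same series as ρ₃ for k =
-- 3.
ρ₉-fraction : Fraction (S ⊛ dil 3 (neg T) ⊛ dil 6 S) (T ⊛ dil 3 (neg S) ⊛ dil 6 T) (G · dil 3 G) (G⁻¹ · dil 3 G⁻¹)
ρ₉-fraction = fraction-≈
  (≈-trans (·-congʳ (≈-trans (·-congˡ dil-3-neg-G⁻¹) (≈-sym (·-assoc _ _ _)))) (cancel₂⁻¹ 6 (G · dil 3 G)))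
  (≈-trans (·-congʳ (≈-trans (·-congˡ dil-3-neg-G) (solve 3 (λ h u l → h :* (u :* l) := u :* (h :* l)) ≈-refl G⁻¹ (dil 6 G) (dil 3 G⁻¹)))) (cancel₂ 6 (G⁻¹ · dil 3 G⁻¹)))
  (fraction-⊛ (fraction-⊛ S/T (fraction-dil 3 (fraction-neg T/S))) (fraction-dil 6 S/T))

theorem1p5 : (∀ (n : ℕ) → ρ₁ 1 (2 * n + 1) ≡ ρ₁′ 1 (2 * n))
    × (∀ (n : ℕ) → ρ₁ 1 (4 * n + 2) ≡ - ρ₁′ 1 (4 * n + 1))
    × (∀ (n : ℕ) → ρ₁ 2 (2 * n + 3) ≡ - ρ₁′ 2 (2 * n + 1))
    × (∀ (n : ℕ) → ρ₁ 2 (8 * n + 4) ≡ ρ₁′ 2 (8 * n + 2))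
    × (∀ (n : ℕ) → ρ₁ 2 (8 * n + 6) ≡ ρ₁′ 2 (8 * n + 4))
    × (∀ (n : ℕ) → ρ₁ 4 (4 * n + 6) ≡ - ρ₁′ 4 (4 * n + 2))
    × (∀ (n : ℕ) → ρ₂ 3 (4 * n + 5) ≡ - ρ₂′ 3 (4 * n + 3))
    × (∀ (n : ℕ) → ρ₂ 5 (4 * n + 6) ≡ - ρ₂′ 5 (4 * n + 2))
    × (∀ (n : ℕ) → ρ₂ 7 (4 * n + 7) ≡ - ρ₂′ 7 (4 * n + 1))
    × (∀ (n : ℕ) → ρ₂ 9 (4 * n + 10) ≡ - ρ₂′ 9 (4 * n + 2))
    × (∀ (n : ℕ) → ρ₃ 3 (4 * n + 6) ≡ - ρ₃′ 3 (4 * n + 2))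
    × (∀ (n : ℕ) → ρ₃ 5 (4 * n + 7) ≡ - ρ₃′ 5 (4 * n + 1))
    × (∀ (n : ℕ) → ρ₃ 9 (4 * n + 11) ≡ - ρ₃′ 9 (4 * n + 1))
    × (∀ (n : ℕ) → ρ₄ (4 * n + 2) ≡ - ρ₄′ (4 * n))
    × (∀ (n : ℕ) → ρ₅ 1 (4 * n + 6) ≡ - ρ₅′ 1 (4 * n + 2))
    × (∀ (n : ℕ) → ρ₅ 1 (4 * n + 7) ≡ ρ₅′ 1 (4 * n + 3))
    × (∀ (n : ℕ) → ρ₅ 1 (8 * n + 4) ≡ - ρ₅′ 1 (8 * n))
    × (∀ (n : ℕ) → ρ₅ 1 (8 * n + 5) ≡ ρ₅′ 1 (8 * n + 1))
    × (∀ (n : ℕ) → ρ₅ 2 (8 * n + 12) ≡ - ρ₅′ 2 (8 * n + 4))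
    × (∀ (n : ℕ) → ρ₆ (4 * n + 5) ≡ - ρ₆′ (4 * n + 3))
    × (∀ (n : ℕ) → ρ₇ (8 * n + 8) ≡ - ρ₇′ (8 * n + 8))
    × (∀ (n : ℕ) → ρ₈ (8 * n + 13) ≡ - ρ₈′ (8 * n + 3))
    × (∀ (n : ℕ) → ρ₉ (4 * n + 6) ≡ - ρ₉′ (4 * n + 2))
theorem1p5 =
    (λ n → trans (symmetric {2} {0} 1 ρ₁-fraction-1 part-i n) (cong (ρ₁′ 1) (ℕP.+-identityʳ (2 * n))))
  , antisymmetric {4} {1} 1 ρ₁-fraction-1 part-ii
  , antisymmetric {2} {1} 2 ρ₁-fraction-2 part-iii
  , symmetric {8} {2} 2 ρ₁-fraction-2 part-iv
  , symmetric {8} {4} 2 ρ₁-fraction-2 part-v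
  , antisymmetric {4} {2} 4 ρ₁-fraction-4 part-vi
  , antisymmetric {4} {3} 2 (ρ₂-fraction 3) part-vii
  , antisymmetric {4} {2} 4 (ρ₂-fraction 5) part-viii
  , antisymmetric {4} {1} 6 (ρ₂-fraction 7) part-ix
  , antisymmetric {4} {2} 8 (ρ₂-fraction 9) part-x
  , antisymmetric {4} {2} 4 (ρ₃-fraction 3) part-xi
  , antisymmetric {4} {1} 6 (ρ₃-fraction 5) part-xii
  , antisymmetric {4} {1} 10 (ρ₃-fraction 9) part-xiii
  , (λ n → trans (antisymmetric {4} {0} 2 ρ₄-fraction part-xiv n) (cong (λ k → - ρ₄′ k) (ℕP.+-identityʳ (4 * n))))
  , antisymmetric {4} {2} 4 ρ₅-fraction-1 part-xv
  , symmetric {4} {3} 4 ρ₅-fraction-1 part-xvi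
  , (λ n → trans (antisymmetric {8} {0} 4 ρ₅-fraction-1 part-xvii n) (cong (λ k → - ρ₅′ 1 k) (ℕP.+-identityʳ (8 * n))))
  , symmetric {8} {1} 4 ρ₅-fraction-1 part-xviii
  , antisymmetric {8} {4} 8 ρ₅-fraction-2 part-xix
  , antisymmetric {4} {3} 2 ρ₆-fraction part-vii
  , antisymmetric {8} {8} 0 ρ₇-fraction part-xxi
  , antisymmetric {8} {3} 10 ρ₈-fraction part-xxii
  , antisymmetric {4} {2} 4 ρ₉-fraction part-xi
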